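{- For all integers $n,a,b,c\ge 1$, $$\mathrm{topo}(G_S(n,a,b,c))=\left(n(a+b-1)+\binom{n}{2}\cdot 2c\right)!\prod_{j=0}^{n-1}\frac{(a+cj-1)!\,(b+cj-1)!\,(c+cj-1)!}{(c-1)!\,(a+b+(j+n-1)c-1)!}.$$
   Context: For a directed acyclic graph $G=(V,E)$ with $|V|$ vertices, a topological ordering is a bijection $f:V\to\{1,\dots,|V|\}$ such that $f(u)>f(v)$ for every directed edge $u\to v$; $\mathrm{topo}(G)$ denotes the number of topological orderings of $G$. For integers $n,a,b,c\ge1$, $G_S(n,a,b,c)$ is the directed graph with vertex set consisting of $x_1,\dots,x_n$; $p_{i,k}$ for $i\in[n]$, $k\in[a-1]$; $q_{i,k}$ for $i\in[n]$, $k\in[b-1]$; and $r_{i,j,k}$ for $1\le i<j\le n$, $k\in[2c]$; and edges $x_{i+1}\to x_i$ for $i\in[n-1]$; $x_i\to p_{i,k}$ for all $i,k$; $q_{i,k}\to x_i$ for all $i,k$; and $x_j\to r_{i,j,k}\to x_i$ (two edges) for all $1\le i<j\le n$, $k\in[2c]$. Here $[m]=\{1,\dots,m\}$ (empty if $m\le 0$). -}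

module Defs where

open import Data.Nat using (ℕ; zero; suc; _+_; _*_; _∸_; _≡ᵇ_)
open import Data.Bool using (Bool; true; false; T; T?)
open import Data.Fin using (Fin; _<?_) renaming (_<_ to _<ᶠ_; _≟_ to _≟ᶠ_)
open import Data.Fin.Properties using (all?; any?)
open import Data.List using (List; []; _∷_; _++_; map; concatMap; upTo; length; lookup; filter; allFin)
open import Data.Nat.ListAction using (product)
open import Data.Vec using (Vec; []; _∷_) renaming (lookup to lookupᵥ)
open import Data.Product using (_×_; ∃; _,_)
open import Relation.Binary.PropositionalEquality using (_≡_)
open import Relation.Nullary using (Dec)
open import Relation.Nullary.Decidable using (_×-dec_; _→-dec_)

-- Generic: number of topological orderings of a finite digraph.
--
-- A digraph is given by a list `vs` enumerating its vertices (each vertex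
-- exactly once) and a Boolean edge relation `E` (E u v = true iff u → v).
-- With N = length vs, an ordering f : V → {1..N} is represented by the
-- vector ℓ of its values along the enumeration: f (vs ! i) = 1 + ℓ ! i
-- (values in Fin N, i.e. {0..N-1}, shifted by one; order is unaffected).

allVecs : (k N : ℕ) → List (Vec (Fin N) k)
allVecs zero    N = [] ∷ []
allVecs (suc k) N = concatMap (λ i → map (i ∷_) (allVecs k N)) (allFin N)

module _ {V : Set} (vs : List V) (E : V → V → Bool) where

  N : ℕ
  N = length vs

  IsTopoOrdering : Vec (Fin N) N → Set
  IsTopoOrdering ℓ =
      (∀ i j → lookupᵥ ℓ i ≡ lookupᵥ ℓ j → i ≡ j)
    × (∀ y → ∃ λ i → lookupᵥ ℓ i ≡ y)
    × (∀ i j → T (E (lookup vs i) (lookup vs j)) → lookupᵥ ℓ j <ᶠ lookupᵥ ℓ i)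

  isTopoOrdering? : (ℓ : Vec (Fin N) N) → Dec (IsTopoOrdering ℓ)
  isTopoOrdering? ℓ =
        all? (λ i → all? (λ j → (lookupᵥ ℓ i ≟ᶠ lookupᵥ ℓ j) →-dec (i ≟ᶠ j)))
    ×-dec all? (λ y → any? (λ i → lookupᵥ ℓ i ≟ᶠ y))
    ×-dec all? (λ i → all? (λ j → T? (E (lookup vs i) (lookup vs j))
                                    →-dec (lookupᵥ ℓ j <? lookupᵥ ℓ i)))

  topo : ℕ
  topo = length (filter isTopoOrdering? (allVecs N N))

range1 : ℕ → List ℕ
range1 m = map suc (upTo m)

data Vtx : Set where
  x : ℕ → Vtx
  p : ℕ → ℕ → Vtx
  q : ℕ → ℕ → Vtx
  r : ℕ → ℕ → ℕ → Vtx

GS-vertices : ℕ → ℕ → ℕ → ℕ → List Vtx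
GS-vertices n a b c =
     map x (range1 n)
  ++ concatMap (λ i → map (p i) (range1 (a ∸ 1))) (range1 n)
  ++ concatMap (λ i → map (q i) (range1 (b ∸ 1))) (range1 n)
  ++ concatMap (λ j → concatMap (λ i → map (r i j) (range1 (2 * c)))
                                (range1 (j ∸ 1)))
               (range1 n)

-- edge relation of G_S (only ever applied to vertices of GS-vertices):
--   x_{i+1} → x_i,  x_i → p_{i,k},  q_{i,k} → x_i,  x_j → r_{i,j,k} → x_i
GS-edge : Vtx → Vtx → Bool
GS-edge (x j)     (x i)      = j ≡ᵇ suc i
GS-edge (x i)     (p i′ k)   = i ≡ᵇ i′
GS-edge (q i k)   (x i′)     = i ≡ᵇ i′
GS-edge (x j′)    (r i j k)  = j′ ≡ᵇ j
GS-edge (r i j k) (x i′)     = i ≡ᵇ i′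
GS-edge _         _          = false

topoGS : ℕ → ℕ → ℕ → ℕ → ℕ
topoGS n a b c = topo (GS-vertices n a b c) GS-edge

prodRange : ℕ → (ℕ → ℕ) → ℕ
prodRange n f = product (map f (upTo n))

{-# OPTIONS --safe #-}
module Submission where

-- Only the gaps cut out by the chain x_1 < ... < x_n matter: the vertices in a gap holding m
-- of them can be ordered in m! ways. Writing y_0, ..., y_n for the gaps and Λ for the linear
-- functional with Λ(y^m) = ∏ m_g!, the number of orderings is Λ(Φ), where Φ has one factor
-- for each vertex other than the x_i, namely the sum of the gaps available to it. With
-- z_i = y_0 + ... + y_(i-1) and t the sum of all gaps,
--   Φ = ∏ z_i^(a-1) (t - z_i)^(b-1) ∏_(i<j) (z_j - z_i)^(2c),
-- and Λ is the integral against exp(-t), so Λ(Φ) is a Selberg integral. It is evaluated by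
-- Aomoto's method: with ∂_i = ∂/∂z_i, the vanishing of
--   Σ_i Λ(∂_i (z_i (t - z_i) e_k(z without z_i) Φ))
-- relates Λ(e_k Φ) to Λ(e_(k+1) Φ); going from k = 0 to k = n raises a by one. The reflection
-- z ↦ t - z does the same for b, and for a = b = 1 the vertex x_n is on top, so removing it
-- leads from (n, 1, 1) to (n - 1, 1, 2c + 1).

open import Algebra.Bundles using (CommutativeRing)
import Algebra.Properties.Semiring.Sum as SemiringSum
import Algebra.Solver.Ring as RingSolver
open import Algebra.Solver.Ring.AlmostCommutativeRing using (fromCommutativeRing; _-Raw-AlmostCommutative⟶_)
open import Data.Bool using (Bool; true; false; T; T?; not; if_then_else_)
open import Data.Bool.ListAction using (all)
open import Data.Empty using (⊥-elim)
open import Data.Fin as Fin using (Fin; zero; suc; inject₁; fromℕ; punchIn; punchOut; lower₁; toℕ)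
import Data.Fin.Properties as Finₚ
open import Data.Integer as ℤ using (ℤ; +_; _+_; _*_; -_; 0ℤ; 1ℤ; -1ℤ)
import Data.Integer.Properties as ℤₚ
open import Data.Integer.Tactic.RingSolver using (solve-∀)
open import Data.List as List using (List; []; _∷_; _++_; _∷ʳ_; map; concatMap; upTo; allFin; filter; length)
open import Data.List.Membership.Propositional using (_∈_; lose)
open import Data.List.Membership.Propositional.Properties using (∈-concatMap⁺; ∈-concatMap⁻; ∈-map⁺; ∈-map⁻; ∈-filter⁺; ∈-filter⁻; ∈-allFin)
open import Data.List.Membership.Propositional.Properties.WithK using (unique∧set⇒bag)
import Data.List.Properties as Listₚ
open import Data.List.Relation.Binary.BagAndSetEquality using (∼bag⇒↭)
open import Data.List.Relation.Binary.Permutation.Propositional.Properties using (↭-length)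
open import Data.List.Relation.Unary.All as All using (All; []; _∷_)
import Data.List.Relation.Unary.All.Properties as Allₚ
open import Data.List.Relation.Unary.AllPairs using ([]; _∷_)
open import Data.List.Relation.Unary.Any as Any using (Any; here; there)
import Data.List.Relation.Unary.Any.Properties as Anyₚ
open import Data.List.Relation.Unary.Unique.Propositional using (Unique)
import Data.List.Relation.Unary.Unique.Propositional.Properties as Uniqueₚ
open import Data.Maybe using (Maybe; just; nothing)
open import Data.Nat as ℕ using (ℕ; zero; suc; pred; _!; _≤_; _<_; z≤n; s≤s)
open import Data.Nat.Combinatorics using (_C_; nC1≡n; nCk+nC[k+1]≡[n+1]C[k+1])
open import Data.Nat.ListAction using (product) renaming (sum to sumℕ)
open import Data.Nat.ListAction.Properties using (product-++)
import Data.Nat.Properties as ℕₚ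
open import Data.Nat.Tactic.RingSolver using () renaming (solve-∀ to ℕ-solve-∀)
open import Data.Product using (_×_; _,_; ∃; proj₁; proj₂)
open import Data.Sum using (_⊎_; inj₁; inj₂)
open import Data.Unit using (⊤; tt)
open import Data.Vec as Vec using (Vec; []; _∷_; zipWith; replicate; lookup; insertAt; removeAt; toList; fromList; tabulate)
import Data.Vec.Properties as Vecₚ
open import Function using (_∘_; id; mk⇔)
open import Relation.Binary.Bundles using (Setoid)
open import Relation.Binary.PropositionalEquality using (_≡_; _≢_; refl; sym; trans; cong; cong₂; subst; subst₂; module ≡-Reasoning)
import Relation.Binary.Reasoning.Setoid as SetoidReasoning
open import Relation.Nullary using (¬_; Dec; yes; no)
open import Relation.Nullary.Decidable using (_×-dec_; _→-dec_)

-- Polynomials as expressions modulo linear functionals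

-- The argument is purely algebraic. Polynomials are compared through all linear functionals, so an
-- operation on expressions respects `≈` as soon as it has a transpose. The obstacle in Aomoto's
-- method is its denominators z_i - z_j. They are avoided by carrying separate polynomials `G i j`
-- with (z_i - z_j) `G i j` = Φ, which exist because the exponent 2c is positive. The factor z_i (t
-- - z_i) is there to remove boundary terms: in gap coordinates ∂_i is the derivative in the gap
-- below a chain vertex minus that in the gap above it, and the differentiated polynomial is
-- divisible by both gaps, so that the two terms have the same value under Λ. The weight exp(-t)
-- replaces the usual range 0 ≤ z_i ≤ 1 because its moments are the factorials that count the orders
-- within a gap. The price is a stray factor t in the recursion; Euler's identity for homogeneous
-- polynomials turns it into a number, and these numbers build up the leading factorial of the
-- formula. All identities are kept with cleared denominators, since the values lie in ℤ.

Mon : ℕ → Set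
Mon K = Vec ℕ K

infixl 7 _·_
_·_ : ∀ {K} → Mon K → Mon K → Mon K
_·_ = zipWith ℕ._+_

𝟘 : ∀ {K} → Mon K
𝟘 = replicate _ 0

unit : ∀ {K} → Fin K → Mon K
unit zero    = 1 ∷ 𝟘
unit (suc g) = 0 ∷ unit g

·-identityˡ : ∀ {K} (m : Mon K) → 𝟘 · m ≡ m
·-identityˡ []      = refl
·-identityˡ (k ∷ m) = cong (k ∷_) (·-identityˡ m)

·-comm : ∀ {K} (m m′ : Mon K) → m · m′ ≡ m′ · m
·-comm []      []        = refl
·-comm (k ∷ m) (k′ ∷ m′) = cong₂ _∷_ (ℕₚ.+-comm k k′) (·-comm m m′)

·-assoc : ∀ {K} (m m′ m″ : Mon K) → (m · m′) · m″ ≡ m · (m′ · m″)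
·-assoc []      []        []        = refl
·-assoc (k ∷ m) (k′ ∷ m′) (k″ ∷ m″) = cong₂ _∷_ (ℕₚ.+-assoc k k′ k″) (·-assoc m m′ m″)

infixl 6 _⊕_ _⊖_
infixl 7 _⊗_
data Poly (K : ℕ) : Set where
  con     : ℤ → Poly K
  var     : Fin K → Poly K
  _⊕_ _⊗_ : Poly K → Poly K → Poly K

neg : ∀ {K} → Poly K → Poly K
neg p = con -1ℤ ⊗ p

_⊖_ : ∀ {K} → Poly K → Poly K → Poly K
p ⊖ q = p ⊕ neg q

-- ⟪ p ⟫ φ is the value at p of the linear functional that sends each monomial m to φ m.
⟪_⟫ : ∀ {K} → Poly K → (Mon K → ℤ) → ℤ
⟪ con c ⟫ φ = c * φ 𝟘
⟪ var g ⟫ φ = φ (unit g)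
⟪ p ⊕ q ⟫ φ = ⟪ p ⟫ φ + ⟪ q ⟫ φ
⟪ p ⊗ q ⟫ φ = ⟪ p ⟫ (λ m → ⟪ q ⟫ (λ m′ → φ (m · m′)))

-- Linear functionals separate polynomials, so this is equality of the polynomials denoted.
infix 4 _≈_
record _≈_ {K} (p q : Poly K) : Set where
  constructor mk≈
  field pairing : ∀ φ → ⟪ p ⟫ φ ≡ ⟪ q ⟫ φ
open _≈_ public

pairing-cong : ∀ {K} (p : Poly K) {φ ψ : Mon K → ℤ} → (∀ m → φ m ≡ ψ m) → ⟪ p ⟫ φ ≡ ⟪ p ⟫ ψ
pairing-cong (con c) e = cong (c *_) (e _)
pairing-cong (var g) e = e _
pairing-cong (p ⊕ q) e = cong₂ _+_ (pairing-cong p e) (pairing-cong q e)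
pairing-cong (p ⊗ q) e = pairing-cong p (λ m → pairing-cong q (λ m′ → e _))

pairing-+ : ∀ {K} (p : Poly K) (φ ψ : Mon K → ℤ) → ⟪ p ⟫ (λ m → φ m + ψ m) ≡ ⟪ p ⟫ φ + ⟪ p ⟫ ψ
pairing-+ (con c) φ ψ = ℤₚ.*-distribˡ-+ c _ _
pairing-+ (var g) φ ψ = refl
pairing-+ (p ⊕ q) φ ψ = trans (cong₂ _+_ (pairing-+ p φ ψ) (pairing-+ q φ ψ)) (lemma (⟪ p ⟫ φ) _ _ _)
  where
  lemma : ∀ a b c d → (a + b) + (c + d) ≡ (a + c) + (b + d)
  lemma = solve-∀
pairing-+ (p ⊗ q) φ ψ = trans (pairing-cong p (λ m → pairing-+ q _ _)) (pairing-+ p _ _)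

pairing-* : ∀ {K} (p : Poly K) c (φ : Mon K → ℤ) → ⟪ p ⟫ (λ m → c * φ m) ≡ c * ⟪ p ⟫ φ
pairing-* (con d) c φ = lemma d c (φ 𝟘)
  where
  lemma : ∀ d c f → d * (c * f) ≡ c * (d * f)
  lemma = solve-∀
pairing-* (var g) c φ = refl
pairing-* (p ⊕ q) c φ = trans (cong₂ _+_ (pairing-* p c φ) (pairing-* q c φ)) (sym (ℤₚ.*-distribˡ-+ c _ _))
pairing-* (p ⊗ q) c φ = trans (pairing-cong p (λ m → pairing-* q c _)) (pairing-* p c _)

-- Fubini's theorem for two functionals. Commutativity of `⊗` rests on it.
pairing-swap : ∀ {K K′} (p : Poly K) (q : Poly K′) (f : Mon K → Mon K′ → ℤ) →
  ⟪ p ⟫ (λ m → ⟪ q ⟫ (f m)) ≡ ⟪ q ⟫ (λ m′ → ⟪ p ⟫ (λ m → f m m′))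
pairing-swap (con c) q f = sym (pairing-* q c _)
pairing-swap (var g) q f = refl
pairing-swap (p ⊕ p′) q f = trans (cong₂ _+_ (pairing-swap p q f) (pairing-swap p′ q f)) (sym (pairing-+ q _ _))
pairing-swap (p ⊗ p′) q f = trans (pairing-cong p (λ m → pairing-swap p′ q _)) (pairing-swap p q _)

module _ {K : ℕ} where

  ≈-refl : {p : Poly K} → p ≈ p
  ≈-refl = mk≈ λ φ → refl

  ≈-sym : {p q : Poly K} → p ≈ q → q ≈ p
  ≈-sym e = mk≈ λ φ → sym (pairing e φ)

  ≈-trans : {p q s : Poly K} → p ≈ q → q ≈ s → p ≈ s
  ≈-trans e f = mk≈ λ φ → trans (pairing e φ) (pairing f φ)

  ≡⇒≈ : {p q : Poly K} → p ≡ q → p ≈ q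
  ≡⇒≈ refl = ≈-refl

  ⊕-cong : {p p′ q q′ : Poly K} → p ≈ p′ → q ≈ q′ → p ⊕ q ≈ p′ ⊕ q′
  ⊕-cong e f = mk≈ λ φ → cong₂ _+_ (pairing e φ) (pairing f φ)

  ⊗-cong : {p p′ q q′ : Poly K} → p ≈ p′ → q ≈ q′ → p ⊗ q ≈ p′ ⊗ q′
  ⊗-cong {p′ = p′} e f = mk≈ λ φ → trans (pairing e _) (pairing-cong p′ (λ m → pairing f _))

  neg-cong : {p q : Poly K} → p ≈ q → neg p ≈ neg q
  neg-cong = ⊗-cong ≈-refl

  ⊖-cong : {p p′ q q′ : Poly K} → p ≈ p′ → q ≈ q′ → p ⊖ q ≈ p′ ⊖ q′
  ⊖-cong e f = ⊕-cong e (neg-cong f)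

  con-cong : {a b : ℤ} → a ≡ b → con {K} a ≈ con b
  con-cong refl = ≈-refl

  con-+ : ∀ a b → con {K} (a + b) ≈ con a ⊕ con b
  con-+ a b = mk≈ λ φ → ℤₚ.*-distribʳ-+ _ a b

  con-* : ∀ a b → con {K} (a * b) ≈ con a ⊗ con b
  con-* a b = mk≈ λ φ → trans (ℤₚ.*-assoc a b _) (cong (λ m → a * (b * φ m)) (sym (·-identityˡ 𝟘)))

  ⊗-comm : (p q : Poly K) → p ⊗ q ≈ q ⊗ p
  ⊗-comm p q = mk≈ λ φ → trans (pairing-swap p q _)
    (pairing-cong q (λ m′ → pairing-cong p (λ m → cong φ (·-comm m m′))))

  ⊗-identityˡ : (p : Poly K) → con 1ℤ ⊗ p ≈ p
  ⊗-identityˡ p = mk≈ λ φ → trans (ℤₚ.*-identityˡ _) (pairing-cong p (λ m → cong φ (·-identityˡ m)))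

  ⊗-distribʳ-⊕ : (p q s : Poly K) → (q ⊕ s) ⊗ p ≈ q ⊗ p ⊕ s ⊗ p
  ⊗-distribʳ-⊕ p q s = mk≈ λ φ → refl

  ⊕-inverseʳ : (p : Poly K) → p ⊕ neg p ≈ con 0ℤ
  ⊕-inverseʳ p = mk≈ λ φ →
    trans (cong (λ i → ⟪ p ⟫ φ + i) (trans (ℤₚ.-1*i≡-i _) (cong -_ (pairing-cong p (λ m → cong φ (·-identityˡ m))))))
          (trans (ℤₚ.+-inverseʳ (⟪ p ⟫ φ)) (sym (ℤₚ.*-zeroˡ (φ 𝟘))))

  ⊕-comm : (p q : Poly K) → p ⊕ q ≈ q ⊕ p
  ⊕-comm p q = mk≈ λ φ → ℤₚ.+-comm (⟪ p ⟫ φ) (⟪ q ⟫ φ)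

  ⊕-identityˡ : (p : Poly K) → con 0ℤ ⊕ p ≈ p
  ⊕-identityˡ p = mk≈ λ φ → trans (cong (_+ ⟪ p ⟫ φ) (ℤₚ.*-zeroˡ (φ 𝟘))) (ℤₚ.+-identityˡ _)

Poly-setoid : ℕ → Setoid _ _
Poly-setoid K = record
  { Carrier = Poly K ; _≈_ = _≈_
  ; isEquivalence = record { refl = ≈-refl ; sym = ≈-sym ; trans = ≈-trans } }

Poly-ring : ℕ → CommutativeRing _ _
Poly-ring K = record
  { Carrier = Poly K ; _≈_ = _≈_ ; _+_ = _⊕_ ; _*_ = _⊗_ ; -_ = neg ; 0# = con 0ℤ ; 1# = con 1ℤ
  ; isCommutativeRing = record
    { isRing = record
      { +-isAbelianGroup = record
        { isGroup = record
          { isMonoid = record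
            { isSemigroup = record
              { isMagma = record { isEquivalence = Setoid.isEquivalence (Poly-setoid K) ; ∙-cong = ⊕-cong }
              ; assoc = λ p q s → mk≈ λ φ → ℤₚ.+-assoc (⟪ p ⟫ φ) (⟪ q ⟫ φ) (⟪ s ⟫ φ) }
            ; identity = ⊕-identityˡ , λ p → ≈-trans (⊕-comm p _) (⊕-identityˡ p) }
          ; inverse = (λ p → ≈-trans (⊕-comm (neg p) p) (⊕-inverseʳ p)) , ⊕-inverseʳ
          ; ⁻¹-cong = neg-cong }
        ; comm = ⊕-comm }
      ; *-cong = ⊗-cong
      ; *-assoc = λ p q s → mk≈ λ φ → pairing-cong p (λ m → pairing-cong q (λ m′ → pairing-cong s (λ m″ →
          cong φ (·-assoc m m′ m″))))
      ; *-identity = ⊗-identityˡ , λ p → ≈-trans (⊗-comm p _) (⊗-identityˡ p)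
      ; distrib = (λ p q s → ≈-trans (⊗-comm p (q ⊕ s))
                    (≈-trans (⊗-distribʳ-⊕ p q s) (⊕-cong (⊗-comm q p) (⊗-comm s p))))
                , ⊗-distribʳ-⊕ }
    ; *-comm = ⊗-comm } }

con-homomorphism : ∀ K → CommutativeRing.rawRing ℤₚ.+-*-commutativeRing -Raw-AlmostCommutative⟶ fromCommutativeRing (Poly-ring K)
con-homomorphism K = record
  { ⟦_⟧ = con ; +-homo = con-+ ; *-homo = con-*
  ; -‿homo = λ a → ≈-trans (con-cong (sym (ℤₚ.-1*i≡-i a))) (con-* -1ℤ a)
  ; 0-homo = ≈-refl ; 1-homo = ≈-refl }

con-≟ : ∀ {K} (a b : ℤ) → Maybe (con {K} a ≈ con b)
con-≟ a b with a ℤ.≟ b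
... | yes e = just (con-cong e)
... | no  _ = nothing

module PolySolver {K : ℕ} = RingSolver (CommutativeRing.rawRing ℤₚ.+-*-commutativeRing)
  (fromCommutativeRing (Poly-ring K)) (con-homomorphism K) con-≟

-- Formal partial derivatives

δ : ∀ {n} → Fin n → Fin n → ℤ
δ zero    zero    = 1ℤ
δ zero    (suc _) = 0ℤ
δ (suc _) zero    = 0ℤ
δ (suc i) (suc j) = δ i j

D : ∀ {K} → Fin K → Poly K → Poly K
D g (con c) = con 0ℤ
D g (var h) = con (δ g h)
D g (p ⊕ q) = D g p ⊕ D g q
D g (p ⊗ q) = D g p ⊗ q ⊕ p ⊗ D g q

-- The transpose of D.
D* : ∀ {K} → Fin K → (Mon K → ℤ) → Mon K → ℤ
-- At `k = 0` the truncated `pred` does no harm, because the coefficient is 0.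
D* zero    φ (k ∷ m) = + k * φ (pred k ∷ m)
D* (suc g) φ (k ∷ m) = D* g (λ m′ → φ (k ∷ m′)) m

D*-𝟘 : ∀ {K} (g : Fin K) (φ : Mon K → ℤ) → D* g φ 𝟘 ≡ 0ℤ
D*-𝟘 zero    φ = refl
D*-𝟘 (suc g) φ = D*-𝟘 g _

D*-unit : ∀ {K} (g h : Fin K) (φ : Mon K → ℤ) → D* g φ (unit h) ≡ δ g h * φ 𝟘
D*-unit zero    zero    φ = refl
D*-unit zero    (suc h) φ = refl
D*-unit (suc g) zero    φ = D*-𝟘 g _
D*-unit (suc g) (suc h) φ = D*-unit g h _

D*-· : ∀ {K} (g : Fin K) (φ : Mon K → ℤ) m m′ →
  D* g φ (m · m′) ≡ D* g (λ u → φ (u · m′)) m + D* g (λ u → φ (m · u)) m′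
D*-· zero φ (zero ∷ m)  (k′ ∷ m′)     = sym (ℤₚ.+-identityˡ _)
D*-· zero φ (suc k ∷ m) (zero ∷ m′)   rewrite ℕₚ.+-identityʳ k = sym (ℤₚ.+-identityʳ _)
D*-· zero φ (suc k ∷ m) (suc k′ ∷ m′) rewrite ℕₚ.+-suc k k′ =
  trans (cong (_* φ (suc (k ℕ.+ k′) ∷ m · m′)) (trans (cong +_ (sym (cong suc (ℕₚ.+-suc k k′)))) (ℤₚ.pos-+ (suc k) (suc k′))))
        (ℤₚ.*-distribʳ-+ _ (+ suc k) (+ suc k′))
D*-· (suc g) φ (k ∷ m) (k′ ∷ m′) = D*-· g _ m m′

D*-pairing : ∀ {K K′} (g : Fin K) (q : Poly K′) (f : Mon K → Mon K′ → ℤ) m →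
  D* g (λ u → ⟪ q ⟫ (f u)) m ≡ ⟪ q ⟫ (λ m′ → D* g (λ u → f u m′) m)
D*-pairing zero    q f (k ∷ m) = sym (pairing-* q (+ k) _)
D*-pairing (suc g) q f (k ∷ m) = D*-pairing g q _ m

D-pairing : ∀ {K} (g : Fin K) (p : Poly K) φ → ⟪ D g p ⟫ φ ≡ ⟪ p ⟫ (D* g φ)
D-pairing g (con c) φ = sym (trans (cong (c *_) (D*-𝟘 g φ)) (ℤₚ.*-zeroʳ c))
D-pairing g (var h) φ = sym (D*-unit g h φ)
D-pairing g (p ⊕ q) φ = cong₂ _+_ (D-pairing g p φ) (D-pairing g q φ)
D-pairing g (p ⊗ q) φ = begin
  ⟪ D g p ⟫ (λ m → ⟪ q ⟫ (λ m′ → φ (m · m′))) + ⟪ p ⟫ (λ m → ⟪ D g q ⟫ (λ m′ → φ (m · m′)))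
    ≡⟨ cong₂ _+_ (trans (D-pairing g p _) (pairing-cong p (D*-pairing g q _)))
                 (pairing-cong p (λ m → D-pairing g q _)) ⟩
  ⟪ p ⟫ (λ m → ⟪ q ⟫ (λ m′ → D* g (λ u → φ (u · m′)) m)) + ⟪ p ⟫ (λ m → ⟪ q ⟫ (D* g (λ u → φ (m · u))))
    ≡⟨ pairing-+ p _ _ ⟨
  ⟪ p ⟫ (λ m → ⟪ q ⟫ (λ m′ → D* g (λ u → φ (u · m′)) m) + ⟪ q ⟫ (D* g (λ u → φ (m · u))))
    ≡⟨ pairing-cong p (λ m → trans (pairing-cong q (D*-· g φ m)) (pairing-+ q _ _)) ⟨
  ⟪ p ⊗ q ⟫ (D* g φ) ∎
  where open ≡-Reasoning

-- `D` works on expressions and could a priori depend on the expression chosen; it does not, because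
-- pairing with `D g p` is pairing `p` with a transposed functional.
D-cong : ∀ {K} (g : Fin K) {p q : Poly K} → p ≈ q → D g p ≈ D g q
D-cong g {p} {q} e = mk≈ λ φ → trans (D-pairing g p φ) (trans (pairing e _) (sym (D-pairing g q φ)))

-- The functional Λ and integration by parts

weight : ∀ {K} → Mon K → ℤ
weight []      = 1ℤ
weight (k ∷ m) = + (k !) * weight m

-- Λ p is the integral of p(y) exp (- Σ y) over the positive orthant.
Λ : ∀ {K} → Poly K → ℤ
Λ p = ⟪ p ⟫ weight

Λ-cong : ∀ {K} {p q : Poly K} → p ≈ q → Λ p ≡ Λ q
Λ-cong e = pairing e weight

Λ-con : ∀ {K} c (p : Poly K) → Λ (con c ⊗ p) ≡ c * Λ p
Λ-con c p = cong (c *_) (pairing-cong p (λ m → cong weight (·-identityˡ m)))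

D*-* : ∀ {K} (g : Fin K) c (φ : Mon K → ℤ) m → D* g (λ u → c * φ u) m ≡ c * D* g φ m
D*-* zero    c φ (k ∷ m) = lemma (+ k) c (φ (pred k ∷ m))
  where
  lemma : ∀ k c f → k * (c * f) ≡ c * (k * f)
  lemma = solve-∀
D*-* (suc g) c φ (k ∷ m) = D*-* g c _ m

D*-weight : ∀ {K} (g : Fin K) (m : Mon K) → D* g weight (unit g · m) ≡ weight (unit g · m)
D*-weight zero (k ∷ m) = trans (sym (ℤₚ.*-assoc (+ suc k) (+ (k !)) (weight (𝟘 · m)))) 
  (cong (_* weight (𝟘 · m)) (sym (ℤₚ.pos-* (suc k) (k !))))
D*-weight (suc g) (k ∷ m) = trans (D*-* g (+ (k !)) weight (unit g · m)) (cong (+ (k !) *_) (D*-weight g m))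

-- Integration by parts without boundary term, since a multiple of `var g` vanishes where that
-- variable is 0. On monomials it is (k + 1) k! = (k + 1)!.
Λ-D-var : ∀ {K} (g : Fin K) (p : Poly K) → Λ (D g (var g ⊗ p)) ≡ Λ (var g ⊗ p)
Λ-D-var g p = trans (D-pairing g (var g ⊗ p) weight) (pairing-cong p (D*-weight g))

lift : ∀ {K} → Poly K → Poly (suc K)
lift (con c) = con c
lift (var g) = var (suc g)
lift (p ⊕ q) = lift p ⊕ lift q
lift (p ⊗ q) = lift p ⊗ lift q

-- Restriction to the face of the orthant where variable 0 vanishes, the boundary term of an
-- integration by parts.
drop : ∀ {K} → Poly (suc K) → Poly K
drop (con c)       = con c
drop (var zero)    = con 0ℤ
drop (var (suc g)) = var g
drop (p ⊕ q) = drop p ⊕ drop q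
drop (p ⊗ q) = drop p ⊗ drop q

drop-lift : ∀ {K} (p : Poly K) → drop (lift p) ≡ p
drop-lift (con c) = refl
drop-lift (var g) = refl
drop-lift (p ⊕ q) = cong₂ _⊕_ (drop-lift p) (drop-lift q)
drop-lift (p ⊗ q) = cong₂ _⊗_ (drop-lift p) (drop-lift q)

lift-pairing : ∀ {K} (p : Poly K) φ → ⟪ lift p ⟫ φ ≡ ⟪ p ⟫ (λ m → φ (0 ∷ m))
lift-pairing (con c) φ = refl
lift-pairing (var g) φ = refl
lift-pairing (p ⊕ q) φ = cong₂ _+_ (lift-pairing p φ) (lift-pairing q φ)
lift-pairing (p ⊗ q) φ = trans (lift-pairing p _) (pairing-cong p (λ m → lift-pairing q _))

lift-cong : ∀ {K} {p q : Poly K} → p ≈ q → lift p ≈ lift q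
lift-cong {p = p} {q} e = mk≈ λ φ → trans (lift-pairing p φ) (trans (pairing e _) (sym (lift-pairing q φ)))

drop* : ∀ {K} → (Mon K → ℤ) → Mon (suc K) → ℤ
drop* φ (zero ∷ m)  = φ m
drop* φ (suc _ ∷ m) = 0ℤ

pairing-0 : ∀ {K} (p : Poly K) {φ : Mon K → ℤ} → (∀ m → φ m ≡ 0ℤ) → ⟪ p ⟫ φ ≡ 0ℤ
pairing-0 p e = trans (pairing-cong p e) (pairing-* p 0ℤ (λ _ → 0ℤ))

drop*-· : ∀ {K} (q : Poly (suc K)) (φ : Mon K → ℤ) m →
  ⟪ q ⟫ (λ m′ → drop* φ (m · m′)) ≡ drop* (λ u → ⟪ q ⟫ (drop* (λ u′ → φ (u · u′)))) m
drop*-· q φ (zero ∷ m)  = pairing-cong q λ { (zero ∷ m′) → refl ; (suc k ∷ m′) → refl }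
drop*-· q φ (suc k ∷ m) = pairing-0 q λ { (k′ ∷ m′) → refl }

drop-pairing : ∀ {K} (p : Poly (suc K)) φ → ⟪ drop p ⟫ φ ≡ ⟪ p ⟫ (drop* φ)
drop-pairing (con c) φ = refl
drop-pairing (var zero) φ = refl
drop-pairing (var (suc g)) φ = refl
drop-pairing (p ⊕ q) φ = cong₂ _+_ (drop-pairing p φ) (drop-pairing q φ)
drop-pairing (p ⊗ q) φ = trans (drop-pairing p _) (sym (pairing-cong p λ m →
  trans (drop*-· q φ m) (drop*-cong (λ u → sym (drop-pairing q _)) m)))
  where
  drop*-cong : ∀ {K} {φ ψ : Mon K → ℤ} → (∀ m → φ m ≡ ψ m) → ∀ m → drop* φ m ≡ drop* ψ m
  drop*-cong e (zero ∷ m)  = e m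
  drop*-cong e (suc k ∷ m) = refl

-- A monomial containing variable 0 contributes only to the derivative, any other only to the
-- boundary value. This identity mirrors the removal of the top element of an ordering.
Λ-by-parts : ∀ {K} (p : Poly (suc K)) → Λ p ≡ Λ (D zero p) + Λ (drop p)
Λ-by-parts p = sym (trans (cong₂ _+_ (D-pairing zero p weight) (drop-pairing p weight))
  (trans (sym (pairing-+ p _ _)) (pairing-cong p split)))
  where
  split : ∀ m → D* zero weight m + drop* weight m ≡ weight m
  split (zero ∷ m)  = trans (ℤₚ.+-identityˡ (weight m)) (sym (ℤₚ.*-identityˡ (weight m)))
  split (suc k ∷ m) = trans (ℤₚ.+-identityʳ _) (trans (sym (ℤₚ.*-assoc (+ suc k) (+ (k !)) (weight m)))
    (cong (_* weight m) (sym (ℤₚ.pos-* (suc k) (k !)))))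

D-lift-zero : ∀ {K} (p : Poly K) → D zero (lift p) ≈ con 0ℤ
D-lift-zero p = mk≈ λ φ → trans (D-pairing zero (lift p) φ) (trans (lift-pairing p _) (pairing-0 p (λ m → refl)))

D-lift-suc : ∀ {K} (g : Fin K) (p : Poly K) → D (suc g) (lift p) ≡ lift (D g p)
D-lift-suc g (con c) = refl
D-lift-suc g (var h) = refl
D-lift-suc g (p ⊕ q) = cong₂ _⊕_ (D-lift-suc g p) (D-lift-suc g q)
D-lift-suc g (p ⊗ q) = cong₂ (λ u v → u ⊗ lift q ⊕ lift p ⊗ v) (D-lift-suc g p) (D-lift-suc g q)

Λ-lift : ∀ {K} (p : Poly K) → Λ (lift p) ≡ Λ p
Λ-lift p = trans (lift-pairing p weight) (pairing-cong p (λ m → ℤₚ.*-identityˡ (weight m)))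

-- Homogeneous polynomials

degree : ∀ {K} → Mon K → ℕ
degree []      = 0
degree (k ∷ m) = k ℕ.+ degree m

-- Euler's identity in dual form. The zero polynomial is thus homogeneous of every degree, which
-- covers the vanishing cases of `esym`.
record Homogeneous {K} (d : ℕ) (p : Poly K) : Set where
  constructor mkHomogeneous
  field euler : ∀ φ → ⟪ p ⟫ (λ m → + degree m * φ m) ≡ + d * ⟪ p ⟫ φ
open Homogeneous public

degree-𝟘 : ∀ K → degree (𝟘 {K}) ≡ 0
degree-𝟘 zero    = refl
degree-𝟘 (suc K) = degree-𝟘 K

degree-unit : ∀ {K} (g : Fin K) → degree (unit g) ≡ 1
degree-unit {suc K} zero    = cong suc (degree-𝟘 K)
degree-unit {suc K} (suc g) = degree-unit g

degree-· : ∀ {K} (m m′ : Mon K) → degree (m · m′) ≡ degree m ℕ.+ degree m′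
degree-· []      []        = refl
degree-· (k ∷ m) (k′ ∷ m′) = trans (cong (k ℕ.+ k′ ℕ.+_) (degree-· m m′)) (lemma k k′ (degree m) (degree m′))
  where
  lemma : ∀ a b c d → a ℕ.+ b ℕ.+ (c ℕ.+ d) ≡ a ℕ.+ c ℕ.+ (b ℕ.+ d)
  lemma = ℕ-solve-∀

homogeneous-con : ∀ {K} c → Homogeneous {K} 0 (con c)
homogeneous-con {K} c = mkHomogeneous λ φ → trans (cong (λ d → c * (+ d * φ 𝟘)) (degree-𝟘 K))
  (trans (cong (c *_) (ℤₚ.*-zeroˡ (φ 𝟘))) (ℤₚ.*-zeroʳ c))

homogeneous-0 : ∀ {K} d → Homogeneous {K} d (con 0ℤ)
homogeneous-0 d = mkHomogeneous λ φ → sym (ℤₚ.*-zeroʳ (+ d))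

homogeneous-var : ∀ {K} (g : Fin K) → Homogeneous 1 (var g)
homogeneous-var g = mkHomogeneous λ φ → cong (λ d → + d * φ (unit g)) (degree-unit g)

homogeneous-⊕ : ∀ {K d} {p q : Poly K} → Homogeneous d p → Homogeneous d q → Homogeneous d (p ⊕ q)
homogeneous-⊕ {d = d} h h′ = mkHomogeneous λ φ →
  trans (cong₂ _+_ (euler h φ) (euler h′ φ)) (sym (ℤₚ.*-distribˡ-+ (+ d) _ _))

homogeneous-⊗ : ∀ {K d d′} {p q : Poly K} → Homogeneous d p → Homogeneous d′ q → Homogeneous (d ℕ.+ d′) (p ⊗ q)
homogeneous-⊗ {d = d} {d′} {p} {q} h h′ = mkHomogeneous λ φ → begin
  ⟪ p ⟫ (λ m → ⟪ q ⟫ (λ m′ → + degree (m · m′) * φ (m · m′)))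
    ≡⟨ pairing-cong p (λ m → trans (pairing-cong q (λ m′ → trans
         (cong (_* φ (m · m′)) (trans (cong +_ (degree-· m m′)) (ℤₚ.pos-+ (degree m) (degree m′))))
         (ℤₚ.*-distribʳ-+ (φ (m · m′)) (+ degree m) (+ degree m′))))
       (trans (pairing-+ q _ _) (cong₂ _+_ (pairing-* q (+ degree m) _) (euler h′ _)))) ⟩
  ⟪ p ⟫ (λ m → + degree m * ⟪ q ⟫ (λ m′ → φ (m · m′)) + + d′ * ⟪ q ⟫ (λ m′ → φ (m · m′)))
    ≡⟨ trans (pairing-+ p _ _) (cong₂ _+_ (euler h _) (pairing-* p (+ d′) _)) ⟩
  + d * ⟪ p ⊗ q ⟫ φ + + d′ * ⟪ p ⊗ q ⟫ φ
    ≡⟨ trans (cong (_* ⟪ p ⊗ q ⟫ φ) (ℤₚ.pos-+ d d′)) (ℤₚ.*-distribʳ-+ _ (+ d) (+ d′)) ⟨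
  + (d ℕ.+ d′) * ⟪ p ⊗ q ⟫ φ ∎
  where open ≡-Reasoning

homogeneous-neg : ∀ {K d} {p : Poly K} → Homogeneous d p → Homogeneous d (neg p)
homogeneous-neg = homogeneous-⊗ (homogeneous-con -1ℤ)

homogeneous-lift : ∀ {K d} {p : Poly K} → Homogeneous d p → Homogeneous d (lift p)
homogeneous-lift {d = d} {p} h = mkHomogeneous λ φ →
  trans (lift-pairing p _) (trans (euler h _) (cong (+ d *_) (sym (lift-pairing p φ))))

-- Elementary symmetric polynomials

module PolySum {K : ℕ} = SemiringSum (CommutativeRing.semiring (Poly-ring K))
module PolyReasoning {K : ℕ} = SetoidReasoning (Poly-setoid K)
open PolySum using (sum; sum-cong-≋; ∑-distrib-+; ∑-comm; *-distribˡ-sum)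
open PolySolver using (solve; _:=_; _:+_; _:*_) renaming (con to :con)

infixl 6 _:⊖_
_:⊖_ : ∀ {n K} → PolySolver.Polynomial {K} n → PolySolver.Polynomial {K} n → PolySolver.Polynomial {K} n
p :⊖ q = p :+ :con -1ℤ :* q

module _ {K : ℕ} where

  sum-⊕ : ∀ {n} (f g : Fin n → Poly K) → sum (λ i → f i ⊕ g i) ≈ sum f ⊕ sum g
  sum-⊕ = ∑-distrib-+

  sum-⊗ : ∀ {n} p (f : Fin n → Poly K) → sum (λ i → p ⊗ f i) ≈ p ⊗ sum f
  sum-⊗ p f = ≈-sym (*-distribˡ-sum p f)

  sum-⊖ : ∀ {n} (f g : Fin n → Poly K) → sum (λ i → f i ⊖ g i) ≈ sum f ⊖ sum g
  sum-⊖ f g = ≈-trans (sum-⊕ f (neg ∘ g)) (⊕-cong ≈-refl (sum-⊗ _ g))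

  sum-const : ∀ n (p : Poly K) → sum {n = n} (λ _ → p) ≈ con (+ n) ⊗ p
  sum-const zero    p = solve 1 (λ p → :con 0ℤ := :con 0ℤ :* p) ≈-refl p
  sum-const (suc n) p = ≈-trans (⊕-cong ≈-refl (sum-const n p))
    (≈-trans (solve 2 (λ p n → p :+ n :* p := (:con 1ℤ :+ n) :* p) ≈-refl p (con (+ n)))
             (⊗-cong (≈-sym (con-+ 1ℤ (+ n))) ≈-refl))

  sum-0 : ∀ {n} (f : Fin n → Poly K) → (∀ i → f i ≈ con 0ℤ) → sum f ≈ con 0ℤ
  sum-0 {n} f e = ≈-trans (sum-cong-≋ e) (≈-trans (sum-const n (con 0ℤ))
    (solve 1 (λ p → p :* :con 0ℤ := :con 0ℤ) ≈-refl (con (+ n))))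

  sum-δ : ∀ {n} (i : Fin n) (f : Fin n → Poly K) → sum (λ j → con (δ i j) ⊗ f j) ≈ f i
  sum-δ zero f = ≈-trans (⊕-cong ≈-refl (sum-0 _ (λ j →
      solve 1 (λ p → :con 0ℤ :* p := :con 0ℤ) ≈-refl (f (suc j)))))
    (solve 1 (λ p → :con 1ℤ :* p :+ :con 0ℤ := p) ≈-refl (f zero))
  sum-δ (suc i) f = ≈-trans (⊕-cong ≈-refl (sum-δ i (f ∘ suc)))
    (solve 2 (λ p q → :con 0ℤ :* p :+ q := q) ≈-refl (f zero) (f (suc i)))

  Λ-sum-0 : ∀ {n} (f : Fin n → Poly K) → (∀ i → Λ (f i) ≡ 0ℤ) → Λ (sum f) ≡ 0ℤ
  Λ-sum-0 {zero}  f e = refl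
  Λ-sum-0 {suc n} f e = cong₂ _+_ (e zero) (Λ-sum-0 (f ∘ suc) (e ∘ suc))

  -- Putting 0 in place of a variable, instead of removing it, keeps the index type `Fin n`, so
  -- double sums over i and j need no reindexing; in `esym` the effect is the same.
  erase : ∀ {n} → Fin n → (Fin n → Poly K) → Fin n → Poly K
  erase zero    w zero    = con 0ℤ
  erase zero    w (suc j) = w (suc j)
  erase (suc i) w zero    = w zero
  erase (suc i) w (suc j) = erase i (w ∘ suc) j

  erase-self : ∀ {n} (i : Fin n) w → erase i w i ≡ con 0ℤ
  erase-self zero    w = refl
  erase-self (suc i) w = erase-self i (w ∘ suc)

  erase-other : ∀ {n} {i j : Fin n} w → i ≢ j → erase i w j ≡ w j
  erase-other {i = zero}  {zero}  w i≢j = ⊥-elim (i≢j refl)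
  erase-other {i = zero}  {suc j} w i≢j = refl
  erase-other {i = suc i} {zero}  w i≢j = refl
  erase-other {i = suc i} {suc j} w i≢j = erase-other (w ∘ suc) (i≢j ∘ cong suc)

  erase-idem : ∀ {n} (i : Fin n) w j → erase i (erase i w) j ≡ erase i w j
  erase-idem zero    w zero    = refl
  erase-idem zero    w (suc j) = refl
  erase-idem (suc i) w zero    = refl
  erase-idem (suc i) w (suc j) = erase-idem i (w ∘ suc) j

  erase-comm : ∀ {n} (i i′ : Fin n) w j → erase i (erase i′ w) j ≡ erase i′ (erase i w) j
  erase-comm zero    zero     w j       = refl
  erase-comm zero    (suc i′) w zero    = refl
  erase-comm zero    (suc i′) w (suc j) = refl
  erase-comm (suc i) zero     w zero    = refl
  erase-comm (suc i) zero     w (suc j) = refl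
  erase-comm (suc i) (suc i′) w zero    = refl
  erase-comm (suc i) (suc i′) w (suc j) = erase-comm i i′ (w ∘ suc) j

  esym : ∀ {n} → ℕ → (Fin n → Poly K) → Poly K
  esym         zero    w = con 1ℤ
  esym {zero}  (suc k) w = con 0ℤ
  esym {suc n} (suc k) w = w zero ⊗ esym k (w ∘ suc) ⊕ esym (suc k) (w ∘ suc)

  -- The elementary symmetric polynomial of index k - 1, which vanishes for k = 0.
  esym⁻ : ∀ {n} → ℕ → (Fin n → Poly K) → Poly K
  esym⁻ zero    w = con 0ℤ
  esym⁻ (suc k) w = esym k w

  esym-suc : ∀ {n} k (w : Fin (suc n) → Poly K) →
    esym k w ≈ w zero ⊗ esym⁻ k (w ∘ suc) ⊕ esym k (w ∘ suc)
  esym-suc zero    w = solve 1 (λ p → :con 1ℤ := p :* :con 0ℤ :+ :con 1ℤ) ≈-refl (w zero)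
  esym-suc (suc k) w = ≈-refl

  esym-cong : ∀ {n} k {v w : Fin n → Poly K} → (∀ i → v i ≈ w i) → esym k v ≈ esym k w
  esym-cong         zero    e = ≈-refl
  esym-cong {zero}  (suc k) e = ≈-refl
  esym-cong {suc n} (suc k) e = ⊕-cong (⊗-cong (e zero) (esym-cong k (e ∘ suc))) (esym-cong (suc k) (e ∘ suc))

  esym⁻-cong : ∀ {n} k {v w : Fin n → Poly K} → (∀ i → v i ≈ w i) → esym⁻ k v ≈ esym⁻ k w
  esym⁻-cong zero    e = ≈-refl
  esym⁻-cong (suc k) e = esym-cong k e

  esym-erase-zero : ∀ {n} k (w : Fin (suc n) → Poly K) → esym k (erase zero w) ≈ esym k (w ∘ suc)
  esym-erase-zero k w = ≈-trans (esym-suc k _)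
    (solve 2 (λ p q → :con 0ℤ :* p :+ q := q) ≈-refl (esym⁻ k (w ∘ suc)) _)

  esym⁻-erase-zero : ∀ {n} k (w : Fin (suc n) → Poly K) → esym⁻ k (erase zero w) ≈ esym⁻ k (w ∘ suc)
  esym⁻-erase-zero zero    w = ≈-refl
  esym⁻-erase-zero (suc k) w = esym-erase-zero k w

  esym-split : ∀ {n} k (w : Fin n → Poly K) i → esym k w ≈ w i ⊗ esym⁻ k (erase i w) ⊕ esym k (erase i w)
  esym-split k w zero = ≈-trans (esym-suc k w)
    (⊕-cong (⊗-cong ≈-refl (≈-sym (esym⁻-erase-zero k w))) (≈-sym (esym-erase-zero k w)))
  esym-split zero w (suc i) = solve 1 (λ p → :con 1ℤ := p :* :con 0ℤ :+ :con 1ℤ) ≈-refl (w (suc i))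
  esym-split (suc k) w (suc i) = ≈-trans
    (⊕-cong (⊗-cong ≈-refl (esym-split k (w ∘ suc) i)) (esym-split (suc k) (w ∘ suc) i))
    (≈-trans
      (solve 5 (λ a b x y z → a :* (b :* x :+ y) :+ (b :* y :+ z) := b :* (a :* x :+ y) :+ (a :* y :+ z))
        ≈-refl (w zero) (w (suc i)) (esym⁻ k v) (esym k v) (esym (suc k) v))
      (⊕-cong (⊗-cong ≈-refl (≈-sym (esym-suc k (erase (suc i) w)))) ≈-refl))
    where v = erase i (w ∘ suc)

  -- Each product of k variables arises once for each of its k members.
  sum-esym-weighted : ∀ {n} k (w : Fin n → Poly K) →
    sum (λ i → w i ⊗ esym⁻ k (erase i w)) ≈ con (+ k) ⊗ esym k w
  sum-esym-weighted zero w = ≈-trans (sum-0 _ (λ i → solve 1 (λ p → p :* :con 0ℤ := :con 0ℤ) ≈-refl (w i)))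
    (solve 0 (:con 0ℤ := :con 0ℤ :* :con 1ℤ) ≈-refl)
  sum-esym-weighted {zero} (suc k) w = solve 1 (λ p → :con 0ℤ := p :* :con 0ℤ) ≈-refl (con (+ suc k))
  sum-esym-weighted {suc n} (suc k) w = begin
    w zero ⊗ esym k (erase zero w) ⊕ sum (λ i → w (suc i) ⊗ esym k (erase (suc i) w))
      ≈⟨ ⊕-cong (⊗-cong ≈-refl (esym-erase-zero k w)) (sum-cong-≋ (λ i → ≈-trans
           (⊗-cong ≈-refl (esym-suc k (erase (suc i) w)))
           (solve 4 (λ a b x y → b :* (a :* x :+ y) := a :* (b :* x) :+ b :* y) ≈-refl
              (w zero) (w (suc i)) (esym⁻ k (erase i v)) (esym k (erase i v))))) ⟩
    w zero ⊗ esym k v ⊕ sum (λ i → w zero ⊗ (v i ⊗ esym⁻ k (erase i v)) ⊕ v i ⊗ esym k (erase i v))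
      ≈⟨ ⊕-cong ≈-refl (≈-trans (sum-⊕ {n} _ _) (⊕-cong (≈-trans (sum-⊗ {n} _ _)
           (⊗-cong ≈-refl (sum-esym-weighted k v))) (sum-esym-weighted (suc k) v))) ⟩
    w zero ⊗ esym k v ⊕ (w zero ⊗ (con (+ k) ⊗ esym k v) ⊕ con (+ suc k) ⊗ esym (suc k) v)
      ≈⟨ solve 5 (λ a x c d y → a :* x :+ (a :* (c :* x) :+ d :* y) := (:con 1ℤ :+ c) :* (a :* x) :+ d :* y) ≈-refl
           (w zero) (esym k v) (con (+ k)) (con (+ suc k)) (esym (suc k) v) ⟩
    (con 1ℤ ⊕ con (+ k)) ⊗ (w zero ⊗ esym k v) ⊕ con (+ suc k) ⊗ esym (suc k) v
      ≈⟨ ⊕-cong (⊗-cong (≈-sym (con-+ 1ℤ (+ k))) ≈-refl) ≈-refl ⟩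
    con (+ suc k) ⊗ (w zero ⊗ esym k v) ⊕ con (+ suc k) ⊗ esym (suc k) v
      ≈⟨ solve 3 (λ d x y → d :* x :+ d :* y := d :* (x :+ y)) ≈-refl _ _ _ ⟩
    con (+ suc k) ⊗ esym (suc k) w ∎
    where
    open PolyReasoning
    v = w ∘ suc

  -- Each product of k variables survives the erasure of any of the n - k variables that it does not
  -- contain.
  sum-esym-erase : ∀ {n} k (w : Fin n → Poly K) →
    sum (λ i → esym k (erase i w)) ≈ (con (+ n) ⊖ con (+ k)) ⊗ esym k w
  sum-esym-erase {n} k w = begin
    sum (λ i → esym k (erase i w))
      ≈⟨ sum-cong-≋ (λ i → ≈-trans
           (solve 2 (λ x y → y := (x :+ y) :⊖ x) ≈-refl (w i ⊗ esym⁻ k (erase i w)) (esym k (erase i w)))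
           (⊖-cong (≈-sym (esym-split k w i)) ≈-refl)) ⟩
    sum (λ i → esym k w ⊖ w i ⊗ esym⁻ k (erase i w))
      ≈⟨ ≈-trans (sum-⊖ {n} _ _) (⊖-cong (sum-const n _) (sum-esym-weighted k w)) ⟩
    con (+ n) ⊗ esym k w ⊖ con (+ k) ⊗ esym k w
      ≈⟨ solve 3 (λ n k x → n :* x :⊖ k :* x := (n :⊖ k) :* x) ≈-refl _ _ _ ⟩
    (con (+ n) ⊖ con (+ k)) ⊗ esym k w ∎
    where open PolyReasoning

  -- An abstract notion, because differences and negatives of the `D g` are needed: the former move
  -- a single chain vertex, the latter serve the reflection.
  record IsDerivation (∂ : Poly K → Poly K) : Set where
    field
      ∂-cong : ∀ {p q} → p ≈ q → ∂ p ≈ ∂ q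
      ∂-con  : ∀ c → ∂ (con c) ≈ con 0ℤ
      ∂-⊕    : ∀ p q → ∂ (p ⊕ q) ≈ ∂ p ⊕ ∂ q
      ∂-⊗    : ∀ p q → ∂ (p ⊗ q) ≈ ∂ p ⊗ q ⊕ p ⊗ ∂ q

    ∂-⊖ : ∀ p q → ∂ (p ⊖ q) ≈ ∂ p ⊖ ∂ q
    ∂-⊖ p q = ≈-trans (∂-⊕ p (neg q)) (⊕-cong ≈-refl (≈-trans (∂-⊗ _ q)
      (≈-trans (⊕-cong (⊗-cong (∂-con -1ℤ) ≈-refl) ≈-refl)
        (solve 2 (λ q q′ → :con 0ℤ :* q :+ q′ := q′) ≈-refl q (neg (∂ q))))))

    ∂-esym : ∀ {n} k (w : Fin n → Poly K) → (∀ i → ∂ (w i) ≈ con 0ℤ) → ∂ (esym k w) ≈ con 0ℤ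
    ∂-esym         zero    w e = ∂-con 1ℤ
    ∂-esym {zero}  (suc k) w e = ∂-con 0ℤ
    ∂-esym {suc n} (suc k) w e = ≈-trans (∂-⊕ _ _) (≈-trans
      (⊕-cong (≈-trans (∂-⊗ _ _) (⊕-cong (⊗-cong (e zero) ≈-refl) (⊗-cong ≈-refl (∂-esym k (w ∘ suc) (e ∘ suc)))))
              (∂-esym (suc k) (w ∘ suc) (e ∘ suc)))
      (solve 2 (λ x y → :con 0ℤ :* x :+ y :* :con 0ℤ :+ :con 0ℤ := :con 0ℤ) ≈-refl _ _))
  open IsDerivation public

δ-refl : ∀ {n} (i : Fin n) → δ i i ≡ 1ℤ
δ-refl zero    = refl
δ-refl (suc i) = δ-refl i

δ-≢ : ∀ {n} {i j : Fin n} → i ≢ j → δ i j ≡ 0ℤ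
δ-≢ {i = zero}  {zero}  i≢j = ⊥-elim (i≢j refl)
δ-≢ {i = zero}  {suc j} i≢j = refl
δ-≢ {i = suc i} {zero}  i≢j = refl
δ-≢ {i = suc i} {suc j} i≢j = δ-≢ (i≢j ∘ cong suc)

-- Φ behaves like ∏ wᵢ^α (t - wᵢ)^β ∏_{i<j} (wᵢ - wⱼ)^{2c}, and G i j like Φ / (wᵢ - wⱼ).
record SelbergSystem {n K : ℕ} (α β c : ℕ) (t Φ : Poly K) (w : Fin n → Poly K) : Set where
  field
    ∂       : Fin n → Poly K → Poly K
    G       : Fin n → Fin n → Poly K
    ∂-deriv : ∀ i → IsDerivation (∂ i)
    ∂-w     : ∀ i j → ∂ i (w j) ≈ con (δ i j)
    ∂-t     : ∀ i → ∂ i t ≈ con 0ℤ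
    G-self  : ∀ i → G i i ≈ con 0ℤ
    G-anti  : ∀ i j → G j i ≈ neg (G i j)
    G-Φ     : ∀ {i j} → i ≢ j → (w i ⊖ w j) ⊗ G i j ≈ Φ
    -- The logarithmic derivative α / wᵢ - β / (t - wᵢ) + 2c Σ 1 / (wᵢ - wⱼ), cleared of
    -- denominators.
    ∂-Φ     : ∀ i → w i ⊗ (t ⊖ w i) ⊗ ∂ i Φ ≈
                (con (+ α) ⊗ (t ⊖ w i) ⊖ con (+ β) ⊗ w i) ⊗ Φ
                ⊕ con (+ 2) ⊗ (con (+ c) ⊗ (w i ⊗ (t ⊖ w i) ⊗ sum (G i)))
    Λ-∂     : ∀ i p → Λ (∂ i (w i ⊗ (t ⊖ w i) ⊗ p ⊗ Φ)) ≡ 0ℤ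

-- Aomoto's identity

module _ {K : ℕ} {p q : Poly K} {a b : ℤ} (p≈a : p ≈ con a) (q≈b : q ≈ con b) where

  ⊕-con : p ⊕ q ≈ con (a + b)
  ⊕-con = ≈-trans (⊕-cong p≈a q≈b) (≈-sym (con-+ a b))

  ⊗-con : p ⊗ q ≈ con (a * b)
  ⊗-con = ≈-trans (⊗-cong p≈a q≈b) (≈-sym (con-* a b))

  ⊖-con : p ⊖ q ≈ con (a + - b)
  ⊖-con = ≈-trans (⊖-cong p≈a q≈b) (≈-sym (≈-trans (con-+ a (- b))
    (⊕-cong ≈-refl (≈-trans (con-cong (sym (ℤₚ.-1*i≡-i b))) (con-* -1ℤ b)))))

Λ-combination : ∀ {K} a b (p q : Poly K) → Λ (con a ⊗ p ⊖ con b ⊗ q) ≡ a * Λ p + - (b * Λ q)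
Λ-combination a b p q = cong₂ _+_ (Λ-con a p)
  (trans (Λ-con -1ℤ (con b ⊗ q)) (trans (ℤₚ.-1*i≡-i _) (cong -_ (Λ-con b q))))

module Aomoto {n K α β c : ℕ} {t Φ : Poly K} {w : Fin n → Poly K} (S : SelbergSystem α β c t Φ w) (k : ℕ) where
  open SelbergSystem S

  private
    E : Fin n → Poly K
    E i = esym k (erase i w)

    A : Fin n → Poly K
    A i = w i ⊗ (t ⊖ w i) ⊗ E i

    -- The divided difference (Aᵢ - Aⱼ) / (wᵢ - wⱼ) when i ≠ j. With `erase i w j` in place of
    -- `w j`, its sum over all j falls under the counting identities for `erase i w`; the diagonal
    -- value is not 0 and has to be subtracted.
    B : Fin n → Fin n → Poly K
    B i j = esym k (erase j (erase i w)) ⊗ (t ⊖ w i ⊖ erase i w j)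
            ⊖ w i ⊗ (erase i w j ⊗ esym⁻ k (erase j (erase i w)))

    eₖ eₖ₊₁ n′ k′ α′ β′ c′ : Poly K
    eₖ = esym k w
    eₖ₊₁ = esym (suc k) w
    n′ = con (+ n)
    k′ = con (+ k)
    α′ = con (+ α)
    β′ = con (+ β)
    c′ = con (+ c)

  ∂-E : ∀ i → ∂ i (E i) ≈ con 0ℤ
  ∂-E i = ∂-esym (∂-deriv i) k (erase i w) λ j → erased j (i Fin.≟ j)
    where
    erased : ∀ j → Dec (i ≡ j) → ∂ i (erase i w j) ≈ con 0ℤ
    erased j (yes refl) = ≈-trans (∂-cong (∂-deriv i) (≡⇒≈ (erase-self i w))) (∂-con (∂-deriv i) 0ℤ)
    erased j (no i≢j)   = ≈-trans (∂-cong (∂-deriv i) (≡⇒≈ (erase-other w i≢j)))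
      (≈-trans (∂-w i j) (con-cong (δ-≢ i≢j)))

  ∂-A : ∀ i → ∂ i (A i) ≈ (t ⊖ con (+ 2) ⊗ w i) ⊗ E i
  ∂-A i = begin
    ∂ i (w i ⊗ (t ⊖ w i) ⊗ E i)
      ≈⟨ ≈-trans (∂-⊗ d _ _) (⊕-cong (⊗-cong (≈-trans (∂-⊗ d _ _) (⊕-cong (⊗-cong ∂w ≈-refl)
          (⊗-cong ≈-refl (≈-trans (∂-⊖ d _ _) (⊖-cong (∂-t i) ∂w))))) ≈-refl) (⊗-cong ≈-refl (∂-E i))) ⟩
    (con 1ℤ ⊗ (t ⊖ w i) ⊕ w i ⊗ (con 0ℤ ⊖ con 1ℤ)) ⊗ E i ⊕ w i ⊗ (t ⊖ w i) ⊗ con 0ℤ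
      ≈⟨ solve 3 (λ t w e → (:con 1ℤ :* (t :⊖ w) :+ w :* (:con 0ℤ :⊖ :con 1ℤ)) :* e :+ w :* (t :⊖ w) :* :con 0ℤ
                   := (t :⊖ :con (+ 2) :* w) :* e) ≈-refl t (w i) (E i) ⟩
    (t ⊖ con (+ 2) ⊗ w i) ⊗ E i ∎
    where
    open PolyReasoning
    d = ∂-deriv i
    ∂w = ≈-trans (∂-w i i) (con-cong (δ-refl i))

  ∂-AΦ : ∀ i → ∂ i (A i ⊗ Φ) ≈
    ((con 1ℤ ⊕ α′) ⊗ t ⊗ Φ ⊗ E i ⊖ (con (+ 2) ⊕ α′ ⊕ β′) ⊗ Φ ⊗ (w i ⊗ E i)) ⊕ con (+ 2) ⊗ c′ ⊗ (A i ⊗ sum (G i))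
  ∂-AΦ i = begin
    ∂ i (A i ⊗ Φ)
      ≈⟨ ≈-trans (∂-⊗ (∂-deriv i) _ _) (⊕-cong (⊗-cong (∂-A i) ≈-refl) 
          (solve 4 (λ w u e p → w :* u :* e :* p := e :* (w :* u :* p)) ≈-refl (w i) (t ⊖ w i) (E i) (∂ i Φ))) ⟩
    (t ⊖ con (+ 2) ⊗ w i) ⊗ E i ⊗ Φ ⊕ E i ⊗ (w i ⊗ (t ⊖ w i) ⊗ ∂ i Φ)
      ≈⟨ ⊕-cong ≈-refl (⊗-cong ≈-refl (∂-Φ i)) ⟩
    (t ⊖ con (+ 2) ⊗ w i) ⊗ E i ⊗ Φ ⊕ E i ⊗ ((α′ ⊗ (t ⊖ w i) ⊖ β′ ⊗ w i) ⊗ Φ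
                ⊕ con (+ 2) ⊗ (c′ ⊗ (w i ⊗ (t ⊖ w i) ⊗ sum (G i))))
      ≈⟨ solve 8 (λ t w e p a b c g → (t :⊖ :con (+ 2) :* w) :* e :* p :+ e :* ((a :* (t :⊖ w) :⊖ b :* w) :* p
                     :+ :con (+ 2) :* (c :* (w :* (t :⊖ w) :* g)))
                   := ((:con 1ℤ :+ a) :* t :* p :* e :⊖ (:con (+ 2) :+ a :+ b) :* p :* (w :* e))
                       :+ :con (+ 2) :* c :* (w :* (t :⊖ w) :* e :* g)) ≈-refl
           t (w i) (E i) Φ α′ β′ c′ (sum (G i)) ⟩
    ((con 1ℤ ⊕ α′) ⊗ t ⊗ Φ ⊗ E i ⊖ (con (+ 2) ⊕ α′ ⊕ β′) ⊗ Φ ⊗ (w i ⊗ E i)) ⊕ con (+ 2) ⊗ c′ ⊗ (A i ⊗ sum (G i)) ∎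
    where open PolyReasoning

  -- With x and y the elementary symmetric polynomials of index k - 1 and k in the variables other
  -- than wᵢ and wⱼ, Eᵢ = wⱼ x + y and Eⱼ = wᵢ x + y. The factor wᵢ - wⱼ then splits off by ring
  -- algebra.
  divided-difference : ∀ {i j} → i ≢ j → A i ⊖ A j ≈ (w i ⊖ w j) ⊗ B i j
  divided-difference {i} {j} i≢j = begin
    w i ⊗ (t ⊖ w i) ⊗ E i ⊖ w j ⊗ (t ⊖ w j) ⊗ E j
      ≈⟨ ⊖-cong (⊗-cong ≈-refl Eᵢ) (⊗-cong ≈-refl Eⱼ) ⟩
    w i ⊗ (t ⊖ w i) ⊗ (w j ⊗ x ⊕ y) ⊖ w j ⊗ (t ⊖ w j) ⊗ (w i ⊗ x ⊕ y)
      ≈⟨ solve 5 (λ a b t x y → a :* (t :⊖ a) :* (b :* x :+ y) :⊖ b :* (t :⊖ b) :* (a :* x :+ y)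
            := (a :⊖ b) :* (y :* (t :⊖ a :⊖ b) :⊖ a :* (b :* x))) ≈-refl (w i) (w j) t x y ⟩
    (w i ⊖ w j) ⊗ (y ⊗ (t ⊖ w i ⊖ w j) ⊖ w i ⊗ (w j ⊗ x))
      ≈⟨ ⊗-cong ≈-refl (⊖-cong (⊗-cong ≈-refl (⊖-cong ≈-refl vⱼ)) (⊗-cong ≈-refl (⊗-cong vⱼ ≈-refl))) ⟩
    (w i ⊖ w j) ⊗ B i j ∎
    where
    open PolyReasoning
    x = esym⁻ k (erase j (erase i w))
    y = esym k (erase j (erase i w))
    vⱼ : w j ≈ erase i w j
    vⱼ = ≡⇒≈ (sym (erase-other w i≢j))
    Eᵢ : E i ≈ w j ⊗ x ⊕ y
    Eᵢ = ≈-trans (esym-split k (erase i w) j) (⊕-cong (⊗-cong (≈-sym vⱼ) ≈-refl) ≈-refl)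
    Eⱼ : E j ≈ w i ⊗ x ⊕ y
    Eⱼ = ≈-trans (esym-split k (erase j w) i) (⊕-cong
      (⊗-cong (≡⇒≈ (erase-other w (i≢j ∘ sym))) (esym⁻-cong k (≡⇒≈ ∘ erase-comm i j w)))
      (esym-cong k (≡⇒≈ ∘ erase-comm i j w)))

  AG : ∀ i j → (A i ⊖ A j) ⊗ G i j ≈ Φ ⊗ (B i j ⊖ con (δ i j) ⊗ B i j)
  AG i j with i Fin.≟ j
  ... | yes refl = ≈-trans (⊗-cong ≈-refl (G-self i)) (≈-trans
    (solve 3 (λ a b p → a :* :con 0ℤ := p :* (b :⊖ :con 1ℤ :* b)) ≈-refl (A i ⊖ A i) (B i i) Φ)
    (⊗-cong ≈-refl (⊖-cong ≈-refl (⊗-cong (con-cong (sym (δ-refl i))) ≈-refl))))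
  ... | no i≢j = ≈-trans (⊗-cong (divided-difference i≢j) ≈-refl) (≈-trans
    (solve 3 (λ u b g → u :* b :* g := (u :* g) :* (b :⊖ :con 0ℤ :* b)) ≈-refl (w i ⊖ w j) (B i j) (G i j))
    (⊗-cong (G-Φ i≢j) (⊖-cong ≈-refl (⊗-cong (con-cong (sym (δ-≢ i≢j))) ≈-refl))))

  -- The sum runs over all j and then loses the diagonal term Eᵢ (t - wᵢ), which is the origin of
  -- the -1 in both n - k - 1 and n - 1.
  sum-B : ∀ i → sum (λ j → B i j ⊖ con (δ i j) ⊗ B i j) ≈
    (n′ ⊖ k′ ⊖ con 1ℤ) ⊗ t ⊗ E i ⊖ (n′ ⊖ con 1ℤ) ⊗ (w i ⊗ E i) ⊖ (con 1ℤ ⊕ k′) ⊗ esym (suc k) (erase i w)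
  sum-B i = begin
    sum (λ j → B i j ⊖ con (δ i j) ⊗ B i j)
      ≈⟨ ≈-trans (sum-⊖ {n = n} _ _) (⊖-cong (sum-cong-≋ (λ j →
           solve 5 (λ y t a b z → y :* (t :⊖ a :⊖ b) :⊖ a :* z := ((t :⊖ a) :* y :⊖ b :* y) :⊖ a :* z)
             ≈-refl (esym k (erase j v)) t (w i) (v j) (v j ⊗ esym⁻ k (erase j v)))) (sum-δ i (B i))) ⟩
    sum (λ j → (t ⊖ w i) ⊗ esym k (erase j v) ⊖ v j ⊗ esym k (erase j v) ⊖ w i ⊗ (v j ⊗ esym⁻ k (erase j v))) ⊖ B i i
      ≈⟨ ⊖-cong (≈-trans (sum-⊖ {n = n} _ _) (⊖-cong (≈-trans (sum-⊖ {n = n} _ _) (⊖-cong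
            (≈-trans (sum-⊗ {n = n} _ _) (⊗-cong ≈-refl (sum-esym-erase k v)))
            (≈-trans (sum-esym-weighted (suc k) v) (⊗-cong (con-+ 1ℤ (+ k)) ≈-refl))))
            (≈-trans (sum-⊗ {n = n} _ _) (⊗-cong ≈-refl (sum-esym-weighted k v))))) Bᵢᵢ ⟩
    ((t ⊖ w i) ⊗ ((n′ ⊖ k′) ⊗ E i) ⊖ (con 1ℤ ⊕ k′) ⊗ e′ ⊖ w i ⊗ (k′ ⊗ E i)) ⊖ E i ⊗ (t ⊖ w i)
      ≈⟨ solve 6 (λ t a n k x e → ((t :⊖ a) :* ((n :⊖ k) :* x) :⊖ (:con 1ℤ :+ k) :* e :⊖ a :* (k :* x)) :⊖ x :* (t :⊖ a)
            := (n :⊖ k :⊖ :con 1ℤ) :* t :* x :⊖ (n :⊖ :con 1ℤ) :* (a :* x) :⊖ (:con 1ℤ :+ k) :* e) ≈-refl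
            t (w i) n′ k′ (E i) e′ ⟩
    (n′ ⊖ k′ ⊖ con 1ℤ) ⊗ t ⊗ E i ⊖ (n′ ⊖ con 1ℤ) ⊗ (w i ⊗ E i) ⊖ (con 1ℤ ⊕ k′) ⊗ e′ ∎
    where
    open PolyReasoning
    v = erase i w
    e′ = esym (suc k) v
    Bᵢᵢ : B i i ≈ E i ⊗ (t ⊖ w i)
    Bᵢᵢ = ≈-trans (⊖-cong (⊗-cong (esym-cong k (≡⇒≈ ∘ erase-idem i w)) (⊖-cong ≈-refl (≡⇒≈ (erase-self i w))))
                           (⊗-cong ≈-refl (⊗-cong (≡⇒≈ (erase-self i w)) ≈-refl)))
      (solve 4 (λ x t a z → x :* (t :⊖ a :⊖ :con 0ℤ) :⊖ a :* (:con 0ℤ :* z) := x :* (t :⊖ a)) ≈-refl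
         (E i) t (w i) (esym⁻ k (erase i v)))

  -- Antisymmetry of G turns Aᵢ Gᵢⱼ + Aⱼ Gⱼᵢ into (Aᵢ - Aⱼ) Gᵢⱼ.
  symmetrize : con (+ 2) ⊗ sum (λ i → A i ⊗ sum (G i)) ≈ Φ ⊗ sum (λ i → sum (λ j → B i j ⊖ con (δ i j) ⊗ B i j))
  symmetrize = begin
    con (+ 2) ⊗ sum (λ i → A i ⊗ sum (G i))
      ≈⟨ solve 1 (λ x → :con (+ 2) :* x := x :+ x) ≈-refl _ ⟩
    sum (λ i → A i ⊗ sum (G i)) ⊕ sum (λ i → A i ⊗ sum (G i))
      ≈⟨ ⊕-cong expand (≈-trans expand (∑-comm (λ i j → A i ⊗ G i j))) ⟩
    sum (λ i → sum (λ j → A i ⊗ G i j)) ⊕ sum (λ i → sum (λ j → A j ⊗ G j i))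
      ≈⟨ ≈-trans (sum-cong-≋ (λ i → sum-⊕ (λ j → A i ⊗ G i j) (λ j → A j ⊗ G j i)))
           (sum-⊕ (λ i → sum (λ j → A i ⊗ G i j)) (λ i → sum (λ j → A j ⊗ G j i))) ⟨
    sum (λ i → sum (λ j → A i ⊗ G i j ⊕ A j ⊗ G j i))
      ≈⟨ sum-cong-≋ (λ i → sum-cong-≋ (λ j → ≈-trans (⊕-cong ≈-refl (⊗-cong ≈-refl (G-anti i j)))
           (≈-trans (solve 3 (λ a b g → a :* g :+ b :* (:con -1ℤ :* g) := (a :⊖ b) :* g) ≈-refl (A i) (A j) (G i j))
             (AG i j)))) ⟩
    sum (λ i → sum (λ j → Φ ⊗ (B i j ⊖ con (δ i j) ⊗ B i j)))
      ≈⟨ ≈-trans (sum-cong-≋ (λ i → sum-⊗ Φ (λ j → B i j ⊖ con (δ i j) ⊗ B i j)))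
           (sum-⊗ Φ (λ i → sum (λ j → B i j ⊖ con (δ i j) ⊗ B i j))) ⟩
    Φ ⊗ sum (λ i → sum (λ j → B i j ⊖ con (δ i j) ⊗ B i j)) ∎
    where
    open PolyReasoning
    expand : sum (λ i → A i ⊗ sum (G i)) ≈ sum (λ i → sum (λ j → A i ⊗ G i j))
    expand = sum-cong-≋ (λ i → ≈-sym (sum-⊗ {n = n} (A i) (G i)))

  sum-∂ : sum (λ i → ∂ i (A i ⊗ Φ)) ≈
    (n′ ⊖ k′) ⊗ (con 1ℤ ⊕ α′ ⊕ (n′ ⊖ k′ ⊖ con 1ℤ) ⊗ c′) ⊗ (t ⊗ (eₖ ⊗ Φ))
    ⊖ (con 1ℤ ⊕ k′) ⊗ (con (+ 2) ⊕ α′ ⊕ β′ ⊕ (con (+ 2) ⊗ n′ ⊖ k′ ⊖ con (+ 2)) ⊗ c′) ⊗ (eₖ₊₁ ⊗ Φ)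
  sum-∂ = begin
    sum (λ i → ∂ i (A i ⊗ Φ))
      ≈⟨ ≈-trans (sum-cong-≋ ∂-AΦ) (≈-trans (sum-⊕ {n = n} _ _) (⊕-cong (≈-trans (sum-⊖ {n = n} _ _)
           (⊖-cong (≈-trans (sum-⊗ {n = n} _ _) (⊗-cong ≈-refl (sum-esym-erase k w)))
                   (≈-trans (sum-⊗ {n = n} _ _) (⊗-cong ≈-refl wE)))) (sum-⊗ {n = n} _ _))) ⟩
    P ⊕ con (+ 2) ⊗ c′ ⊗ sum (λ i → A i ⊗ sum (G i))
      -- The 2 of the exponent 2c is the 2 that `symmetrize` consumes, so nothing has to be halved.
      ≈⟨ ⊕-cong ≈-refl (≈-trans (solve 2 (λ c x → :con (+ 2) :* c :* x := c :* (:con (+ 2) :* x)) ≈-refl _ _)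
           (⊗-cong ≈-refl (≈-trans symmetrize (⊗-cong ≈-refl (≈-trans (sum-cong-≋ sum-B)
             (≈-trans (sum-⊖ {n = n} _ _) (⊖-cong (≈-trans (sum-⊖ {n = n} _ _) (⊖-cong
               (≈-trans (sum-⊗ {n = n} _ _) (⊗-cong ≈-refl (sum-esym-erase k w)))
               (≈-trans (sum-⊗ {n = n} _ _) (⊗-cong ≈-refl wE))))
               (≈-trans (sum-⊗ {n = n} _ _) (⊗-cong ≈-refl (≈-trans (sum-esym-erase (suc k) w)
                 (⊗-cong (⊖-cong ≈-refl (con-+ 1ℤ (+ k))) ≈-refl))))))))))) ⟩
    P ⊕ c′ ⊗ (Φ ⊗ ((n′ ⊖ k′ ⊖ con 1ℤ) ⊗ t ⊗ ((n′ ⊖ k′) ⊗ eₖ) ⊖ (n′ ⊖ con 1ℤ) ⊗ ((con 1ℤ ⊕ k′) ⊗ eₖ₊₁)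
       ⊖ (con 1ℤ ⊕ k′) ⊗ ((n′ ⊖ (con 1ℤ ⊕ k′)) ⊗ eₖ₊₁)))
      ≈⟨ solve 9 (λ n k a b c t p x y →
           ((:con 1ℤ :+ a) :* t :* p :* ((n :⊖ k) :* x) :⊖ (:con (+ 2) :+ a :+ b) :* p :* ((:con 1ℤ :+ k) :* y))
           :+ c :* (p :* ((n :⊖ k :⊖ :con 1ℤ) :* t :* ((n :⊖ k) :* x) :⊖ (n :⊖ :con 1ℤ) :* ((:con 1ℤ :+ k) :* y)
                          :⊖ (:con 1ℤ :+ k) :* ((n :⊖ (:con 1ℤ :+ k)) :* y)))
           := (n :⊖ k) :* (:con 1ℤ :+ a :+ (n :⊖ k :⊖ :con 1ℤ) :* c) :* (t :* (x :* p))
              :⊖ (:con 1ℤ :+ k) :* (:con (+ 2) :+ a :+ b :+ (:con (+ 2) :* n :⊖ k :⊖ :con (+ 2)) :* c) :* (y :* p)) ≈-refl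
           n′ k′ α′ β′ c′ t Φ eₖ eₖ₊₁ ⟩
    _ ∎
    where
    open PolyReasoning
    wE : sum (λ i → w i ⊗ E i) ≈ (con 1ℤ ⊕ k′) ⊗ eₖ₊₁
    wE = ≈-trans (sum-esym-weighted (suc k) w) (⊗-cong (con-+ 1ℤ (+ k)) ≈-refl)
    P : Poly K
    P = (con 1ℤ ⊕ α′) ⊗ t ⊗ Φ ⊗ ((n′ ⊖ k′) ⊗ eₖ) ⊖ (con (+ 2) ⊕ α′ ⊕ β′) ⊗ Φ ⊗ ((con 1ℤ ⊕ k′) ⊗ eₖ₊₁)

  -- The factor `t` remains because the coordinates are not normalised to t = 1; `Λ-total` evaluates
  -- it later.
  aomoto : (+ n + - + k) * (1ℤ + + α + (+ n + - + k + -1ℤ) * + c) * Λ (t ⊗ (eₖ ⊗ Φ))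
         ≡ (1ℤ + + k) * (+ 2 + + α + + β + (+ 2 * + n + - + k + - + 2) * + c) * Λ (eₖ₊₁ ⊗ Φ)
  aomoto = ℤₚ.i-j≡0⇒i≡j _ _ (begin
    c₁ * Λ X + - (c₂ * Λ Y)
      ≡⟨ Λ-combination c₁ c₂ X Y ⟨
    Λ (con c₁ ⊗ X ⊖ con c₂ ⊗ Y)
      ≡⟨ Λ-cong (≈-trans sum-∂ (⊖-cong (⊗-cong C₁ ≈-refl) (⊗-cong C₂ ≈-refl))) ⟨
    Λ (sum (λ i → ∂ i (A i ⊗ Φ)))
      ≡⟨ Λ-sum-0 {n = n} _ (λ i → Λ-∂ i (E i)) ⟩
    0ℤ ∎)
    where
    open ≡-Reasoning
    X = t ⊗ (eₖ ⊗ Φ)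
    Y = eₖ₊₁ ⊗ Φ
    c₁ = (+ n + - + k) * (1ℤ + + α + (+ n + - + k + -1ℤ) * + c)
    c₂ = (1ℤ + + k) * (+ 2 + + α + + β + (+ 2 * + n + - + k + - + 2) * + c)
    C₁ : (n′ ⊖ k′) ⊗ (con 1ℤ ⊕ α′ ⊕ (n′ ⊖ k′ ⊖ con 1ℤ) ⊗ c′) ≈ con c₁
    C₁ = ⊗-con (⊖-con ≈-refl ≈-refl) (⊕-con (⊕-con ≈-refl ≈-refl)
           (⊗-con (⊖-con (⊖-con ≈-refl ≈-refl) ≈-refl) ≈-refl))
    C₂ : (con 1ℤ ⊕ k′) ⊗ (con (+ 2) ⊕ α′ ⊕ β′ ⊕ (con (+ 2) ⊗ n′ ⊖ k′ ⊖ con (+ 2)) ⊗ c′) ≈ con c₂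
    C₂ = ⊗-con (⊕-con ≈-refl ≈-refl) (⊕-con (⊕-con (⊕-con ≈-refl ≈-refl) ≈-refl)
           (⊗-con (⊖-con (⊖-con (⊗-con ≈-refl ≈-refl) ≈-refl) ≈-refl) ≈-refl))

-- Products of powers of linear forms

pow : ∀ {K} → Poly K → ℕ → Poly K
pow p zero    = con 1ℤ
pow p (suc e) = p ⊗ pow p e

module _ {K : ℕ} (e : ℕ) where

  powers : ∀ {n} → (Fin n → Poly K) → Poly K
  powers {zero}  ℓ = con 1ℤ
  powers {suc n} ℓ = pow (ℓ zero) e ⊗ powers (ℓ ∘ suc)

  -- powers ℓ / ℓ h
  powers/ : ∀ {n} → (Fin n → Poly K) → Fin n → Poly K
  powers/ ℓ zero    = pow (ℓ zero) (pred e) ⊗ powers (ℓ ∘ suc)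
  powers/ ℓ (suc h) = pow (ℓ zero) e ⊗ powers/ (ℓ ∘ suc) h

  differences : ∀ {n} → (Fin n → Poly K) → Poly K
  differences {zero}  w = con 1ℤ
  differences {suc n} w = powers (λ h → w zero ⊖ w (suc h)) ⊗ differences (w ∘ suc)

  -- differences w / (w i - w j)
  differences/ : ∀ {n} → (Fin n → Poly K) → Fin n → Fin n → Poly K
  differences/ w zero    zero    = con 0ℤ
  differences/ w zero    (suc j) = powers/ (λ h → w zero ⊖ w (suc h)) j ⊗ differences (w ∘ suc)
  differences/ w (suc i) zero    = neg (differences/ w zero (suc i))
  differences/ w (suc i) (suc j) = powers (λ h → w zero ⊖ w (suc h)) ⊗ differences/ (w ∘ suc) i j

  differences/-self : ∀ {n} (w : Fin n → Poly K) i → differences/ w i i ≈ con 0ℤ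
  differences/-self w zero    = ≈-refl
  differences/-self w (suc i) = ≈-trans (⊗-cong ≈-refl (differences/-self (w ∘ suc) i))
    (solve 1 (λ p → p :* :con 0ℤ := :con 0ℤ) ≈-refl _)

  differences/-anti : ∀ {n} (w : Fin n → Poly K) i j → differences/ w j i ≈ neg (differences/ w i j)
  differences/-anti w zero    zero    = solve 0 (:con 0ℤ := :con -1ℤ :* :con 0ℤ) ≈-refl
  differences/-anti w zero    (suc j) = ≈-refl
  differences/-anti w (suc i) zero    = solve 1 (λ p → p := :con -1ℤ :* (:con -1ℤ :* p)) ≈-refl _
  differences/-anti w (suc i) (suc j) = ≈-trans (⊗-cong ≈-refl (differences/-anti (w ∘ suc) i j))
    (solve 2 (λ p q → p :* (:con -1ℤ :* q) := :con -1ℤ :* (p :* q)) ≈-refl _ _)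

powers/-⊗ : ∀ {K} e {n} (ℓ : Fin n → Poly K) h → ℓ h ⊗ powers/ (suc e) ℓ h ≈ powers (suc e) ℓ
powers/-⊗ e ℓ zero    = solve 3 (λ p q s → p :* (q :* s) := p :* q :* s) ≈-refl _ _ _
powers/-⊗ e ℓ (suc h) = ≈-trans
  (solve 3 (λ p q s → p :* (q :* s) := q :* (p :* s)) ≈-refl (ℓ (suc h)) (pow (ℓ zero) (suc e)) (powers/ (suc e) (ℓ ∘ suc) h))
  (⊗-cong ≈-refl (powers/-⊗ e (ℓ ∘ suc) h))

-- At exponent 0 `powers/` is not a true quotient, but the coefficient e hides this. Hence the
-- exponents α and β may be 0.
powers/-con : ∀ {K} e {n} (ℓ : Fin n → Poly K) h →
  con (+ e) ⊗ (ℓ h ⊗ powers/ e ℓ h) ≈ con (+ e) ⊗ powers e ℓ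
powers/-con zero    ℓ h = solve 2 (λ p q → :con 0ℤ :* p := :con 0ℤ :* q) ≈-refl _ _
powers/-con (suc e) ℓ h = ⊗-cong ≈-refl (powers/-⊗ e ℓ h)

-- No coefficient is available here to hide a failure at exponent 0. The exponent has to be
-- positive, which is why `Realisation` works with `suc c`.
differences/-⊗ : ∀ {K} e {n} (w : Fin n → Poly K) {i j} → i ≢ j →
  (w i ⊖ w j) ⊗ differences/ (suc e) w i j ≈ differences (suc e) w
differences/-⊗ e w {zero}  {zero}  i≢j = ⊥-elim (i≢j refl)
differences/-⊗ e w {zero}  {suc j} i≢j = ≈-trans
  (solve 3 (λ p q s → p :* (q :* s) := p :* q :* s) ≈-refl (w zero ⊖ w (suc j)) _ (differences (suc e) (w ∘ suc)))
  (⊗-cong (powers/-⊗ e (λ h → w zero ⊖ w (suc h)) j) ≈-refl)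
differences/-⊗ e w {suc i} {zero}  i≢j = ≈-trans
  (solve 3 (λ a b s → (a :⊖ b) :* (:con -1ℤ :* s) := (b :⊖ a) :* s) ≈-refl (w (suc i)) (w zero) _)
  (differences/-⊗ e w {zero} {suc i} (λ ()))
differences/-⊗ e w {suc i} {suc j} i≢j = ≈-trans
  (solve 3 (λ p q s → p :* (q :* s) := q :* (p :* s)) ≈-refl (w (suc i) ⊖ w (suc j))
    (powers (suc e) (λ h → w zero ⊖ w (suc h))) (differences/ (suc e) (w ∘ suc) i j))
  (⊗-cong ≈-refl (differences/-⊗ e (w ∘ suc) (i≢j ∘ cong suc)))

module _ {K : ℕ} {∂ : Poly K → Poly K} (d : IsDerivation ∂) where

  ∂-pow : ∀ p e → ∂ (pow p e) ≈ con (+ e) ⊗ (∂ p ⊗ pow p (pred e))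
  ∂-pow p zero = ≈-trans (∂-con d 1ℤ) (solve 1 (λ x → :con 0ℤ := :con 0ℤ :* x) ≈-refl _)
  ∂-pow p (suc zero) = ≈-trans (∂-⊗ d _ _) (≈-trans (⊕-cong ≈-refl (⊗-cong ≈-refl (∂-con d 1ℤ)))
    (solve 2 (λ p p′ → p′ :* :con 1ℤ :+ p :* :con 0ℤ := :con 1ℤ :* (p′ :* :con 1ℤ)) ≈-refl p (∂ p)))
  ∂-pow p (suc (suc e)) = ≈-trans (∂-⊗ d _ _) (≈-trans (⊕-cong ≈-refl (⊗-cong ≈-refl (∂-pow p (suc e)))) (≈-trans
    (solve 4 (λ p p′ e x → p′ :* (p :* x) :+ p :* (e :* (p′ :* x)) := (:con 1ℤ :+ e) :* (p′ :* (p :* x))) ≈-refl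
      p (∂ p) (con (+ suc e)) (pow p e))
    (⊗-cong (≈-sym (con-+ 1ℤ (+ suc e))) ≈-refl)))

  ∂-powers : ∀ e {n} (ℓ : Fin n → Poly K) →
    ∂ (powers e ℓ) ≈ con (+ e) ⊗ sum (λ h → ∂ (ℓ h) ⊗ powers/ e ℓ h)
  ∂-powers e {zero}  ℓ = ≈-trans (∂-con d 1ℤ) (solve 1 (λ x → :con 0ℤ := x :* :con 0ℤ) ≈-refl _)
  ∂-powers e {suc n} ℓ = begin
    ∂ (p ⊗ s)
      ≈⟨ ≈-trans (∂-⊗ d p s) (⊕-cong (⊗-cong (∂-pow (ℓ zero) e) ≈-refl) (⊗-cong ≈-refl (∂-powers e (ℓ ∘ suc)))) ⟩
    con (+ e) ⊗ (∂ (ℓ zero) ⊗ pow (ℓ zero) (pred e)) ⊗ s ⊕ p ⊗ (con (+ e) ⊗ sum (λ h → ∂ (ℓ (suc h)) ⊗ powers/ e (ℓ ∘ suc) h))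
      ≈⟨ solve 6 (λ e l q s p x → e :* (l :* q) :* s :+ p :* (e :* x) := e :* (l :* (q :* s) :+ p :* x)) ≈-refl
           (con (+ e)) (∂ (ℓ zero)) (pow (ℓ zero) (pred e)) s p _ ⟩
    con (+ e) ⊗ (∂ (ℓ zero) ⊗ powers/ e ℓ zero ⊕ p ⊗ sum (λ h → ∂ (ℓ (suc h)) ⊗ powers/ e (ℓ ∘ suc) h))
      ≈⟨ ⊗-cong ≈-refl (⊕-cong ≈-refl (≈-trans (≈-sym (sum-⊗ {n = n} p _)) (sum-cong-≋ (λ h →
           solve 3 (λ p l q → p :* (l :* q) := l :* (p :* q)) ≈-refl p (∂ (ℓ (suc h))) (powers/ e (ℓ ∘ suc) h))))) ⟩
    con (+ e) ⊗ sum (λ h → ∂ (ℓ h) ⊗ powers/ e ℓ h) ∎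
    where
    open PolyReasoning
    p = pow (ℓ zero) e
    s = powers e (ℓ ∘ suc)

  -- Only the factor `ℓ i` is moved by ∂, with slope σ, and multiplying by it restores the power
  -- lost. Used with σ = 1 for the positions wᵢ and σ = -1 for t - wᵢ.
  ∂-powers-δ : ∀ e {n} (ℓ : Fin n → Poly K) i σ → (∀ h → ∂ (ℓ h) ≈ con (δ i h) ⊗ σ) →
    ℓ i ⊗ ∂ (powers e ℓ) ≈ con (+ e) ⊗ (σ ⊗ powers e ℓ)
  ∂-powers-δ e {n} ℓ i σ ∂ℓ = begin
    ℓ i ⊗ ∂ (powers e ℓ)
      ≈⟨ ⊗-cong ≈-refl (≈-trans (∂-powers e ℓ) (⊗-cong ≈-refl (≈-trans (sum-cong-≋ (λ h →
           ≈-trans (⊗-cong (∂ℓ h) ≈-refl)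
             (solve 3 (λ a b c → a :* b :* c := a :* (b :* c)) ≈-refl (con (δ i h)) σ (powers/ e ℓ h))))
           (sum-δ i (λ h → σ ⊗ powers/ e ℓ h))))) ⟩
    ℓ i ⊗ (con (+ e) ⊗ (σ ⊗ powers/ e ℓ i))
      ≈⟨ solve 4 (λ l e s x → l :* (e :* (s :* x)) := s :* (e :* (l :* x))) ≈-refl _ _ _ _ ⟩
    σ ⊗ (con (+ e) ⊗ (ℓ i ⊗ powers/ e ℓ i))
      ≈⟨ ⊗-cong ≈-refl (powers/-con e ℓ i) ⟩
    σ ⊗ (con (+ e) ⊗ powers e ℓ)
      ≈⟨ solve 3 (λ s e x → s :* (e :* x) := e :* (s :* x)) ≈-refl _ _ _ ⟩
    con (+ e) ⊗ (σ ⊗ powers e ℓ) ∎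
    where open PolyReasoning

  -- The terms (∂ wᵢ - ∂ wⱼ) / (wᵢ - wⱼ) for i < j are regrouped by the variable differentiated: the
  -- part with ∂ wⱼ moves to row j, where antisymmetry of `differences/` accounts for its sign.
  ∂-differences : ∀ e {n} (w : Fin n → Poly K) →
    ∂ (differences e w) ≈ con (+ e) ⊗ sum (λ i → ∂ (w i) ⊗ sum (differences/ e w i))
  ∂-differences e {zero}  w = ≈-trans (∂-con d 1ℤ) (solve 1 (λ x → :con 0ℤ := x :* :con 0ℤ) ≈-refl _)
  ∂-differences e {suc n} w = begin
    ∂ (r ⊗ v)
      ≈⟨ ≈-trans (∂-⊗ d r v) (⊕-cong (⊗-cong (∂-powers e ℓ) ≈-refl) (⊗-cong ≈-refl (∂-differences e (w ∘ suc)))) ⟩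
    con (+ e) ⊗ sum (λ h → ∂ (ℓ h) ⊗ powers/ e ℓ h) ⊗ v ⊕ r ⊗ (con (+ e) ⊗ sum (λ i → w′ (suc i) ⊗ sum (differences/ e (w ∘ suc) i)))
      ≈⟨ solve 5 (λ e x v r y → e :* x :* v :+ r :* (e :* y) := e :* (v :* x :+ r :* y)) ≈-refl _ _ _ _ _ ⟩
    con (+ e) ⊗ (v ⊗ sum (λ h → ∂ (ℓ h) ⊗ powers/ e ℓ h) ⊕ r ⊗ sum (λ i → w′ (suc i) ⊗ sum (differences/ e (w ∘ suc) i)))
      ≈⟨ ⊗-cong ≈-refl (⊕-cong row rest) ⟩
    con (+ e) ⊗ ((w′ zero ⊗ sum q ⊕ sum (λ i → w′ (suc i) ⊗ neg (q i))) ⊕ sum (λ i → w′ (suc i) ⊗ sum (λ j → r ⊗ differences/ e (w ∘ suc) i j)))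
      ≈⟨ ⊗-cong ≈-refl (≈-trans (solve 3 (λ x y z → x :+ y :+ z := x :+ (y :+ z)) ≈-refl _ _ _)
           (⊕-cong (solve 2 (λ a b → a :* b := a :* (:con 0ℤ :+ b)) ≈-refl _ _)
             (≈-trans (≈-sym (sum-⊕ {n = n} _ _)) (sum-cong-≋ (λ i →
               solve 3 (λ a b c → a :* b :+ a :* c := a :* (b :+ c)) ≈-refl (w′ (suc i)) _ _))))) ⟩
    con (+ e) ⊗ sum (λ i → w′ i ⊗ sum (differences/ e w i)) ∎
    where
    open PolyReasoning
    ℓ : Fin n → Poly K
    ℓ h = w zero ⊖ w (suc h)
    r = powers e ℓ
    v = differences e (w ∘ suc)
    w′ : Fin (suc n) → Poly K
    w′ i = ∂ (w i)
    q : Fin n → Poly K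
    q i = differences/ e w zero (suc i)
    row : v ⊗ sum (λ h → ∂ (ℓ h) ⊗ powers/ e ℓ h) ≈ w′ zero ⊗ sum q ⊕ sum (λ i → w′ (suc i) ⊗ neg (q i))
    row = ≈-trans (≈-sym (sum-⊗ v (λ h → ∂ (ℓ h) ⊗ powers/ e ℓ h))) (≈-trans
      (sum-cong-≋ (λ h → ≈-trans (⊗-cong ≈-refl (⊗-cong (∂-⊖ d (w zero) (w (suc h))) ≈-refl))
        (solve 4 (λ v a b x → v :* ((a :⊖ b) :* x) := a :* (x :* v) :+ b :* (:con -1ℤ :* (x :* v))) ≈-refl
          v (w′ zero) (w′ (suc h)) (powers/ e ℓ h))))
      (≈-trans (sum-⊕ (λ h → w′ zero ⊗ q h) (λ h → w′ (suc h) ⊗ neg (q h))) (⊕-cong (sum-⊗ (w′ zero) q) ≈-refl)))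
    rest : r ⊗ sum (λ i → w′ (suc i) ⊗ sum (differences/ e (w ∘ suc) i))
         ≈ sum (λ i → w′ (suc i) ⊗ sum (λ j → r ⊗ differences/ e (w ∘ suc) i j))
    rest = ≈-trans (≈-sym (sum-⊗ r (λ i → w′ (suc i) ⊗ sum (differences/ e (w ∘ suc) i)))) (sum-cong-≋ (λ i →
      ≈-trans (solve 3 (λ r a x → r :* (a :* x) := a :* (r :* x)) ≈-refl r (w′ (suc i)) _)
        (⊗-cong ≈-refl (≈-sym (sum-⊗ r (differences/ e (w ∘ suc) i))))))

module _ {K : ℕ} where

  homogeneous-pow : ∀ e {p : Poly K} → Homogeneous 1 p → Homogeneous e (pow p e)
  homogeneous-pow zero    h = homogeneous-con 1ℤ
  homogeneous-pow (suc e) h = homogeneous-⊗ h (homogeneous-pow e h)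

  homogeneous-powers : ∀ e {n} {ℓ : Fin n → Poly K} → (∀ i → Homogeneous 1 (ℓ i)) → Homogeneous (n ℕ.* e) (powers e ℓ)
  homogeneous-powers e {zero}  h = homogeneous-con 1ℤ
  homogeneous-powers e {suc n} h = homogeneous-⊗ (homogeneous-pow e (h zero)) (homogeneous-powers e (h ∘ suc))

  homogeneous-⊖ : ∀ {d} {p q : Poly K} → Homogeneous d p → Homogeneous d q → Homogeneous d (p ⊖ q)
  homogeneous-⊖ h h′ = homogeneous-⊕ h (homogeneous-neg h′)

  homogeneous-esym : ∀ k {n} {w : Fin n → Poly K} → (∀ i → Homogeneous 1 (w i)) → Homogeneous k (esym k w)
  homogeneous-esym zero    h         = homogeneous-con 1ℤ
  homogeneous-esym (suc k) {zero}  h = homogeneous-0 (suc k)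
  homogeneous-esym (suc k) {suc n} h =
    homogeneous-⊕ (homogeneous-⊗ (h zero) (homogeneous-esym k (h ∘ suc))) (homogeneous-esym (suc k) (h ∘ suc))

triangle : ℕ → ℕ
triangle zero    = 0
triangle (suc n) = n ℕ.+ triangle n

homogeneous-differences : ∀ {K} e {n} {w : Fin n → Poly K} → (∀ i → Homogeneous 1 (w i)) →
  Homogeneous (triangle n ℕ.* e) (differences e w)
homogeneous-differences e {zero}  h = homogeneous-con 1ℤ
homogeneous-differences e {suc n} {w} h = subst (λ d → Homogeneous d (differences e w)) (sym (ℕₚ.*-distribʳ-+ e n (triangle n)))
  (homogeneous-⊗ (homogeneous-powers e (λ i → homogeneous-⊖ (h zero) (h (suc i)))) (homogeneous-differences e (h ∘ suc)))

D-isDerivation : ∀ {K} (g : Fin K) → IsDerivation (D g)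
D-isDerivation g = record
  { ∂-cong = D-cong g ; ∂-con = λ _ → ≈-refl ; ∂-⊕ = λ _ _ → ≈-refl ; ∂-⊗ = λ _ _ → ≈-refl }

⊖-isDerivation : ∀ {K} {∂ ∂′ : Poly K → Poly K} → IsDerivation ∂ → IsDerivation ∂′ → IsDerivation (λ p → ∂ p ⊖ ∂′ p)
⊖-isDerivation d d′ = record
  { ∂-cong = λ e → ⊖-cong (∂-cong d e) (∂-cong d′ e)
  ; ∂-con  = λ c → ≈-trans (⊖-cong (∂-con d c) (∂-con d′ c)) (solve 0 (:con 0ℤ :⊖ :con 0ℤ := :con 0ℤ) ≈-refl)
  ; ∂-⊕    = λ p q → ≈-trans (⊖-cong (∂-⊕ d p q) (∂-⊕ d′ p q))
      (solve 4 (λ a b x y → (a :+ b) :⊖ (x :+ y) := (a :⊖ x) :+ (b :⊖ y)) ≈-refl _ _ _ _)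
  ; ∂-⊗    = λ p q → ≈-trans (⊖-cong (∂-⊗ d p q) (∂-⊗ d′ p q))
      (solve 6 (λ p q a b x y → (a :* q :+ p :* b) :⊖ (x :* q :+ p :* y) := (a :⊖ x) :* q :+ p :* (b :⊖ y)) ≈-refl p q _ _ _ _) }

neg-isDerivation : ∀ {K} {∂ : Poly K → Poly K} → IsDerivation ∂ → IsDerivation (neg ∘ ∂)
neg-isDerivation d = record
  { ∂-cong = λ e → neg-cong (∂-cong d e)
  ; ∂-con  = λ c → ≈-trans (neg-cong (∂-con d c)) (solve 0 (:con -1ℤ :* :con 0ℤ := :con 0ℤ) ≈-refl)
  ; ∂-⊕    = λ p q → ≈-trans (neg-cong (∂-⊕ d p q))
      (solve 2 (λ a b → :con -1ℤ :* (a :+ b) := :con -1ℤ :* a :+ :con -1ℤ :* b) ≈-refl _ _)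
  ; ∂-⊗    = λ p q → ≈-trans (neg-cong (∂-⊗ d p q))
      (solve 4 (λ p q a b → :con -1ℤ :* (a :* q :+ p :* b) := (:con -1ℤ :* a) :* q :+ p :* (:con -1ℤ :* b)) ≈-refl p q _ _) }

-- Φ stays the same polynomial and is only read in the variables t - wᵢ. Differences of these change
-- sign, so both `∂` and `G` are negated, while the two ends of the range exchange α and β.
reflect : ∀ {n K α β c} {t Φ : Poly K} {w : Fin n → Poly K} →
  SelbergSystem α β c t Φ w → SelbergSystem β α c t Φ (λ i → t ⊖ w i)
reflect {n} {K} {α} {β} {c} {t} {Φ} {w} S = record
  { ∂       = λ i → neg ∘ ∂ i
  ; G       = λ i j → neg (G i j)
  ; ∂-deriv = neg-isDerivation ∘ ∂-deriv
  ; ∂-w     = λ i j → ≈-trans (neg-cong (≈-trans (∂-⊖ (∂-deriv i) t (w j)) (⊖-cong (∂-t i) (∂-w i j))))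
      (solve 1 (λ x → :con -1ℤ :* (:con 0ℤ :⊖ x) := x) ≈-refl _)
  ; ∂-t     = λ i → ≈-trans (neg-cong (∂-t i)) (solve 0 (:con -1ℤ :* :con 0ℤ := :con 0ℤ) ≈-refl)
  ; G-self  = λ i → ≈-trans (neg-cong (G-self i)) (solve 0 (:con -1ℤ :* :con 0ℤ := :con 0ℤ) ≈-refl)
  ; G-anti  = λ i j → neg-cong (G-anti i j)
  ; G-Φ     = λ {i} {j} i≢j → ≈-trans
      (solve 4 (λ t a b g → ((t :⊖ a) :⊖ (t :⊖ b)) :* (:con -1ℤ :* g) := (a :⊖ b) :* g) ≈-refl t (w i) (w j) (G i j)) (G-Φ i≢j)
  ; ∂-Φ     = λ i → ≈-trans
      (solve 3 (λ t a p → (t :⊖ a) :* (t :⊖ (t :⊖ a)) :* (:con -1ℤ :* p) := :con -1ℤ :* (a :* (t :⊖ a) :* p)) ≈-refl t (w i) (∂ i Φ))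
      (≈-trans (neg-cong (∂-Φ i)) (≈-trans
        (solve 7 (λ x y t a p c g → :con -1ℤ :* ((x :* (t :⊖ a) :⊖ y :* a) :* p :+ :con (+ 2) :* (c :* (a :* (t :⊖ a) :* g)))
            := (y :* (t :⊖ (t :⊖ a)) :⊖ x :* (t :⊖ a)) :* p :+ :con (+ 2) :* (c :* ((t :⊖ a) :* (t :⊖ (t :⊖ a)) :* (:con -1ℤ :* g)))) ≈-refl
          (con (+ α)) (con (+ β)) t (w i) Φ (con (+ c)) (sum (G i)))
        (⊕-cong ≈-refl (⊗-cong ≈-refl (⊗-cong ≈-refl (⊗-cong ≈-refl (≈-sym (sum-⊗ {n = n} (con -1ℤ) (G i)))))))))
  ; Λ-∂     = λ i p → trans (Λ-con -1ℤ (∂ i ((t ⊖ w i) ⊗ (t ⊖ (t ⊖ w i)) ⊗ p ⊗ Φ))) (cong (-1ℤ *_) (trans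
      (Λ-cong (∂-cong (∂-deriv i) (solve 4 (λ t a p f → (t :⊖ a) :* (t :⊖ (t :⊖ a)) :* p :* f := a :* (t :⊖ a) :* p :* f) ≈-refl t (w i) p Φ)))
      (Λ-∂ i p)))
  }
  where open SelbergSystem S

-- The Selberg polynomial in gap coordinates

-- The indicator of `k < j`. It will be the coefficient, in the sum of the lowest j gaps, of the gap
-- numbered k from the bottom.
θ : ℕ → ℕ → ℤ
θ k       zero    = 0ℤ
θ zero    (suc j) = 1ℤ
θ (suc k) (suc j) = θ k j

θ-≤ : ∀ {k j} → j ≤ k → θ k j ≡ 0ℤ
θ-≤ z≤n       = refl
θ-≤ (s≤s j≤k) = θ-≤ j≤k

θ-< : ∀ {k j} → k < j → θ k j ≡ 1ℤ
θ-< {zero}  (s≤s _)   = refl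
θ-< {suc k} (s≤s k<j) = θ-< k<j

-- The sum of the lowest j gaps (of all K gaps when j ≥ K). Gaps are listed from the top
-- one down, so that variable 0 is the gap above all chain vertices.
ζ : ∀ K → ℕ → Poly K
ζ zero    j = con 0ℤ
ζ (suc K) j = lift (ζ K j) ⊕ con (θ K j) ⊗ var zero

-- Gaps are numbered from the bottom but variables from the top, so a new gap on top is a new
-- variable 0 and `lift` carries everything below it over unchanged.
gap : ∀ {K} → Fin K → ℕ
gap {suc K} zero    = K
gap         (suc g) = gap g

gap< : ∀ {K} (g : Fin K) → gap g < K
gap< {suc K} zero    = ℕₚ.≤-refl
gap< {suc K} (suc g) = ℕₚ.m≤n⇒m≤1+n (gap< g)

gap-inject₁ : ∀ {K} (g : Fin K) → gap (inject₁ g) ≡ suc (gap g)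
gap-inject₁ {suc K} zero    = refl
gap-inject₁ {suc K} (suc g) = gap-inject₁ g

gap-surjective : ∀ {K j} → j < K → ∃ λ (g : Fin K) → gap g ≡ j
gap-surjective {suc K} {j} (s≤s j≤K) with ℕₚ.m≤n⇒m<n∨m≡n j≤K
... | inj₂ refl = zero , refl
... | inj₁ j<K  = let g , e = gap-surjective j<K in suc g , e

-- The indicator of g ≤ h minus that of g < h is that of g = h. This makes the difference of the
-- derivatives in two adjacent gaps dual to the positions.
θ-δ : ∀ {K} (g h : Fin K) → θ (gap g) (suc (gap h)) + - θ (suc (gap g)) (suc (gap h)) ≡ δ g h
θ-δ {suc K} zero    zero    rewrite θ-< (ℕₚ.n<1+n K) | θ-≤ (ℕₚ.≤-refl {K}) = refl
θ-δ {suc K} zero    (suc h) rewrite θ-≤ (gap< h) | θ-≤ {K} (ℕₚ.<⇒≤ (gap< h)) = refl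
θ-δ {suc K} (suc g) zero    rewrite θ-< (ℕₚ.m≤n⇒m≤1+n (gap< g)) | θ-< (gap< g) = refl
θ-δ {suc K} (suc g) (suc h) = θ-δ g h

D-ζ : ∀ {K} (g : Fin K) j → D g (ζ K j) ≈ con (θ (gap g) j)
D-ζ {suc K} zero    j = ≈-trans (⊕-cong (D-lift-zero (ζ K j)) ≈-refl)
  (solve 2 (λ x y → :con 0ℤ :+ (:con 0ℤ :* x :+ y :* :con 1ℤ) := y) ≈-refl (var zero) (con (θ K j)))
D-ζ {suc K} (suc g) j = ≈-trans (⊕-cong (≈-trans (≡⇒≈ (D-lift-suc g (ζ K j))) (lift-cong (D-ζ g j))) ≈-refl)
  (solve 3 (λ x y z → z :+ (:con 0ℤ :* x :+ y :* :con 0ℤ) := z) ≈-refl (var zero) (con (θ K j)) (con (θ (gap g) j)))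

ζ-saturates : ∀ {K j} → K ≤ j → ζ K j ≡ ζ K K
ζ-saturates {zero}  K≤j = refl
ζ-saturates {suc K} K<j = cong₂ (λ p c → lift p ⊕ con c ⊗ var zero)
  (trans (ζ-saturates (ℕₚ.<⇒≤ K<j)) (sym (ζ-saturates (ℕₚ.n≤1+n K))))
  (trans (θ-< K<j) (sym (θ-< (ℕₚ.n<1+n K))))

ζ-0 : ∀ K → ζ K 0 ≈ con 0ℤ
ζ-0 zero    = ≈-refl
ζ-0 (suc K) = ≈-trans (⊕-cong (lift-cong (ζ-0 K)) ≈-refl)
  (solve 1 (λ x → :con 0ℤ :+ :con 0ℤ :* x := :con 0ℤ) ≈-refl (var zero))

ζ-step : ∀ {K} (g : Fin K) → ζ K (suc (gap g)) ⊖ ζ K (gap g) ≈ var g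
ζ-step {suc K} zero = ≈-trans
  (⊖-cong (⊕-cong (≡⇒≈ (cong lift (ζ-saturates (ℕₚ.n≤1+n K)))) (⊗-cong (con-cong (θ-< (ℕₚ.n<1+n K))) ≈-refl))
          (⊕-cong ≈-refl (⊗-cong (con-cong (θ-≤ (ℕₚ.≤-refl {K}))) ≈-refl)))
  (solve 2 (λ x y → (x :+ :con 1ℤ :* y) :⊖ (x :+ :con 0ℤ :* y) := y) ≈-refl (lift (ζ K K)) (var zero))
ζ-step {suc K} (suc g) = ≈-trans
  (⊖-cong (⊕-cong ≈-refl (⊗-cong (con-cong (θ-≤ (gap< g))) ≈-refl))
          (⊕-cong ≈-refl (⊗-cong (con-cong (θ-≤ (ℕₚ.<⇒≤ (gap< g)))) ≈-refl)))
  (≈-trans (solve 3 (λ a b y → (a :+ :con 0ℤ :* y) :⊖ (b :+ :con 0ℤ :* y) := a :⊖ b) ≈-refl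
             (lift (ζ K (suc (gap g)))) (lift (ζ K (gap g))) (var zero))
           (lift-cong (ζ-step g)))

homogeneous-ζ : ∀ K j → Homogeneous 1 (ζ K j)
homogeneous-ζ zero    j = homogeneous-0 1
homogeneous-ζ (suc K) j = homogeneous-⊕ (homogeneous-lift (homogeneous-ζ K j))
  (homogeneous-⊗ (homogeneous-con (θ K j)) (homogeneous-var zero))

total : ∀ K → Poly K
total K = ζ K K

-- Multiplying a monomial by one gap variable scales its weight by the exponent of that variable
-- plus 1; over all K gaps these factors add up to degree + K.
ζ-weight : ∀ K {j} → K ≤ j → (m : Mon K) → ⟪ ζ K j ⟫ (λ u → weight (u · m)) ≡ + (degree m ℕ.+ K) * weight m
ζ-weight zero    K≤j []      = refl
ζ-weight (suc K) {j} K<j (k ∷ m) = begin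
  ⟪ lift (ζ K j) ⟫ (λ u → weight (u · (k ∷ m))) + θ K j * (+ (suc k !) * weight ((𝟘 · 𝟘) · m))
    ≡⟨ cong₂ _+_ (trans (lift-pairing (ζ K j) _) (trans (pairing-* (ζ K j) (+ (k !)) (λ u → weight (u · m)))
                    (cong (+ (k !) *_) (ζ-weight K (ℕₚ.<⇒≤ K<j) m))))
         (cong₂ _*_ (θ-< K<j) (cong₂ _*_ (ℤₚ.pos-* (suc k) (k !))
           (cong weight (trans (cong (_· m) (·-identityˡ 𝟘)) (·-identityˡ m))))) ⟩
  + (k !) * (+ (degree m ℕ.+ K) * weight m) + 1ℤ * (+ suc k * + (k !) * weight m)
    ≡⟨ lemma (+ (k !)) (+ (degree m ℕ.+ K)) (+ suc k) (weight m) ⟩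
  (+ suc k + + (degree m ℕ.+ K)) * (+ (k !) * weight m)
    ≡⟨ cong (_* (+ (k !) * weight m)) (trans (sym (ℤₚ.pos-+ (suc k) (degree m ℕ.+ K))) (cong +_
         (trans (cong suc (sym (ℕₚ.+-assoc k (degree m) K))) (sym (ℕₚ.+-suc (k ℕ.+ degree m) K))))) ⟩
  + (degree (k ∷ m) ℕ.+ suc K) * weight (k ∷ m) ∎
  where
  open ≡-Reasoning
  lemma : ∀ f d s x → f * (d * x) + 1ℤ * (s * f * x) ≡ (s + d) * (f * x)
  lemma = solve-∀

-- With t as radius, a form of degree d in K variables integrates to a multiple of Γ(d + K); an
-- extra t replaces this by Γ(d + K + 1).
Λ-total : ∀ {K d} {p : Poly K} → Homogeneous d p → Λ (total K ⊗ p) ≡ + (d ℕ.+ K) * Λ p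
Λ-total {K} {d} {p} h = begin
  Λ (total K ⊗ p)
    ≡⟨ pairing-swap (total K) p _ ⟩
  ⟪ p ⟫ (λ m → ⟪ total K ⟫ (λ u → weight (u · m)))
    ≡⟨ pairing-cong p (λ m → trans (ζ-weight K ℕₚ.≤-refl m)
         (trans (cong (_* weight m) (ℤₚ.pos-+ (degree m) K)) (ℤₚ.*-distribʳ-+ (weight m) (+ degree m) (+ K)))) ⟩
  ⟪ p ⟫ (λ m → + degree m * weight m + + K * weight m)
    ≡⟨ trans (pairing-+ p _ _) (cong₂ _+_ (euler h weight) (pairing-* p (+ K) weight)) ⟩
  + d * Λ p + + K * Λ p
    ≡⟨ trans (cong (_* Λ p) (ℤₚ.pos-+ d K)) (ℤₚ.*-distribʳ-+ (Λ p) (+ d) (+ K)) ⟨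
  + (d ℕ.+ K) * Λ p ∎
  where open ≡-Reasoning

-- The position of the chain vertex x_(1 + gap i).
pos : ∀ n → Fin n → Poly (suc n)
pos n i = ζ (suc n) (suc (gap i))

selberg : ∀ n α β c → Poly (suc n)
selberg n α β c = powers α (pos n) ⊗ powers β (λ i → total (suc n) ⊖ pos n i) ⊗ differences (2 ℕ.* c) (pos n)

degree-selberg : ℕ → ℕ → ℕ → ℕ → ℕ
degree-selberg n α β c = n ℕ.* α ℕ.+ n ℕ.* β ℕ.+ triangle n ℕ.* (2 ℕ.* c)

homogeneous-pos : ∀ n i → Homogeneous 1 (pos n i)
homogeneous-pos n i = homogeneous-ζ (suc n) (suc (gap i))

homogeneous-selberg : ∀ n α β c → Homogeneous (degree-selberg n α β c) (selberg n α β c)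
homogeneous-selberg n α β c = homogeneous-⊗ (homogeneous-⊗ (homogeneous-powers α (homogeneous-pos n))
  (homogeneous-powers β (λ i → homogeneous-⊖ (homogeneous-ζ (suc n) (suc n)) (homogeneous-pos n i))))
  (homogeneous-differences (2 ℕ.* c) (homogeneous-pos n))

module Realisation (n α β c : ℕ) where

  private
    t = total (suc n)
    w = pos n
    A = powers α w
    B = powers β (λ i → t ⊖ w i)
    Φ = selberg n α β (suc c)

    G : Fin n → Fin n → Poly (suc n)
    G i j = A ⊗ B ⊗ differences/ (2 ℕ.* suc c) w i j

    -- The derivative in the position of one chain vertex, the others being fixed: raising the
    -- vertex lengthens the gap below it (`suc i`) and shortens the gap above it (`inject₁ i`).
    ∂ : Fin n → Poly (suc n) → Poly (suc n)
    ∂ i p = D (suc i) p ⊖ D (inject₁ i) p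

    ∂-isDerivation : ∀ i → IsDerivation (∂ i)
    ∂-isDerivation i = ⊖-isDerivation (D-isDerivation (suc i)) (D-isDerivation (inject₁ i))

    ∂-ζ : ∀ i j → ∂ i (ζ (suc n) j) ≈ con (θ (gap i) j + - θ (suc (gap i)) j)
    ∂-ζ i j = ⊖-con (D-ζ (suc i) j) (≈-trans (D-ζ (inject₁ i) j) (con-cong (cong (λ g → θ g j) (gap-inject₁ i))))

    ∂-pos : ∀ i j → ∂ i (w j) ≈ con (δ i j)
    ∂-pos i j = ≈-trans (∂-ζ i (suc (gap j))) (con-cong (θ-δ i j))

    ∂-total : ∀ i → ∂ i t ≈ con 0ℤ
    ∂-total i = ≈-trans (∂-ζ i (suc n)) (con-cong (cong₂ (λ a b → a + - b)
      (θ-< (ℕₚ.m≤n⇒m≤1+n (gap< i))) (θ-< (gap< i))))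

    G-⊗ : ∀ {i j} → i ≢ j → (w i ⊖ w j) ⊗ G i j ≈ Φ
    G-⊗ i≢j = ≈-trans (solve 3 (λ x y z → x :* (y :* z) := y :* (x :* z)) ≈-refl _ (A ⊗ B) _)
      (⊗-cong ≈-refl (differences/-⊗ _ w i≢j))

    ∂-selberg : ∀ i → w i ⊗ (t ⊖ w i) ⊗ ∂ i Φ ≈ (con (+ α) ⊗ (t ⊖ w i) ⊖ con (+ β) ⊗ w i) ⊗ Φ
                  ⊕ con (+ 2) ⊗ (con (+ suc c) ⊗ (w i ⊗ (t ⊖ w i) ⊗ sum (G i)))
    ∂-selberg i = begin
      w i ⊗ u ⊗ ∂ i Φ
        ≈⟨ ⊗-cong ≈-refl (≈-trans (∂-⊗ d (A ⊗ B) P) (⊕-cong (⊗-cong (∂-⊗ d A B) ≈-refl) (⊗-cong ≈-refl ∂P))) ⟩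
      w i ⊗ u ⊗ ((∂ i A ⊗ B ⊕ A ⊗ ∂ i B) ⊗ P ⊕ A ⊗ B ⊗ (con (+ 2) ⊗ con (+ suc c) ⊗ sum (differences/ (2 ℕ.* suc c) w i)))
        ≈⟨ solve 9 (λ w u a b a′ b′ p c g → w :* u :* ((a′ :* b :+ a :* b′) :* p :+ a :* b :* (:con (+ 2) :* c :* g))
              := (w :* a′) :* (u :* b :* p) :+ (u :* b′) :* (w :* a :* p) :+ :con (+ 2) :* (c :* (w :* u :* (a :* b :* g))))
              ≈-refl (w i) u A B (∂ i A) (∂ i B) P (con (+ suc c)) (sum (differences/ (2 ℕ.* suc c) w i)) ⟩
      (w i ⊗ ∂ i A) ⊗ (u ⊗ B ⊗ P) ⊕ (u ⊗ ∂ i B) ⊗ (w i ⊗ A ⊗ P)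
        ⊕ con (+ 2) ⊗ (con (+ suc c) ⊗ (w i ⊗ u ⊗ (A ⊗ B ⊗ sum (differences/ (2 ℕ.* suc c) w i))))
        ≈⟨ ⊕-cong (⊕-cong (⊗-cong ∂A ≈-refl) (⊗-cong ∂B ≈-refl)) (⊗-cong ≈-refl (⊗-cong ≈-refl (⊗-cong ≈-refl
             (≈-sym (sum-⊗ {n = n} (A ⊗ B) (differences/ (2 ℕ.* suc c) w i)))))) ⟩
      con (+ α) ⊗ (con 1ℤ ⊗ A) ⊗ (u ⊗ B ⊗ P) ⊕ con (+ β) ⊗ (con -1ℤ ⊗ B) ⊗ (w i ⊗ A ⊗ P)
        ⊕ con (+ 2) ⊗ (con (+ suc c) ⊗ (w i ⊗ u ⊗ sum (G i)))
        ≈⟨ ⊕-cong (solve 7 (λ x y w u a b p → x :* (:con 1ℤ :* a) :* (u :* b :* p) :+ y :* (:con -1ℤ :* b) :* (w :* a :* p)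
              := (x :* u :⊖ y :* w) :* (a :* b :* p)) ≈-refl (con (+ α)) (con (+ β)) (w i) u A B P) ≈-refl ⟩
      (con (+ α) ⊗ u ⊖ con (+ β) ⊗ w i) ⊗ Φ ⊕ con (+ 2) ⊗ (con (+ suc c) ⊗ (w i ⊗ u ⊗ sum (G i))) ∎
      where
      open PolyReasoning
      d = ∂-isDerivation i
      u = t ⊖ w i
      P = differences (2 ℕ.* suc c) w
      ∂A : w i ⊗ ∂ i A ≈ con (+ α) ⊗ (con 1ℤ ⊗ A)
      ∂A = ∂-powers-δ d α w i (con 1ℤ) (λ h → ≈-trans (∂-pos i h) (solve 1 (λ x → x := x :* :con 1ℤ) ≈-refl _))
      ∂B : u ⊗ ∂ i B ≈ con (+ β) ⊗ (con -1ℤ ⊗ B)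
      ∂B = ∂-powers-δ d β (λ h → t ⊖ w h) i (con -1ℤ) (λ h → ≈-trans (∂-⊖ d t (w h)) (≈-trans (⊖-cong (∂-total i) (∂-pos i h))
        (solve 1 (λ x → :con 0ℤ :⊖ x := x :* :con -1ℤ) ≈-refl _)))
      ∂P : ∂ i P ≈ con (+ 2) ⊗ con (+ suc c) ⊗ sum (differences/ (2 ℕ.* suc c) w i)
      ∂P = ≈-trans (∂-differences d (2 ℕ.* suc c) w) (⊗-cong
        (≈-trans (con-cong (ℤₚ.pos-* 2 (suc c))) (con-* (+ 2) (+ suc c)))
        (≈-trans (sum-cong-≋ (λ h → ⊗-cong (∂-pos i h) ≈-refl)) (sum-δ i (λ h → sum (differences/ (2 ℕ.* suc c) w h)))))

    Λ-D-multiple : ∀ (g : Fin (suc n)) {p q} → p ≈ var g ⊗ q → Λ (D g p) ≡ Λ p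
    Λ-D-multiple g {q = q} e = trans (Λ-cong (D-cong g e)) (trans (Λ-D-var g q) (sym (Λ-cong e)))

    module _ (i : Fin n) (p : Poly (suc n)) where

      Q : Poly (suc n)
      Q = w i ⊗ (t ⊖ w i) ⊗ p ⊗ Φ

      neighbour : ∀ {j} → i ≢ j → Q ≈ (w i ⊖ w j) ⊗ (w i ⊗ (t ⊖ w i) ⊗ p ⊗ G i j)
      neighbour i≢j = ≈-trans (⊗-cong ≈-refl (≈-sym (G-⊗ i≢j)))
        (solve 3 (λ x y z → x :* (y :* z) := y :* (x :* z)) ≈-refl _ _ _)

      -- If the vertex is lowest in the chain, the gap below it is wᵢ, a factor of `Q`. Otherwise
      -- the gap is wᵢ - wⱼ for the next lower vertex j, and `G i j` provides the quotient.
      below : ∃ λ q → Q ≈ var (suc i) ⊗ q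
      below = from (gap i) refl (gap< i)
        where
        from : ∀ γ → gap i ≡ γ → γ < n → ∃ λ q → Q ≈ var (suc i) ⊗ q
        from zero eq _ = (t ⊖ w i) ⊗ p ⊗ Φ , ≈-trans
            (solve 4 (λ a b c d → a :* b :* c :* d := a :* (b :* c :* d)) ≈-refl (w i) (t ⊖ w i) p Φ)
            (⊗-cong (≈-trans (≈-trans (solve 1 (λ a → a := a :⊖ :con 0ℤ) ≈-refl (w i))
              (⊖-cong ≈-refl (≈-trans (≈-sym (ζ-0 (suc n))) (≡⇒≈ (cong (ζ (suc n)) (sym eq)))))) (ζ-step (suc i))) ≈-refl)
        from (suc γ) eq γ<n =
          let j , e = gap-surjective (ℕₚ.<⇒≤ γ<n)
              i≢j = λ i≡j → ℕₚ.1+n≢n (trans (sym eq) (trans (cong gap i≡j) e))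
          in w i ⊗ (t ⊖ w i) ⊗ p ⊗ G i j , ≈-trans (neighbour i≢j) (⊗-cong (≈-trans
               (⊖-cong ≈-refl (≡⇒≈ (cong (ζ (suc n)) (trans (cong suc e) (sym eq))))) (ζ-step (suc i))) ≈-refl)

      -- Likewise, with t - wᵢ for the highest chain vertex, and otherwise with wⱼ - wᵢ for the next
      -- higher vertex j, hence the sign.
      above : ∃ λ q → Q ≈ var (inject₁ i) ⊗ q
      above with ℕₚ.m≤n⇒m<n∨m≡n (gap< i)
      ... | inj₂ e = w i ⊗ p ⊗ Φ , ≈-trans
            (solve 4 (λ a b c d → a :* b :* c :* d := b :* (a :* c :* d)) ≈-refl (w i) (t ⊖ w i) p Φ)
            (⊗-cong (≈-trans (⊖-cong (≡⇒≈ (cong (λ j → ζ (suc n) (suc j)) (trans (sym e) (sym (gap-inject₁ i)))))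
                                     (≡⇒≈ (cong (ζ (suc n)) (sym (gap-inject₁ i))))) (ζ-step (inject₁ i))) ≈-refl)
      ... | inj₁ γ<n = let j , e = gap-surjective γ<n
                           i≢j = λ i≡j → ℕₚ.1+n≢n (trans (sym e) (sym (cong gap i≡j)))
                       in neg (w i ⊗ (t ⊖ w i) ⊗ p ⊗ G i j) , ≈-trans (neighbour i≢j) (≈-trans
                            (solve 3 (λ a b x → (a :⊖ b) :* x := (b :⊖ a) :* (:con -1ℤ :* x)) ≈-refl (w i) (w j) _)
                            (⊗-cong (≈-trans (⊖-cong (≡⇒≈ (cong (λ j → ζ (suc n) (suc j)) (trans e (sym (gap-inject₁ i)))))
                                     (≡⇒≈ (cong (ζ (suc n)) (sym (gap-inject₁ i))))) (ζ-step (inject₁ i))) ≈-refl))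

      -- By the two divisibilities each of the two derivatives has the value Λ Q, and ∂ᵢ is their
      -- difference.
      Λ-∂-selberg : Λ (∂ i Q) ≡ 0ℤ
      Λ-∂-selberg = trans (cong₂ _+_ (Λ-D-multiple (suc i) (proj₂ below))
          (trans (Λ-con -1ℤ (D (inject₁ i) Q)) (cong (-1ℤ *_) (Λ-D-multiple (inject₁ i) (proj₂ above)))))
        (trans (cong (λ z → Λ Q + z) (ℤₚ.-1*i≡-i (Λ Q))) (ℤₚ.+-inverseʳ (Λ Q)))

  selbergSystem : SelbergSystem α β (suc c) t Φ w
  selbergSystem = record
    { ∂ = ∂ ; G = G ; ∂-deriv = ∂-isDerivation ; ∂-w = ∂-pos ; ∂-t = ∂-total
    ; G-self = λ i → ≈-trans (⊗-cong ≈-refl (differences/-self _ w i)) (solve 1 (λ x → x :* :con 0ℤ := :con 0ℤ) ≈-refl _)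
    ; G-anti = λ i j → ≈-trans (⊗-cong ≈-refl (differences/-anti _ w i j))
        (solve 2 (λ x y → x :* (:con -1ℤ :* y) := :con -1ℤ :* (x :* y)) ≈-refl _ _)
    ; G-Φ = G-⊗ ; ∂-Φ = ∂-selberg ; Λ-∂ = Λ-∂-selberg }

-- Evaluation of the Selberg integral

∏ : ℕ → (ℕ → ℕ) → ℕ
∏ zero    f = 1
∏ (suc n) f = ∏ n f ℕ.* f n

∏-cong : ∀ n {f g : ℕ → ℕ} → (∀ j → j < n → f j ≡ g j) → ∏ n f ≡ ∏ n g
∏-cong zero    e = refl
∏-cong (suc n) e = cong₂ ℕ._*_ (∏-cong n (λ j j<n → e j (ℕₚ.m≤n⇒m≤1+n j<n))) (e n ℕₚ.≤-refl)

∏-* : ∀ n f g → ∏ n (λ j → f j ℕ.* g j) ≡ ∏ n f ℕ.* ∏ n g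
∏-* zero    f g = refl
∏-* (suc n) f g = trans (cong (ℕ._* (f n ℕ.* g n)) (∏-* n f g)) (lemma (∏ n f) (∏ n g) (f n) (g n))
  where
  lemma : ∀ a b c d → a ℕ.* b ℕ.* (c ℕ.* d) ≡ (a ℕ.* c) ℕ.* (b ℕ.* d)
  lemma = ℕ-solve-∀

∏-front : ∀ n f → ∏ (suc n) f ≡ f 0 ℕ.* ∏ n (f ∘ suc)
∏-front zero    f = trans (ℕₚ.+-identityʳ (f 0)) (sym (ℕₚ.*-identityʳ (f 0)))
∏-front (suc n) f = trans (cong (ℕ._* f (suc n)) (∏-front n f)) (ℕₚ.*-assoc (f 0) _ _)

∏-! : ∀ n → ∏ n suc ≡ n !
∏-! zero    = refl
∏-! (suc n) = trans (cong (ℕ._* suc n) (∏-! n)) (ℕₚ.*-comm (n !) (suc n))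

rising : ℕ → ℕ → ℕ
rising x zero    = 1
rising x (suc j) = x ℕ.* rising (suc x) j

rising-! : ∀ m j → m ! ℕ.* rising (suc m) j ≡ (m ℕ.+ j) !
rising-! m zero    = trans (ℕₚ.*-identityʳ (m !)) (cong _! (sym (ℕₚ.+-identityʳ m)))
rising-! m (suc j) = trans (lemma (m !) (suc m) (rising (suc (suc m)) j))
  (trans (rising-! (suc m) j) (cong _! (sym (ℕₚ.+-suc m j))))
  where
  lemma : ∀ a b c → a ℕ.* (b ℕ.* c) ≡ b ℕ.* a ℕ.* c
  lemma = ℕ-solve-∀

module Chain {n K α β c d : ℕ} {Φ : Poly K} {w : Fin n → Poly K} (S : SelbergSystem α β c (total K) Φ w)
  (hΦ : Homogeneous d Φ) (hw : ∀ i → Homogeneous 1 (w i)) where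

  private
    J : ℕ → ℤ
    J k = Λ (esym k w ⊗ Φ)

    F B : ℕ → ℕ
    F i = suc i ℕ.* (suc α ℕ.+ i ℕ.* c)
    B i = 2 ℕ.+ α ℕ.+ β ℕ.+ (pred n ℕ.+ i) ℕ.* c

  -- Putting j = n - 1 - k turns the signed coefficients of `aomoto` into natural numbers: n - k = j
  -- + 1 and 2n - k - 2 = (n - 1) + j. The factor k + d + K is the value of t on a form of degree k
  -- + d.
  ratio : ∀ k j → n ≡ suc (k ℕ.+ j) →
    J k * + (F j ℕ.* (k ℕ.+ d ℕ.+ K)) ≡ J (suc k) * + (B j ℕ.* suc k)
  ratio k j refl = begin
    J k * + (F j ℕ.* (k ℕ.+ d ℕ.+ K))
      ≡⟨ cong (J k *_) (trans (ℤₚ.pos-* (F j) _) (cong (_* + (k ℕ.+ d ℕ.+ K))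
           (trans (ℤₚ.pos-* (suc j) _) (cong (λ x → + suc j * (+ suc α + x)) (ℤₚ.pos-* j c))))) ⟩
    J k * (+ suc j * (+ suc α + + j * + c) * + (k ℕ.+ d ℕ.+ K))
      ≡⟨ left (J k) (+ j) (+ k) (+ α) (+ c) (+ (k ℕ.+ d ℕ.+ K)) ⟩
    (+ n + - + k) * (1ℤ + + α + (+ n + - + k + -1ℤ) * + c) * (+ (k ℕ.+ d ℕ.+ K) * J k)
      ≡⟨ cong ((+ n + - + k) * (1ℤ + + α + (+ n + - + k + -1ℤ) * + c) *_)
           (Λ-total (homogeneous-⊗ (homogeneous-esym k hw) hΦ)) ⟨
    (+ n + - + k) * (1ℤ + + α + (+ n + - + k + -1ℤ) * + c) * Λ (total K ⊗ (esym k w ⊗ Φ))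
      ≡⟨ Aomoto.aomoto S k ⟩
    (1ℤ + + k) * (+ 2 + + α + + β + (+ 2 * + n + - + k + - + 2) * + c) * J (suc k)
      ≡⟨ right (J (suc k)) (+ j) (+ k) (+ α) (+ β) (+ c) ⟩
    J (suc k) * ((+ 2 + + α + + β + (+ k + + j + + j) * + c) * + suc k)
      ≡⟨ cong (J (suc k) *_) (trans (ℤₚ.pos-* (B j) (suc k)) (cong (λ x → (+ (2 ℕ.+ α ℕ.+ β) + x) * + suc k)
           (ℤₚ.pos-* (k ℕ.+ j ℕ.+ j) c))) ⟨
    J (suc k) * + (B j ℕ.* suc k) ∎
    where
    open ≡-Reasoning
    left : ∀ x j k α c e → x * ((1ℤ + j) * ((1ℤ + α) + j * c) * e)
         ≡ ((1ℤ + (k + j)) + - k) * (1ℤ + α + ((1ℤ + (k + j)) + - k + -1ℤ) * c) * (e * x)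
    left = solve-∀
    right : ∀ x j k α β c → (1ℤ + k) * (+ 2 + α + β + (+ 2 * (1ℤ + (k + j)) + - k + - + 2) * c) * x
          ≡ x * ((+ 2 + α + β + (k + j + j) * c) * (1ℤ + k))
    right = solve-∀

  partial : ∀ j k → n ≡ k ℕ.+ j →
    J k * + (∏ j F ℕ.* rising (k ℕ.+ d ℕ.+ K) j) ≡ J n * + (∏ j B ℕ.* rising (suc k) j)
  partial zero    k e = cong (λ k → J k * 1ℤ) (sym (trans e (ℕₚ.+-identityʳ k)))
  partial (suc j) k e = begin
    J k * + (∏ j F ℕ.* F j ℕ.* (x ℕ.* rising (suc x) j))
      ≡⟨ cong (J k *_) (trans (cong +_ (swap (∏ j F) (F j) x (rising (suc x) j))) (ℤₚ.pos-* (F j ℕ.* x) _)) ⟩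
    J k * (+ (F j ℕ.* x) * + (∏ j F ℕ.* rising (suc x) j))
      ≡⟨ trans (sym (ℤₚ.*-assoc (J k) (+ (F j ℕ.* x)) _)) (cong (_* + (∏ j F ℕ.* rising (suc x) j)) (ratio k j e′)) ⟩
    J (suc k) * + (B j ℕ.* suc k) * + (∏ j F ℕ.* rising (suc x) j)
      ≡⟨ assoc (J (suc k)) (+ (B j ℕ.* suc k)) _ ⟩
    + (B j ℕ.* suc k) * (J (suc k) * + (∏ j F ℕ.* rising (suc x) j))
      ≡⟨ cong (+ (B j ℕ.* suc k) *_) (partial j (suc k) e′) ⟩
    + (B j ℕ.* suc k) * (J n * + (∏ j B ℕ.* rising (2 ℕ.+ k) j))
      ≡⟨ trans (assoc′ (J n) (+ (B j ℕ.* suc k)) _) (cong (J n *_) (trans (sym (ℤₚ.pos-* (B j ℕ.* suc k) _))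
           (cong +_ (sym (swap (∏ j B) (B j) (suc k) (rising (2 ℕ.+ k) j)))))) ⟩
    J n * + (∏ j B ℕ.* B j ℕ.* (suc k ℕ.* rising (2 ℕ.+ k) j)) ∎
    where
    open ≡-Reasoning
    x = k ℕ.+ d ℕ.+ K
    e′ : n ≡ suc (k ℕ.+ j)
    e′ = trans e (ℕₚ.+-suc k j)
    swap : ∀ a b c d → a ℕ.* b ℕ.* (c ℕ.* d) ≡ b ℕ.* c ℕ.* (a ℕ.* d)
    swap = ℕ-solve-∀
    assoc : ∀ a b c → a * b * c ≡ b * (a * c)
    assoc = solve-∀
    assoc′ : ∀ a b c → b * (a * c) ≡ a * (b * c)
    assoc′ = solve-∀

  -- From k = 0 to k = n the factors n - k on one side and k + 1 on the other both multiply to n!,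
  -- which cancels.
  chain : Λ Φ * + (∏ n (λ i → suc α ℕ.+ i ℕ.* c) ℕ.* rising (d ℕ.+ K) n) ≡ Λ (esym n w ⊗ Φ) * + ∏ n B
  chain = ℤₚ.*-cancelʳ-≡ _ _ (+ (n !)) (begin
    Λ Φ * + (X ℕ.* R) * + (n !)
      ≡⟨ trans (ℤₚ.*-assoc (Λ Φ) _ _) (cong₂ _*_ (sym J₀) (trans (sym (ℤₚ.pos-* (X ℕ.* R) (n !)))
           (cong +_ (trans (swap X R (n !)) (cong (ℕ._* R) (sym (trans (∏-* n suc _) (cong (ℕ._* X) (∏-! n))))))))) ⟩
    J 0 * + (∏ n F ℕ.* R)
      ≡⟨ partial n 0 refl ⟩
    J n * + (∏ n B ℕ.* rising 1 n)
      ≡⟨ trans (cong (J n *_) (trans (cong (λ r → + (∏ n B ℕ.* r)) (trans (sym (ℕₚ.+-identityʳ _)) (rising-! 0 n))) (ℤₚ.pos-* (∏ n B) (n !))))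
           (sym (ℤₚ.*-assoc (J n) _ _)) ⟩
    J n * + ∏ n B * + (n !) ∎)
    where
    open ≡-Reasoning
    instance
      n!≢0 : ℕ.NonZero (n !)
      n!≢0 = n ℕₚ.!≢0
    X = ∏ n (λ i → suc α ℕ.+ i ℕ.* c)
    R = rising (d ℕ.+ K) n
    J₀ : J 0 ≡ Λ Φ
    J₀ = Λ-cong (⊗-identityˡ Φ)
    swap : ∀ a b c → a ℕ.* b ℕ.* c ≡ c ℕ.* a ℕ.* b
    swap = ℕ-solve-∀

esym-overflow : ∀ {K n k} (w : Fin n → Poly K) → n < k → esym k w ≈ con 0ℤ
esym-overflow {n = zero}  w (s≤s _)   = ≈-refl
esym-overflow {n = suc n} w (s≤s n<k) = ≈-trans
  (⊕-cong (⊗-cong ≈-refl (esym-overflow (w ∘ suc) n<k)) (esym-overflow (w ∘ suc) (ℕₚ.m≤n⇒m≤1+n n<k)))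
  (solve 1 (λ x → x :* :con 0ℤ :+ :con 0ℤ := :con 0ℤ) ≈-refl _)

esym-powers : ∀ {K n} e (w : Fin n → Poly K) → esym n w ⊗ powers e w ≈ powers (suc e) w
esym-powers {n = zero}  e w = ⊗-identityˡ _
esym-powers {n = suc n} e w = ≈-trans
  (⊗-cong (⊕-cong ≈-refl (esym-overflow (w ∘ suc) (ℕₚ.n<1+n n))) ≈-refl)
  (≈-trans (solve 4 (λ a x p q → (a :* x :+ :con 0ℤ) :* (p :* q) := a :* p :* (x :* q)) ≈-refl
             (w zero) (esym n (w ∘ suc)) (pow (w zero) e) (powers e (w ∘ suc)))
           (⊗-cong ≈-refl (esym-powers e (w ∘ suc))))

module _ {K : ℕ} (e : ℕ) where

  pow-cong : ∀ e {p q : Poly K} → p ≈ q → pow p e ≈ pow q e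
  pow-cong zero    h = ≈-refl
  pow-cong (suc e) h = ⊗-cong h (pow-cong e h)

  powers-cong : ∀ {n} {ℓ ℓ′ : Fin n → Poly K} → (∀ i → ℓ i ≈ ℓ′ i) → powers e ℓ ≈ powers e ℓ′
  powers-cong {zero}  h = ≈-refl
  powers-cong {suc n} h = ⊗-cong (pow-cong e (h zero)) (powers-cong (h ∘ suc))

  differences-cong : ∀ {n} {w w′ : Fin n → Poly K} → (∀ i → w i ≈ w′ i) → differences e w ≈ differences e w′
  differences-cong {zero}  h = ≈-refl
  differences-cong {suc n} h = ⊗-cong (powers-cong (λ i → ⊖-cong (h zero) (h (suc i)))) (differences-cong (h ∘ suc))

  lift-pow : ∀ (p : Poly K) e → pow (lift p) e ≡ lift (pow p e)
  lift-pow p zero    = refl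
  lift-pow p (suc e) = cong (lift p ⊗_) (lift-pow p e)

  lift-powers : ∀ {n} (ℓ : Fin n → Poly K) → powers e (lift ∘ ℓ) ≡ lift (powers e ℓ)
  lift-powers {zero}  ℓ = refl
  lift-powers {suc n} ℓ = cong₂ _⊗_ (lift-pow (ℓ zero) e) (lift-powers (ℓ ∘ suc))

  lift-differences : ∀ {n} (w : Fin n → Poly K) → differences e (lift ∘ w) ≡ lift (differences e w)
  lift-differences {zero}  w = refl
  lift-differences {suc n} w = cong₂ _⊗_ (lift-powers (λ h → w zero ⊖ w (suc h))) (lift-differences (w ∘ suc))

powers-0 : ∀ {K n} (ℓ : Fin n → Poly K) → powers 0 ℓ ≈ con 1ℤ
powers-0 {n = zero}  ℓ = ≈-refl
powers-0 {n = suc n} ℓ = ≈-trans (⊗-identityˡ _) (powers-0 (ℓ ∘ suc))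

triangle-* : ∀ n → triangle n ℕ.* 2 ℕ.+ n ≡ n ℕ.* n
triangle-* zero    = refl
triangle-* (suc n) = trans (lemma₁ n (triangle n)) (trans (cong (λ s → suc (n ℕ.+ n ℕ.+ s)) (triangle-* n)) (lemma₂ n))
  where
  lemma₁ : ∀ n t → (n ℕ.+ t) ℕ.* 2 ℕ.+ suc n ≡ suc (n ℕ.+ n ℕ.+ (t ℕ.* 2 ℕ.+ n))
  lemma₁ = ℕ-solve-∀
  lemma₂ : ∀ n → suc (n ℕ.+ n ℕ.+ n ℕ.* n) ≡ suc n ℕ.* suc n
  lemma₂ = ℕ-solve-∀

-- From here on `c`, `α`, `β` stand for c - 1, a - 1, b - 1 of the theorem, and `size` is the number
-- of vertices of the graph.
module ClosedForm (c : ℕ) where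

  I : ℕ → ℕ → ℕ → ℤ
  I n α β = Λ (selberg n α β (suc c))

  size : ℕ → ℕ → ℕ → ℕ
  size n α β = degree-selberg n α β (suc c) ℕ.+ n

  -- Shaped so that the factors in the theorem reduce to these by computation once a, b and c are
  -- successors; hence the asymmetric `α ℕ.+ suc β`.
  num den : ℕ → ℕ → ℕ → ℕ → ℕ
  num n α β j = ((α ℕ.+ suc c ℕ.* j) !) ℕ.* ((β ℕ.+ suc c ℕ.* j) !) ℕ.* ((c ℕ.+ suc c ℕ.* j) !)
  den n α β j = (c !) ℕ.* ((α ℕ.+ suc β ℕ.+ (j ℕ.+ n ℕ.∸ 1) ℕ.* suc c) !)

  B : ℕ → ℕ → ℕ → ℕ → ℕ
  B n α β i = 2 ℕ.+ α ℕ.+ β ℕ.+ (pred n ℕ.+ i) ℕ.* suc c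

  A : ℕ → ℕ → ℕ
  A α i = suc α ℕ.+ i ℕ.* suc c

  Claim : ℕ → ℕ → ℕ → Set
  Claim n α β = I n α β * + ∏ n (den n α β) ≡ + ((size n α β !) ℕ.* ∏ n (num n α β))

  I-α : ∀ n α β → I n α β * + (∏ n (A α) ℕ.* rising (suc (size n α β)) n) ≡ I n (suc α) β * + ∏ n (B n α β)
  I-α n α β = trans (cong (λ x → I n α β * + (∏ n (A α) ℕ.* rising x n)) (sym (ℕₚ.+-suc _ n)))
    (trans (Chain.chain (Realisation.selbergSystem n α β c) (homogeneous-selberg n α β (suc c)) (homogeneous-pos n))
      (cong (_* + ∏ n (B n α β)) (Λ-cong (≈-trans
        (solve 4 (λ x a b p → x :* (a :* b :* p) := x :* a :* b :* p) ≈-refl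
          (esym n (pos n)) (powers α (pos n)) (powers β (λ i → total (suc n) ⊖ pos n i)) (differences (2 ℕ.* suc c) (pos n)))
        (⊗-cong (⊗-cong (esym-powers α (pos n)) ≈-refl) ≈-refl)))))

  I-β : ∀ n α β → I n α β * + (∏ n (A β) ℕ.* rising (suc (size n α β)) n) ≡ I n α (suc β) * + ∏ n (B n β α)
  I-β n α β = trans (cong (λ x → I n α β * + (∏ n (A β) ℕ.* rising x n)) (sym (ℕₚ.+-suc _ n)))
    (trans (Chain.chain (reflect (Realisation.selbergSystem n α β c)) (homogeneous-selberg n α β (suc c))
             (λ i → homogeneous-⊖ (homogeneous-ζ (suc n) (suc n)) (homogeneous-pos n i)))
      (cong (_* + ∏ n (B n β α)) (Λ-cong (≈-trans
        (solve 4 (λ x a b p → x :* (a :* b :* p) := a :* (x :* b) :* p) ≈-refl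
          (esym n w) (powers α (pos n)) (powers β w) (differences (2 ℕ.* suc c) (pos n)))
        (⊗-cong (⊗-cong ≈-refl (esym-powers β w)) ≈-refl)))))
    where
    w : Fin n → Poly (suc n)
    w i = total (suc n) ⊖ pos n i

  -- For α = β = 0 the top gap does not occur in the polynomial and integrates to 1. The position of
  -- the top chain vertex becomes the new total t, and its differences from the other positions
  -- become the factors (t - zᵢ)^(2c).
  I-0 : ∀ m → I (suc m) 0 0 ≡ I m 0 (2 ℕ.* suc c)
  I-0 m = trans (Λ-cong (begin
    powers 0 (pos (suc m)) ⊗ powers 0 (λ i → total (2 ℕ.+ m) ⊖ pos (suc m) i) ⊗ differences e (pos (suc m))
      ≈⟨ ⊗-cong (⊗-cong (powers-0 (pos (suc m))) (powers-0 (λ i → total (2 ℕ.+ m) ⊖ pos (suc m) i))) (differences-cong e below-top) ⟩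
    con 1ℤ ⊗ con 1ℤ ⊗ differences e (lift ∘ w)
      ≈⟨ solve 1 (λ x → :con 1ℤ :* :con 1ℤ :* x := x) ≈-refl _ ⟩
    differences e (lift ∘ w)
      ≈⟨ ≡⇒≈ (lift-differences e w) ⟩
    lift (differences e w)
      ≈⟨ lift-cong (≈-trans (solve 2 (λ x y → x :* y := :con 1ℤ :* x :* y) ≈-refl _ _)
           (⊗-cong (⊗-cong (≈-sym (powers-0 (pos m))) ≈-refl) ≈-refl)) ⟩
    lift (selberg m 0 e (suc c)) ∎)) (Λ-lift (selberg m 0 e (suc c)))
    where
    open PolyReasoning
    e = 2 ℕ.* suc c
    w : Fin (suc m) → Poly (suc m)
    w i = ζ (suc m) (suc (gap i))
    below-top : ∀ i → pos (suc m) i ≈ lift (w i)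
    below-top i = ≈-trans (⊕-cong ≈-refl (⊗-cong (con-cong (θ-≤ (gap< i))) ≈-refl))
      (solve 2 (λ x y → x :+ :con 0ℤ :* y := x) ≈-refl _ (var zero))

  -- No division takes place: the new denominator contains b, and I′ b may be replaced by I a r, to
  -- which the old claim applies.
  transfer : ∀ (I I′ : ℤ) (d N s a b r : ℕ) {d′ N′ s′ : ℕ} → I * + (a ℕ.* r) ≡ I′ * + b →
    d′ ≡ d ℕ.* b → N′ ≡ N ℕ.* r → s′ ≡ s ℕ.* a → I * + d ≡ + (N ℕ.* s) → I′ * + d′ ≡ + (N′ ℕ.* s′)
  transfer I I′ d N s a b r step refl refl refl claim = begin
    I′ * + (d ℕ.* b)             ≡⟨ cong (I′ *_) (ℤₚ.pos-* d b) ⟩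
    I′ * (+ d * + b)             ≡⟨ swap I′ (+ d) (+ b) ⟩
    (I′ * + b) * + d             ≡⟨ cong (_* + d) (sym step) ⟩
    I * + (a ℕ.* r) * + d        ≡⟨ swap′ I (+ (a ℕ.* r)) (+ d) ⟩
    (I * + d) * + (a ℕ.* r)      ≡⟨ cong (_* + (a ℕ.* r)) claim ⟩
    + (N ℕ.* s) * + (a ℕ.* r)    ≡⟨ sym (ℤₚ.pos-* (N ℕ.* s) (a ℕ.* r)) ⟩
    + (N ℕ.* s ℕ.* (a ℕ.* r))    ≡⟨ cong +_ (swap″ N s a r) ⟩
    + (N ℕ.* r ℕ.* (s ℕ.* a))    ∎
    where
    open ≡-Reasoning
    swap : ∀ x y z → x * (y * z) ≡ (x * z) * y
    swap = solve-∀
    swap′ : ∀ x y z → x * y * z ≡ (x * z) * y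
    swap′ = solve-∀
    swap″ : ∀ N s a r → N ℕ.* s ℕ.* (a ℕ.* r) ≡ N ℕ.* r ℕ.* (s ℕ.* a)
    swap″ = ℕ-solve-∀

  den-suc : ∀ n α β → ∏ n (λ j → (c !) ℕ.* ((suc (α ℕ.+ suc β) ℕ.+ (j ℕ.+ n ℕ.∸ 1) ℕ.* suc c) !)) ≡ ∏ n (den n α β) ℕ.* ∏ n (B n α β)
  den-suc n α β = trans (∏-cong n (λ j j<n → factor n j j<n)) (∏-* n (den n α β) (B n α β))
    where
    lemma : ∀ a b f → a ℕ.* (b ℕ.* f) ≡ a ℕ.* f ℕ.* b
    lemma = ℕ-solve-∀
    factor : ∀ n j → j < n → (c !) ℕ.* ((suc (α ℕ.+ suc β) ℕ.+ (j ℕ.+ n ℕ.∸ 1) ℕ.* suc c) !) ≡ den n α β j ℕ.* B n α β j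
    factor (suc n) j j<n = trans (lemma (c !) (suc (α ℕ.+ suc β) ℕ.+ (j ℕ.+ suc n ℕ.∸ 1) ℕ.* suc c) ((α ℕ.+ suc β ℕ.+ (j ℕ.+ suc n ℕ.∸ 1) ℕ.* suc c) !)) (cong (den (suc n) α β j ℕ.*_) (cong₂ (λ x y → suc (x ℕ.+ y ℕ.* suc c))
      (ℕₚ.+-suc α β) (trans (cong (ℕ._∸ 1) (ℕₚ.+-suc j n)) (ℕₚ.+-comm j n))))

  claim-α : ∀ n α β → Claim n α β → Claim n (suc α) β
  claim-α n α β = transfer (I n α β) (I n (suc α) β) (∏ n (den n α β)) (size n α β !) (∏ n (num n α β))
    (∏ n (A α)) (∏ n (B n α β)) (rising (suc (size n α β)) n) (I-α n α β) (den-suc n α β)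
    (trans (cong _! (lemma n α (n ℕ.* β) (triangle n ℕ.* (2 ℕ.* suc c)))) (sym (rising-! (size n α β) n)))
    (trans (∏-cong n (λ j _ → trans (lemma′ (suc (α ℕ.+ suc c ℕ.* j)) ((α ℕ.+ suc c ℕ.* j) !) ((β ℕ.+ suc c ℕ.* j) !) ((c ℕ.+ suc c ℕ.* j) !)) (cong (num n α β j ℕ.*_) (cong (λ x → suc (α ℕ.+ x)) (ℕₚ.*-comm (suc c) j)))))
           (∏-* n (num n α β) (A α)))
    where
    lemma : ∀ n α b d → n ℕ.* suc α ℕ.+ b ℕ.+ d ℕ.+ n ≡ n ℕ.* α ℕ.+ b ℕ.+ d ℕ.+ n ℕ.+ n
    lemma = ℕ-solve-∀
    lemma′ : ∀ s x y z → s ℕ.* x ℕ.* y ℕ.* z ≡ x ℕ.* y ℕ.* z ℕ.* s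
    lemma′ = ℕ-solve-∀

  claim-β : ∀ n α β → Claim n α β → Claim n α (suc β)
  claim-β n α β = transfer (I n α β) (I n α (suc β)) (∏ n (den n α β)) (size n α β !) (∏ n (num n α β))
    (∏ n (A β)) (∏ n (B n β α)) (rising (suc (size n α β)) n) (I-β n α β)
    (trans (∏-cong n (λ j _ → cong (λ x → (c !) ℕ.* ((x ℕ.+ (j ℕ.+ n ℕ.∸ 1) ℕ.* suc c) !)) (ℕₚ.+-suc α (suc β))))
      (trans (den-suc n α β) (cong (∏ n (den n α β) ℕ.*_) (∏-cong n (λ j _ →
        cong (λ x → 2 ℕ.+ x ℕ.+ (pred n ℕ.+ j) ℕ.* suc c) (ℕₚ.+-comm α β))))))
    (trans (cong _! (lemma n β (n ℕ.* α) (triangle n ℕ.* (2 ℕ.* suc c)))) (sym (rising-! (size n α β) n)))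
    (trans (∏-cong n (λ j _ → trans (lemma′ (suc (β ℕ.+ suc c ℕ.* j)) ((α ℕ.+ suc c ℕ.* j) !) ((β ℕ.+ suc c ℕ.* j) !) ((c ℕ.+ suc c ℕ.* j) !)) (cong (num n α β j ℕ.*_) (cong (λ x → suc (β ℕ.+ x)) (ℕₚ.*-comm (suc c) j)))))
           (∏-* n (num n α β) (A β)))
    where
    lemma : ∀ n β a d → a ℕ.+ n ℕ.* suc β ℕ.+ d ℕ.+ n ≡ a ℕ.+ n ℕ.* β ℕ.+ d ℕ.+ n ℕ.+ n
    lemma = ℕ-solve-∀
    lemma′ : ∀ s x y z → x ℕ.* (s ℕ.* y) ℕ.* z ≡ x ℕ.* y ℕ.* z ℕ.* s
    lemma′ = ℕ-solve-∀

  claim-n : ∀ m → Claim m 0 (2 ℕ.* suc c) → Claim (suc m) 0 0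
  claim-n m claim = begin
    I (suc m) 0 0 * + ∏ (suc m) (den (suc m) 0 0)
      ≡⟨ cong₂ (λ t d → t * + d) (I-0 m) den-front ⟩
    I m 0 e * + (f ℕ.* ∏ m (den m 0 e))
      ≡⟨ trans (cong (I m 0 e *_) (ℤₚ.pos-* f (∏ m (den m 0 e)))) (swap (I m 0 e) (+ f) (+ ∏ m (den m 0 e))) ⟩
    I m 0 e * + ∏ m (den m 0 e) * + f
      ≡⟨ cong (_* + f) claim ⟩
    + ((M !) ℕ.* ∏ m (num m 0 e)) * + f
      ≡⟨ trans (sym (ℤₚ.pos-* ((M !) ℕ.* ∏ m (num m 0 e)) f)) (cong +_ (ℕₚ.*-assoc (M !) (∏ m (num m 0 e)) f)) ⟩
    + ((M !) ℕ.* (∏ m (num m 0 e) ℕ.* f))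
      ≡⟨ cong (λ x → + ((M !) ℕ.* x)) numerators ⟩
    + ((M !) ℕ.* (suc M ℕ.* ∏ (suc m) (num (suc m) 0 0)))
      ≡⟨ cong +_ (trans (swap′ (M !) (suc M) (∏ (suc m) (num (suc m) 0 0))) (cong (λ s → (s !) ℕ.* ∏ (suc m) (num (suc m) 0 0)) (sym size-suc))) ⟩
    + ((size (suc m) 0 0 !) ℕ.* ∏ (suc m) (num (suc m) 0 0)) ∎
    where
    open ≡-Reasoning
    e = 2 ℕ.* suc c
    M = size m 0 e
    f = (c !) ℕ.* ((suc (m ℕ.* suc c)) !)
    swap : ∀ x y z → x * (y * z) ≡ x * z * y
    swap = solve-∀
    swap′ : ∀ x y z → x ℕ.* (y ℕ.* z) ≡ y ℕ.* x ℕ.* z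
    swap′ = ℕ-solve-∀

    size-suc : size (suc m) 0 0 ≡ suc M
    size-suc = lemma m (triangle m) e
      where
      lemma : ∀ m t e → (m ℕ.* 0 ℕ.+ m ℕ.* 0 ℕ.+ (m ℕ.+ t) ℕ.* e) ℕ.+ suc m ≡ suc ((m ℕ.* 0 ℕ.+ m ℕ.* e ℕ.+ t ℕ.* e) ℕ.+ m)
      lemma = ℕ-solve-∀

    -- The graph with m + 1 chain vertices and a = b = 1 has m + 1 + m (m + 1) c vertices, for the c
    -- of the theorem. The two factors of this number are what `numerators` has to match.
    M-factors : suc M ≡ suc m ℕ.* suc (m ℕ.* suc c)
    M-factors = trans (lemma m (triangle m) (suc c)) (trans (cong (λ s → suc m ℕ.+ (m ℕ.+ s) ℕ.* suc c) (triangle-* m)) (lemma′ m (suc c)))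
      where
      lemma : ∀ m t c → suc ((m ℕ.* 0 ℕ.+ m ℕ.* (2 ℕ.* c) ℕ.+ t ℕ.* (2 ℕ.* c)) ℕ.+ m) ≡ suc m ℕ.+ (m ℕ.+ (t ℕ.* 2 ℕ.+ m)) ℕ.* c
      lemma = ℕ-solve-∀
      lemma′ : ∀ m c → suc m ℕ.+ (m ℕ.+ m ℕ.* m) ℕ.* c ≡ suc m ℕ.* suc (m ℕ.* c)
      lemma′ = ℕ-solve-∀

    den-front : ∏ (suc m) (den (suc m) 0 0) ≡ f ℕ.* ∏ m (den m 0 e)
    -- Once the factor at j = 0 is split off, the shift j ↦ j + 1 together with the decrease of n
    -- adds 2c to each remaining argument, as does β = 2c.
    den-front = trans (∏-front m (den (suc m) 0 0)) (cong (f ℕ.*_) (∏-cong m (shift m)))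
      where
      lemma : ∀ x c → suc ((2 ℕ.+ x) ℕ.* c) ≡ suc (2 ℕ.* c) ℕ.+ x ℕ.* c
      lemma = ℕ-solve-∀
      shift : ∀ m j → j < m → den (suc m) 0 0 (suc j) ≡ den m 0 e j
      shift (suc m) j _ = cong (λ x → (c !) ℕ.* (x !)) (trans
        (cong (λ x → suc (x ℕ.* suc c)) (trans (ℕₚ.+-suc j (suc m)) (cong suc (ℕₚ.+-suc j m))))
        (trans (lemma (j ℕ.+ m) (suc c)) (cong (λ x → suc e ℕ.+ x ℕ.* suc c) (sym (cong (ℕ._∸ 1) (ℕₚ.+-suc j m))))))

    h h₂ h₃ : ℕ → ℕ
    h j  = (suc c ℕ.* j) !
    h₂ j = (e ℕ.+ suc c ℕ.* j) !
    h₃ j = (c ℕ.+ suc c ℕ.* j) !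

    -- ∏_{j ≤ m+1} (cj)! read from both ends.
    telescope : ∏ (suc m) h ℕ.* h (suc m) ≡ (suc c !) ℕ.* ∏ m h₂
    telescope = trans (∏-front (suc m) h) (trans (cong₂ ℕ._*_ (cong _! (ℕₚ.*-zeroʳ c)) (∏-front m (h ∘ suc)))
      (trans (ℕₚ.+-identityʳ _) (cong₂ ℕ._*_ (cong _! (ℕₚ.*-identityʳ (suc c))) (∏-cong m (λ j _ → cong _! (lemma (suc c) j))))))
      where
      lemma : ∀ c j → c ℕ.* suc (suc j) ≡ 2 ℕ.* c ℕ.+ c ℕ.* j
      lemma = ℕ-solve-∀

    numerators : ∏ m (num m 0 e) ℕ.* f ≡ suc M ℕ.* ∏ (suc m) (num (suc m) 0 0)
    -- The extra factor completes `c !` to `suc c !`, which is `h 1`; only then does `telescope`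
    -- apply.
    numerators = ℕₚ.*-cancelˡ-≡ _ _ (suc c) (begin
      suc c ℕ.* (∏ m (num m 0 e) ℕ.* f)
        ≡⟨ cong (λ x → suc c ℕ.* (x ℕ.* f)) (trans (∏-* m _ h₃) (cong (ℕ._* H₃) (∏-* m h h₂))) ⟩
      suc c ℕ.* (H ℕ.* ∏ m h₂ ℕ.* H₃ ℕ.* ((c !) ℕ.* (suc k ℕ.* (k !))))
        ≡⟨ lemma₁ (suc c) H (∏ m h₂) H₃ (c !) (suc k) (k !) ⟩
      ((suc c !) ℕ.* ∏ m h₂) ℕ.* (H ℕ.* H₃ ℕ.* suc k ℕ.* (k !))
        ≡⟨ cong (ℕ._* (H ℕ.* H₃ ℕ.* suc k ℕ.* (k !))) (sym telescope) ⟩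
      (H ℕ.* h m ℕ.* h (suc m)) ℕ.* (H ℕ.* H₃ ℕ.* suc k ℕ.* (k !))
        ≡⟨ cong₂ (λ x y → (H ℕ.* h m ℕ.* x) ℕ.* (H ℕ.* H₃ ℕ.* suc k ℕ.* y)) h-suc (cong _! (ℕₚ.*-comm m (suc c))) ⟩
      (H ℕ.* h m ℕ.* (suc c ℕ.* suc m ℕ.* h₃ m)) ℕ.* (H ℕ.* H₃ ℕ.* suc k ℕ.* h m)
        ≡⟨ lemma₂ H H₃ (h m) (h₃ m) (suc c) (suc m) (suc k) ⟩
      suc c ℕ.* (suc m ℕ.* suc k ℕ.* ((H ℕ.* h m) ℕ.* (H ℕ.* h m) ℕ.* (H₃ ℕ.* h₃ m)))
        ≡⟨ cong (suc c ℕ.*_) (cong₂ ℕ._*_ (sym M-factors) (sym (trans (∏-* (suc m) _ h₃)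
             (cong (ℕ._* (H₃ ℕ.* h₃ m)) (∏-* (suc m) h h))))) ⟩
      suc c ℕ.* (suc M ℕ.* ∏ (suc m) (num (suc m) 0 0)) ∎)
      where
      k = m ℕ.* suc c
      H = ∏ m h
      H₃ = ∏ m h₃
      h-suc : h (suc m) ≡ suc c ℕ.* suc m ℕ.* h₃ m
      h-suc = trans (cong _! (ℕₚ.*-suc (suc c) m)) (cong (ℕ._* h₃ m) (sym (ℕₚ.*-suc (suc c) m)))
      lemma₁ : ∀ s H H₂ H₃ c k f → s ℕ.* (H ℕ.* H₂ ℕ.* H₃ ℕ.* (c ℕ.* (k ℕ.* f))) ≡ (s ℕ.* c ℕ.* H₂) ℕ.* (H ℕ.* H₃ ℕ.* k ℕ.* f)
      lemma₁ = ℕ-solve-∀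
      lemma₂ : ∀ H H₃ x y c m k → (H ℕ.* x ℕ.* (c ℕ.* m ℕ.* y)) ℕ.* (H ℕ.* H₃ ℕ.* k ℕ.* x)
             ≡ c ℕ.* (m ℕ.* k ℕ.* ((H ℕ.* x) ℕ.* (H ℕ.* x) ℕ.* (H₃ ℕ.* y)))
      lemma₂ = ℕ-solve-∀

  -- Lexicographic induction on n, α, β: β may jump up to 2c only in the step that lowers n.
  closed-form : ∀ n α β → Claim n α β
  closed-form zero    zero    zero    = refl
  closed-form (suc n) zero    zero    = claim-n n (closed-form n 0 (2 ℕ.* suc c))
  closed-form n       zero    (suc β) = claim-β n zero β (closed-form n zero β)
  closed-form n       (suc α) β       = claim-α n α β (closed-form n α β)

-- Counting topological orderings by removing the top element

open import Defs using (allVecs; topo)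

module _ {A B : Set} {f : A → List B} where

  unique-concatMap : ∀ {as} → Unique as → (∀ a → Unique (f a)) →
    (∀ {a a′ b} → b ∈ f a → b ∈ f a′ → a ≡ a′) → Unique (concatMap f as)
  unique-concatMap []         uf sep = []
  unique-concatMap {a ∷ as} (a∉ ∷ u) uf sep = Uniqueₚ.++⁺ (uf a) (unique-concatMap u uf sep) (λ (b∈ , b∈′) →
    separated a∉ (∈-concatMap⁻ f b∈′) b∈)
    where
    separated : ∀ {b as} → All (a ≢_) as → Any ((b ∈_) ∘ f) as → ¬ (b ∈ f a)
    separated (a≢ ∷ _)  (here b∈′) b∈ = a≢ (sep b∈ b∈′)
    separated (_ ∷ a∉) (there i)  b∈ = separated a∉ i b∈

unique-allVecs : ∀ k N → Unique (allVecs k N)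
unique-allVecs zero    N = [] ∷ []
unique-allVecs (suc k) N = unique-concatMap (Uniqueₚ.allFin⁺ N)
  (λ i → Uniqueₚ.map⁺ Vecₚ.∷-injectiveʳ (unique-allVecs k N))
  (λ v∈ v∈′ → let _ , _ , e = ∈-map⁻ _ v∈ ; _ , _ , e′ = ∈-map⁻ _ v∈′ in Vecₚ.∷-injectiveˡ (trans (sym e) e′))

∈-allVecs : ∀ {k N} (v : Vec (Fin N) k) → v ∈ allVecs k N
∈-allVecs []      = here refl
∈-allVecs (i ∷ v) = ∈-concatMap⁺ _ (lose (∈-allFin i) (∈-map⁺ (i ∷_) (∈-allVecs v)))

vec-ext : ∀ {A : Set} {n} {u v : Vec A n} → (∀ i → lookup u i ≡ lookup v i) → u ≡ v
vec-ext {u = u} {v} e = trans (sym (Vecₚ.tabulate∘lookup u)) (trans (Vecₚ.tabulate-cong e) (Vecₚ.tabulate∘lookup v))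

-- Stated for a relation on indices, so that deleting a vertex is restriction along `punchIn`.
IsOrdering : ∀ {N} → (Fin N → Fin N → Bool) → Vec (Fin N) N → Set
IsOrdering R ℓ =
    (∀ i j → lookup ℓ i ≡ lookup ℓ j → i ≡ j)
  × (∀ y → ∃ λ i → lookup ℓ i ≡ y)
  × (∀ i j → T (R i j) → lookup ℓ j Fin.< lookup ℓ i)

isOrdering? : ∀ {N} (R : Fin N → Fin N → Bool) ℓ → Dec (IsOrdering R ℓ)
isOrdering? R ℓ =
      Finₚ.all? (λ i → Finₚ.all? (λ j → (lookup ℓ i Fin.≟ lookup ℓ j) →-dec (i Fin.≟ j)))
  ×-dec Finₚ.all? (λ y → Finₚ.any? (λ i → lookup ℓ i Fin.≟ y))
  ×-dec Finₚ.all? (λ i → Finₚ.all? (λ j → T? (R i j) →-dec (lookup ℓ j Fin.<? lookup ℓ i)))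

orderings : ∀ {N} → (Fin N → Fin N → Bool) → List (Vec (Fin N) N)
orderings {N} R = filter (isOrdering? R) (allVecs N N)

unique-orderings : ∀ {N} (R : Fin N → Fin N → Bool) → Unique (orderings R)
unique-orderings {N} R = Uniqueₚ.filter⁺ (isOrdering? R) (unique-allVecs N N)

module _ {N : ℕ} where

  putTop : Fin (suc N) → Vec (Fin N) N → Vec (Fin (suc N)) (suc N)
  putTop i ℓ = insertAt (Vec.map inject₁ ℓ) i (fromℕ N)

  putTop-top : ∀ i ℓ → lookup (putTop i ℓ) i ≡ fromℕ N
  putTop-top i ℓ = Vecₚ.insertAt-lookup (Vec.map inject₁ ℓ) i (fromℕ N)

  putTop-punchIn : ∀ i ℓ j → lookup (putTop i ℓ) (punchIn i j) ≡ inject₁ (lookup ℓ j)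
  putTop-punchIn i ℓ j = trans (Vecₚ.insertAt-punchIn (Vec.map inject₁ ℓ) i (fromℕ N) j) (Vecₚ.lookup-map j inject₁ ℓ)

  data Position (i : Fin (suc N)) : Fin (suc N) → Set where
    at    : Position i i
    other : ∀ j → Position i (punchIn i j)

  position : ∀ i k → Position i k
  position i k with i Fin.≟ k
  ... | yes refl = at
  ... | no i≢k   = subst (Position i) (Finₚ.punchIn-punchOut i≢k) (other (punchOut i≢k))

  top-unique : ∀ i ℓ {k} → lookup (putTop i ℓ) k ≡ fromℕ N → i ≡ k
  top-unique i ℓ {k} e with position i k
  ... | at      = refl
  ... | other j = ⊥-elim (Finₚ.fromℕ≢inject₁ (trans (sym e) (putTop-punchIn i ℓ j)))

  putTop-injective : ∀ i {ℓ ℓ′} → putTop i ℓ ≡ putTop i ℓ′ → ℓ ≡ ℓ′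
  putTop-injective i {ℓ} {ℓ′} e = vec-ext λ j → Finₚ.inject₁-injective
    (trans (sym (putTop-punchIn i ℓ j)) (trans (cong (λ v → lookup v (punchIn i j)) e) (putTop-punchIn i ℓ′ j)))

  module _ (R : Fin (suc N) → Fin (suc N) → Bool) (i : Fin (suc N)) where

    delete : Fin N → Fin N → Bool
    delete j k = R (punchIn i j) (punchIn i k)

    IsSource : Set
    IsSource = ∀ j → ¬ T (R j i)

    putTop-ordering : IsSource → ∀ {ℓ} → IsOrdering delete ℓ → IsOrdering R (putTop i ℓ)
    putTop-ordering source {ℓ} (inj , surj , ord) = inj′ , surj′ , ord′
      where
      inj′ : ∀ j k → lookup (putTop i ℓ) j ≡ lookup (putTop i ℓ) k → j ≡ k
      inj′ j k e with position i j | position i k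
      ... | at       | _        = top-unique i ℓ (trans (sym e) (putTop-top i ℓ))
      ... | other j′ | at       = sym (top-unique i ℓ (trans e (putTop-top i ℓ)))
      ... | other j′ | other k′ = cong (punchIn i) (inj j′ k′ (Finₚ.inject₁-injective
        (trans (sym (putTop-punchIn i ℓ j′)) (trans e (putTop-punchIn i ℓ k′)))))
      surj′ : ∀ y → ∃ λ j → lookup (putTop i ℓ) j ≡ y
      surj′ y with N ℕ.≟ toℕ y
      ... | yes e = i , trans (putTop-top i ℓ) (Finₚ.toℕ-injective (trans (Finₚ.toℕ-fromℕ N) e))
      ... | no ¬e = let j , e = surj (lower₁ y ¬e) in
        punchIn i j , trans (putTop-punchIn i ℓ j) (trans (cong inject₁ e) (Finₚ.inject₁-lower₁ y ¬e))
      ord′ : ∀ j k → T (R j k) → lookup (putTop i ℓ) k Fin.< lookup (putTop i ℓ) j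
      ord′ j k Rjk with position i k
      ... | at = ⊥-elim (source j Rjk)
      ... | other k′ with position i j
      ...   | at = subst₂ Fin._<_ (sym (putTop-punchIn i ℓ k′)) (sym (putTop-top i ℓ))
                (subst (toℕ (inject₁ (lookup ℓ k′)) ℕ.<_) (sym (Finₚ.toℕ-fromℕ N)) (Finₚ.inject₁ℕ< (lookup ℓ k′)))
      ...   | other j′ = subst₂ Fin._<_ (sym (putTop-punchIn i ℓ k′)) (sym (putTop-punchIn i ℓ j′))
                (subst₂ ℕ._<_ (sym (Finₚ.toℕ-inject₁ (lookup ℓ k′))) (sym (Finₚ.toℕ-inject₁ (lookup ℓ j′))) (ord j′ k′ Rjk))

  -- The vertex with the largest label is a source, as an edge into it would need a still larger
  -- label. All other labels fit into `Fin N`.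
  removeTop : ∀ (R : Fin (suc N) → Fin (suc N) → Bool) {v} → IsOrdering R v →
    ∃ λ i → IsSource R i × ∃ λ ℓ → IsOrdering (delete R i) ℓ × v ≡ putTop i ℓ
  removeTop R {v} (inj , surj , ord) = i , source , ℓ , (inj′ , surj′ , ord′) , vec-ext agree
    where
    i = proj₁ (surj (fromℕ N))
    top : lookup v i ≡ fromℕ N
    top = proj₂ (surj (fromℕ N))
    source : IsSource R i
    source j Rji = ℕₚ.<⇒≱ (ord j i Rji) (subst (lookup v j Fin.≤_) (sym top) (Finₚ.≤fromℕ (lookup v j)))
    low : ∀ j → N ≢ toℕ (lookup v (punchIn i j))
    low j e = Finₚ.punchInᵢ≢i i j (inj _ _ (trans (Finₚ.toℕ-injective (trans (sym e) (sym (Finₚ.toℕ-fromℕ N)))) (sym top)))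
    ℓ : Vec (Fin N) N
    ℓ = tabulate (λ j → lower₁ (lookup v (punchIn i j)) (low j))
    look : ∀ j → inject₁ (lookup ℓ j) ≡ lookup v (punchIn i j)
    look j = trans (cong inject₁ (Vecₚ.lookup∘tabulate _ j)) (Finₚ.inject₁-lower₁ _ (low j))
    agree : ∀ k → lookup v k ≡ lookup (putTop i ℓ) k
    agree k with position i k
    ... | at      = trans top (sym (putTop-top i ℓ))
    ... | other j = trans (sym (look j)) (sym (putTop-punchIn i ℓ j))
    inj′ : ∀ j k → lookup ℓ j ≡ lookup ℓ k → j ≡ k
    inj′ j k e = Finₚ.punchIn-injective i j k (inj _ _ (trans (sym (look j)) (trans (cong inject₁ e) (look k))))
    surj′ : ∀ y → ∃ λ j → lookup ℓ j ≡ y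
    surj′ y with surj (inject₁ y)
    ... | k , e with position i k
    ...   | at      = ⊥-elim (Finₚ.fromℕ≢inject₁ (trans (sym top) e))
    ...   | other j = j , Finₚ.inject₁-injective (trans (look j) e)
    ord′ : ∀ j k → T (delete R i j k) → lookup ℓ k Fin.< lookup ℓ j
    ord′ j k Rjk = subst₂ ℕ._<_ (toℕ-look k) (toℕ-look j) (ord _ _ Rjk)
      where
      toℕ-look : ∀ j → toℕ (lookup v (punchIn i j)) ≡ toℕ (lookup ℓ j)
      toℕ-look j = trans (cong toℕ (sym (look j))) (Finₚ.toℕ-inject₁ (lookup ℓ j))

  -- Orderings are sorted by the vertex carrying the largest label. Both lists are free of
  -- repetitions and have the same members, hence are permutations of each other.
  orderings-rec : ∀ (R : Fin (suc N) → Fin (suc N) → Bool) (s : Fin (suc N) → Bool) →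
    (∀ i → T (s i) → IsSource R i) → (∀ i → IsSource R i → T (s i)) →
    length (orderings R) ≡ sumℕ (List.tabulate (λ i → if s i then length (orderings (delete R i)) else 0))
  orderings-rec R s sound complete = trans (↭-length (∼bag⇒↭ (unique∧set⇒bag (unique-orderings R) unique
      (mk⇔ to from)))) (length-concatMap id)
    where
    block : Fin (suc N) → List (Vec (Fin (suc N)) (suc N))
    block i = if s i then List.map (putTop i) (orderings (delete R i)) else []

    ∈-block : ∀ {i v} → v ∈ block i → T (s i) × ∃ λ ℓ → ℓ ∈ orderings (delete R i) × v ≡ putTop i ℓ
    ∈-block {i} v∈ with s i
    ... | true = tt , ∈-map⁻ (putTop i) v∈

    unique-block : ∀ i → Unique (block i)
    unique-block i with s i
    ... | true  = Uniqueₚ.map⁺ (putTop-injective i) (unique-orderings (delete R i))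
    ... | false = []

    unique : Unique (concatMap block (allFin (suc N)))
    unique = unique-concatMap (Uniqueₚ.allFin⁺ (suc N)) unique-block λ {i} {i′} v∈ v∈′ →
      let _ , ℓ , _ , e = ∈-block {i} v∈ ; _ , ℓ′ , _ , e′ = ∈-block {i′} v∈′
      in top-unique i ℓ (trans (cong (λ v → lookup v i′) (trans (sym e) e′)) (putTop-top i′ ℓ′))

    in-block : ∀ i {ℓ} → T (s i) → IsOrdering (delete R i) ℓ → putTop i ℓ ∈ block i
    in-block i {ℓ} si ordered with s i
    ... | true = ∈-map⁺ (putTop i) (∈-filter⁺ (isOrdering? (delete R i)) (∈-allVecs ℓ) ordered)

    place : ∀ {v} → (∃ λ i → IsSource R i × ∃ λ ℓ → IsOrdering (delete R i) ℓ × v ≡ putTop i ℓ) →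
      v ∈ concatMap block (allFin (suc N))
    place (i , source , ℓ , ordered , refl) =
      ∈-concatMap⁺ block (lose (∈-allFin i) (in-block i (complete i source) ordered))

    to : ∀ {v} → v ∈ orderings R → v ∈ concatMap block (allFin (suc N))
    to v∈ = place (removeTop R (proj₂ (∈-filter⁻ (isOrdering? R) {xs = allVecs (suc N) (suc N)} v∈)))

    from : ∀ {v} → v ∈ concatMap block (allFin (suc N)) → v ∈ orderings R
    from v∈ with Any.satisfied (∈-concatMap⁻ block {xs = allFin (suc N)} v∈)
    ... | i , v∈i with ∈-block {i} v∈i
    ...   | si , ℓ , ℓ∈ , refl = ∈-filter⁺ (isOrdering? R) (∈-allVecs _)
              (putTop-ordering R i (sound i si) (proj₂ (∈-filter⁻ (isOrdering? (delete R i)) {xs = allVecs N N} ℓ∈)))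

    length-block : ∀ i → length (block i) ≡ (if s i then length (orderings (delete R i)) else 0)
    length-block i with s i
    ... | true  = Listₚ.length-map (putTop i) (orderings (delete R i))
    ... | false = refl

    length-concatMap : ∀ {m} (f : Fin m → Fin (suc N)) → length (concatMap block (List.tabulate f))
      ≡ sumℕ (List.tabulate (λ k → if s (f k) then length (orderings (delete R (f k))) else 0))
    length-concatMap {zero}  f = refl
    length-concatMap {suc m} f = trans (Listₚ.length-++ (block (f zero)))
      (cong₂ ℕ._+_ (length-block (f zero)) (length-concatMap (f ∘ suc)))

length-orderings-cong : ∀ {N} {R S : Fin N → Fin N → Bool} → (∀ i j → R i j ≡ S i j) → length (orderings R) ≡ length (orderings S)
length-orderings-cong {N} {R} {S} e = cong length (Listₚ.filter-≐ (isOrdering? R) (isOrdering? S)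
  ( (λ (inj , surj , ord) → inj , surj , λ i j → ord i j ∘ subst T (sym (e i j)))
  , (λ (inj , surj , ord) → inj , surj , λ i j → ord i j ∘ subst T (e i j))) (allVecs N N))

-- Sums over the choice of the top element

module _ {V : Set} where

  -- The sum of F u us over all ways of singling out one entry u of the list, us being the others.
  selectionSum : List V → (V → List V → ℤ) → ℤ
  selectionSum []       F = 0ℤ
  selectionSum (v ∷ vs) F = F v vs + selectionSum vs (λ u us → F u (v ∷ us))

  -- The equation between lengths keeps the fuel of `orderingCount` correct when an induction passes
  -- through a selection.
  selectionSum-cong : ∀ {P : V → Set} {vs F G} → All P vs →
    (∀ {u us} → P u → All P us → suc (length us) ≡ length vs → F u us ≡ G u us) → selectionSum vs F ≡ selectionSum vs G
  selectionSum-cong []       e = refl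
  selectionSum-cong (p ∷ ps) e = cong₂ _+_ (e p ps refl) (selectionSum-cong ps (λ q qs l → e q (p ∷ qs) (cong suc l)))

  selectionSum-0 : ∀ vs → selectionSum vs (λ _ _ → 0ℤ) ≡ 0ℤ
  selectionSum-0 []       = refl
  selectionSum-0 (v ∷ vs) = trans (ℤₚ.+-identityˡ _) (selectionSum-0 vs)

  selectionSum-++ : ∀ us vs F → selectionSum (us ++ vs) F ≡
    selectionSum us (λ w ws → F w (ws ++ vs)) + selectionSum vs (λ w ws → F w (us ++ ws))
  selectionSum-++ []       vs F = sym (ℤₚ.+-identityˡ _)
  selectionSum-++ (u ∷ us) vs F = trans (cong (λ s → F u (us ++ vs) + s) (selectionSum-++ us vs _)) (sym (ℤₚ.+-assoc (F u (us ++ vs)) _ _))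

  sum-selections : ∀ {n} (v : Vec V (suc n)) (F : V → List V → ℤ) (f : Fin (suc n) → ℕ) →
    (∀ i → + f i ≡ F (lookup v i) (toList (removeAt v i))) → + sumℕ (List.tabulate f) ≡ selectionSum (toList v) F
  sum-selections (u ∷ [])     F f e = cong (_+ 0ℤ) (e zero)
  sum-selections (u ∷ w ∷ v) F f e = cong₂ _+_ (e zero) (sum-selections (w ∷ v) (λ t ts → F t (u ∷ ts)) (f ∘ suc) (e ∘ suc))

  module _ (E : V → V → Bool) where

    isSource : List V → V → Bool
    isSource vs v = all (λ u → not (E u v)) vs

    isSource-true : ∀ {vs v} → All (λ u → E u v ≡ false) vs → isSource vs v ≡ true
    isSource-true []               = refl
    isSource-true (e ∷ es) rewrite e = isSource-true es

    isSource-false : ∀ {vs v} → Any (λ u → E u v ≡ true) vs → isSource vs v ≡ false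
    isSource-false (here e) rewrite e = refl
    isSource-false {u ∷ _} {v} (there es) with E u v
    ... | true  = refl
    ... | false = isSource-false es

    isSource-sound : ∀ {n} (us : Vec V n) v → T (isSource (toList us) v) → ∀ j → ¬ T (E (lookup us j) v)
    isSource-sound (u ∷ us) v s j e with E u v in eq
    isSource-sound (u ∷ us) v s zero    e | false = subst T eq e
    isSource-sound (u ∷ us) v s (suc j) e | false = isSource-sound us v s j e

    isSource-complete : ∀ {n} (us : Vec V n) v → (∀ j → ¬ T (E (lookup us j) v)) → T (isSource (toList us) v)
    isSource-complete []       v h = tt
    isSource-complete (u ∷ us) v h with E u v in eq
    ... | true  = h zero (subst T (sym eq) tt)
    ... | false = isSource-complete us v (h ∘ suc)

    -- The first argument is fuel, meant to be the length of the list.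
    orderingCount : ℕ → List V → ℤ
    orderingCount zero    vs = 1ℤ
    orderingCount (suc N) vs = selectionSum vs (λ u us → if isSource vs u then orderingCount N us else 0ℤ)

    lookup-removeAt : ∀ {n} (v : Vec V (suc n)) i j → lookup (removeAt v i) j ≡ lookup v (punchIn i j)
    lookup-removeAt (u ∷ v)     zero    j       = refl
    lookup-removeAt (u ∷ w ∷ v) (suc i) zero    = refl
    lookup-removeAt (u ∷ w ∷ v) (suc i) (suc j) = lookup-removeAt (w ∷ v) i j

    length-orderings : ∀ {N} (v : Vec V N) → + length (orderings (λ i j → E (lookup v i) (lookup v j))) ≡ orderingCount N (toList v)
    length-orderings {zero}  []  = refl
    length-orderings {suc N} v = trans
      (cong +_ (orderings-rec R (λ i → isSource (toList v) (lookup v i)) (λ i → isSource-sound v (lookup v i)) (λ i → isSource-complete v (lookup v i))))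
      (sum-selections v _ _ λ i → step i (isSource (toList v) (lookup v i)))
      where
      R : Fin (suc N) → Fin (suc N) → Bool
      R i j = E (lookup v i) (lookup v j)
      step : ∀ i b → + (if b then length (orderings (delete R i)) else 0) ≡ (if b then orderingCount N (toList (removeAt v i)) else 0ℤ)
      step i false = refl
      step i true  = trans (cong +_ (length-orderings-cong λ j k →
        sym (cong₂ E (lookup-removeAt v i j) (lookup-removeAt v i k)))) (length-orderings (removeAt v i))

    topo-orderingCount : ∀ vs → + topo vs E ≡ orderingCount (length vs) vs
    topo-orderingCount vs = trans (cong +_ (length-orderings-cong λ i j → sym (cong₂ E (lookup-fromList vs i) (lookup-fromList vs j))))
      (trans (length-orderings (fromList vs)) (cong (orderingCount (length vs)) (Vecₚ.toList∘fromList vs)))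
      where
      lookup-fromList : ∀ vs i → lookup (fromList vs) i ≡ List.lookup vs i
      lookup-fromList (u ∷ vs) zero    = refl
      lookup-fromList (u ∷ vs) (suc i) = lookup-fromList vs i

-- The orderings of G_S

open import Defs

range1-suc : ∀ m → range1 (suc m) ≡ range1 m ∷ʳ suc m
range1-suc m = trans (cong (map suc) (sym (Listₚ.upTo-∷ʳ m))) (Listₚ.map-++ suc (upTo m) (m ∷ []))

chain : ℕ → List Vtx
chain m = map x (range1 m)

chain-suc : ∀ m → chain (suc m) ≡ chain m ++ x (suc m) ∷ []
chain-suc m = trans (cong (map x) (range1-suc m)) (Listₚ.map-++ x (range1 m) (suc m ∷ []))

length-range1 : ∀ m → length (range1 m) ≡ m
length-range1 m = trans (Listₚ.length-map suc (upTo m)) (Listₚ.length-upTo m)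

all-range1 : ∀ {P : ℕ → Set} m → (∀ i → 1 ≤ i → i ≤ m → P i) → All P (range1 m)
all-range1 zero    h = []
all-range1 {P} (suc m) h = subst (All P) (sym (range1-suc m))
  (Allₚ.++⁺ (all-range1 m (λ i 1≤i i≤m → h i 1≤i (ℕₚ.m≤n⇒m≤1+n i≤m))) (h (suc m) (s≤s z≤n) ℕₚ.≤-refl ∷ []))

all-concatMap-range1 : ∀ {A : Set} {P : A → Set} {f : ℕ → List A} m → (∀ i → 1 ≤ i → i ≤ m → All P (f i)) → All P (concatMap f (range1 m))
all-concatMap-range1 m h = Allₚ.concat⁺ (Allₚ.map⁺ (all-range1 m h))

any-chain : ∀ {P : Vtx → Set} m i → 1 ≤ i → i ≤ m → P (x i) → Any P (chain m)
any-chain zero    (suc i) _ () Px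
any-chain {P} (suc m) i 1≤i i≤m Px = subst (Any P) (sym (chain-suc m)) (locate (ℕₚ.m≤n⇒m<n∨m≡n i≤m))
  where
  locate : i < suc m ⊎ i ≡ suc m → Any P (chain m ++ x (suc m) ∷ [])
  locate (inj₁ (s≤s i≤m)) = Anyₚ.++⁺ˡ (any-chain m i 1≤i i≤m Px)
  locate (inj₂ refl)      = Anyₚ.++⁺ʳ (chain m) (here Px)

≡ᵇ-refl : ∀ k → (k ℕ.≡ᵇ k) ≡ true
≡ᵇ-refl zero    = refl
≡ᵇ-refl (suc k) = ≡ᵇ-refl k

≡ᵇ-≢ : ∀ {j k} → j ≢ k → (j ℕ.≡ᵇ k) ≡ false
≡ᵇ-≢ {zero}  {zero}  j≢k = ⊥-elim (j≢k refl)
≡ᵇ-≢ {zero}  {suc k} j≢k = refl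
≡ᵇ-≢ {suc j} {zero}  j≢k = refl
≡ᵇ-≢ {suc j} {suc k} j≢k = ≡ᵇ-≢ (j≢k ∘ cong suc)

module _ (n : ℕ) where

  -- A vertex other than the x i lies above x (low v) and below x (high v), where the
  -- constraint is void for low v = 0 and for high v = n + 1.
  low high : Vtx → ℕ
  low (x i)     = 0
  low (p i k)   = 0
  low (q i k)   = i
  low (r i j k) = i
  high (x i)     = 0
  high (p i k)   = i
  high (q i k)   = suc n
  high (r i j k) = j

  -- All that the count needs to know of a vertex p, q or r. `low<high` rules out chain vertices,
  -- whose two bounds are 0. The restriction `k ≤ n` and the argument `suc k` keep k away from the
  -- void bounds n + 1 and 0.
  record IsInterval (v : Vtx) : Set where
    field
      low<high : low v < high v
      above    : ∀ k → k ≤ n → GS-edge (x k) v ≡ (k ℕ.≡ᵇ high v)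
      below    : ∀ k → GS-edge v (x (suc k)) ≡ (low v ℕ.≡ᵇ suc k)
  open IsInterval

  interval-p : ∀ i k → 1 ≤ i → IsInterval (p i k)
  interval-p i k 1≤i = record { low<high = 1≤i ; above = λ _ _ → refl ; below = λ _ → refl }

  interval-q : ∀ i k → i ≤ n → IsInterval (q i k)
  interval-q i k i≤n = record
    { low<high = s≤s i≤n ; above = λ j j≤n → sym (≡ᵇ-≢ {j} {suc n} (λ { refl → ℕₚ.<-irrefl refl j≤n })) ; below = λ _ → refl }

  interval-r : ∀ i j k → i < j → IsInterval (r i j k)
  interval-r i j k i<j = record { low<high = i<j ; above = λ _ _ → refl ; below = λ _ → refl }

  no-edge : ∀ {u v} → IsInterval u → IsInterval v → GS-edge u v ≡ false
  no-edge {x _}           I J with () ← low<high I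
  no-edge {_} {x _}       I J with () ← low<high J
  no-edge {p _ _}   {p _ _}   I J = refl
  no-edge {p _ _}   {q _ _}   I J = refl
  no-edge {p _ _}   {r _ _ _} I J = refl
  no-edge {q _ _}   {p _ _}   I J = refl
  no-edge {q _ _}   {q _ _}   I J = refl
  no-edge {q _ _}   {r _ _ _} I J = refl
  no-edge {r _ _ _} {p _ _}   I J = refl
  no-edge {r _ _ _} {q _ _}   I J = refl
  no-edge {r _ _ _} {r _ _ _} I J = refl

  -- The sum of the gaps open to `v` while only K gaps exist. Since `ζ K` saturates, an upper bound
  -- by a chain vertex already removed counts as void.
  form : ∀ K → Vtx → Poly K
  form K v = ζ K (high v) ⊖ ζ K (low v)

  forms : ∀ K → List Vtx → Poly K
  forms K []       = con 1ℤ
  forms K (v ∷ vs) = form K v ⊗ forms K vs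

  drop-ζ : ∀ K j → drop (ζ (suc K) j) ≈ ζ K j
  drop-ζ K j = ≈-trans (⊕-cong (≡⇒≈ (drop-lift (ζ K j))) ≈-refl)
    (solve 2 (λ a b → a :+ b :* :con 0ℤ := a) ≈-refl (ζ K j) (con (θ K j)))

  drop-forms : ∀ K vs → drop (forms (suc K) vs) ≈ forms K vs
  drop-forms K []       = ≈-refl
  drop-forms K (v ∷ vs) = ⊗-cong (⊖-cong (drop-ζ K (high v)) (drop-ζ K (low v))) (drop-forms K vs)

  D-form : ∀ m v → low v ≤ m → D zero (form (suc m) v) ≈ con (θ m (high v))
  D-form m v low≤m = ≈-trans (∂-⊖ (D-isDerivation zero) (ζ (suc m) (high v)) (ζ (suc m) (low v)))
    (≈-trans (⊖-cong (D-ζ zero (high v)) (≈-trans (D-ζ zero (low v)) (con-cong (θ-≤ low≤m))))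
      (solve 1 (λ a → a :⊖ :con 0ℤ := a) ≈-refl (con (θ m (high v)))))

  -- A vertex that must lie above x K has no room within the lowest K gaps: both its ends are at the
  -- total. Thus the boundary term vanishes exactly as x K is barred from being removed before that
  -- vertex.
  forms-0 : ∀ K {vs} → All IsInterval vs → Any (λ v → low v ≡ K) vs → forms K vs ≈ con 0ℤ
  forms-0 K {v ∷ vs} (I ∷ _) (here refl) = ≈-trans (⊗-cong (⊖-cong (≡⇒≈ (ζ-saturates (ℕₚ.<⇒≤ (low<high I)))) ≈-refl) ≈-refl)
    (solve 2 (λ a b → (a :⊖ a) :* b := :con 0ℤ) ≈-refl (ζ K K) (forms K vs))
  forms-0 K {v ∷ vs} (_ ∷ Is) (there a) = ≈-trans (⊗-cong ≈-refl (forms-0 K Is a))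
    (solve 1 (λ a → a :* :con 0ℤ := :con 0ℤ) ≈-refl (form K v))

  -- The Leibniz rule, in which choosing the factor to differentiate is choosing the vertex to
  -- remove. `P` collects the factors already passed.
  Λ-D-forms : ∀ {m} (P : Poly (suc m)) vs → Λ (P ⊗ D zero (forms (suc m) vs)) ≡
    selectionSum vs (λ u us → Λ (P ⊗ (D zero (form (suc m) u) ⊗ forms (suc m) us)))
  Λ-D-forms P [] = Λ-cong (solve 1 (λ a → a :* :con 0ℤ := :con 0ℤ) ≈-refl P)
  Λ-D-forms {m} P (v ∷ vs) = begin
    Λ (P ⊗ (f′ ⊗ F ⊕ f ⊗ D zero F))
      ≡⟨ Λ-cong (solve 5 (λ p a b c d → p :* (a :* b :+ c :* d) := p :* (a :* b) :+ (p :* c) :* d) ≈-refl P f′ F f (D zero F)) ⟩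
    Λ (P ⊗ (f′ ⊗ F)) + Λ ((P ⊗ f) ⊗ D zero F)
      ≡⟨ cong (λ s → Λ (P ⊗ (f′ ⊗ F)) + s) (trans (Λ-D-forms (P ⊗ f) vs) (selectionSum-cong {P = λ _ → ⊤} (All.universal (λ _ → tt) vs)
           (λ {u} {us} _ _ _ → Λ-cong (solve 4 (λ p a b c → (p :* a) :* (b :* c) := p :* (b :* (a :* c))) ≈-refl
             P f (D zero (form (suc m) u)) (forms (suc m) us))))) ⟩
    selectionSum (v ∷ vs) (λ u us → Λ (P ⊗ (D zero (form (suc m) u) ⊗ forms (suc m) us))) ∎
    where
    open ≡-Reasoning
    f  = form (suc m) v
    f′ = D zero f
    F  = forms (suc m) vs

  -- The invariant of removal from the top: `v` lies above x (low v) and so leaves first, which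
  -- means that x (low v) is still among the m remaining chain vertices.
  Member : ℕ → Vtx → Set
  Member m v = IsInterval v × low v ≤ m

  source-interval : ∀ {m vs v} → m ≤ n → All (Member m) vs → Member m v → m < high v →
    isSource GS-edge (chain m ++ vs) v ≡ true
  source-interval {m} m≤n ms (I , _) m<high = isSource-true GS-edge (Allₚ.++⁺
    (Allₚ.map⁺ (all-range1 m (λ i _ i≤m → trans (above I i (ℕₚ.≤-trans i≤m m≤n)) (≡ᵇ-≢ (ℕₚ.<⇒≢ (ℕₚ.≤-<-trans i≤m m<high))))))
    (All.map (λ (J , _) → no-edge J I) ms))

  nonsource-interval : ∀ {m v} vs → m ≤ n → Member m v → high v ≤ m →
    isSource GS-edge (chain m ++ vs) v ≡ false
  nonsource-interval {m} {v} vs m≤n (I , _) high≤m = isSource-false GS-edge (Anyₚ.++⁺ˡ (any-chain m (high v)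
    (ℕₚ.≤-trans (s≤s z≤n) (low<high I)) high≤m (trans (above I (high v) (ℕₚ.≤-trans high≤m m≤n)) (≡ᵇ-refl (high v)))))

  nonsource-x : ∀ {m k} vs → k < m → isSource GS-edge (chain m ++ vs) (x k) ≡ false
  nonsource-x {m} {k} vs k<m = isSource-false GS-edge (Anyₚ.++⁺ˡ (any-chain m (suc k) (s≤s z≤n) k<m (≡ᵇ-refl k)))

  source-x : ∀ {m vs} → All (Member m) vs → isSource GS-edge (chain (suc m) ++ vs) (x (suc m)) ≡ true
  source-x {m} {vs} ms = isSource-true GS-edge {chain (suc m) ++ vs} {x (suc m)} (Allₚ.++⁺
    (Allₚ.map⁺ (all-range1 (suc m) (λ i _ i≤m → ≡ᵇ-≢ (ℕₚ.<⇒≢ (s≤s i≤m)))))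
    (All.map (λ (I , low≤m) → trans (below I m) (≡ᵇ-≢ (ℕₚ.<⇒≢ (s≤s low≤m)))) ms))

  nonsource-top : ∀ {m vs} → All IsInterval vs → Any (λ v → low v ≡ suc m) vs →
    isSource GS-edge (chain (suc m) ++ vs) (x (suc m)) ≡ false
  nonsource-top {m} Is a = isSource-false GS-edge (Anyₚ.++⁺ʳ (chain (suc m)) (edge Is a))
    where
    edge : ∀ {vs} → All IsInterval vs → Any (λ v → low v ≡ suc m) vs → Any (λ v → GS-edge v (x (suc m)) ≡ true) vs
    edge (I ∷ _)  (here e)  = here (trans (below I m) (trans (cong (ℕ._≡ᵇ suc m) e) (≡ᵇ-refl m)))
    edge (_ ∷ Is) (there a) = there (edge Is a)

  lower-or-top : ∀ {m vs} → All (Member (suc m)) vs → All (Member m) vs ⊎ Any (λ v → low v ≡ suc m) vs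
  lower-or-top [] = inj₁ []
  lower-or-top ((I , low≤) ∷ ms) with ℕₚ.m≤n⇒m<n∨m≡n low≤ | lower-or-top ms
  ... | inj₂ e          | _       = inj₂ (here e)
  ... | inj₁ _          | inj₂ a  = inj₂ (there a)
  ... | inj₁ (s≤s low≤m) | inj₁ ms′ = inj₁ ((I , low≤m) ∷ ms′)

  -- The top element of an ordering is either an interval vertex with void upper constraint
  -- or the last chain vertex; these are the two terms of Λ-by-parts in the top gap.
  orderingCount-forms : ∀ N m vs → m ℕ.+ length vs ≡ N → m ≤ n → All (Member m) vs →
    orderingCount GS-edge N (chain m ++ vs) ≡ Λ (forms (suc m) vs)
  orderingCount-forms zero    zero    [] e m≤n ms = refl
  orderingCount-forms (suc N) m       vs e m≤n ms = begin
    selectionSum (chain m ++ vs) F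
      ≡⟨ selectionSum-++ (chain m) vs F ⟩
    selectionSum (chain m) (λ u us → F u (us ++ vs)) + selectionSum vs (λ u us → F u (chain m ++ us))
      ≡⟨ cong₂ _+_ (chain-part m vs e m≤n ms) interval-part ⟩
    Λ (drop (forms (suc m) vs)) + Λ (D zero (forms (suc m) vs))
      ≡⟨ ℤₚ.+-comm _ (Λ (D zero (forms (suc m) vs))) ⟩
    Λ (D zero (forms (suc m) vs)) + Λ (drop (forms (suc m) vs))
      ≡⟨ Λ-by-parts (forms (suc m) vs) ⟨
    Λ (forms (suc m) vs) ∎
    where
    open ≡-Reasoning
    F : Vtx → List Vtx → ℤ
    F u us = if isSource GS-edge (chain m ++ vs) u then orderingCount GS-edge N us else 0ℤ

    derivative-term : ∀ {b u us} → D zero (form (suc m) u) ≈ con b →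
      Λ (con 1ℤ ⊗ (D zero (form (suc m) u) ⊗ forms (suc m) us)) ≡ b * Λ (forms (suc m) us)
    derivative-term {b} {u} {us} e = trans (Λ-cong {p = con 1ℤ ⊗ (D zero (form (suc m) u) ⊗ forms (suc m) us)}
      {con b ⊗ forms (suc m) us} (≈-trans (⊗-identityˡ _) (⊗-cong e ≈-refl))) (Λ-con b (forms (suc m) us))

    interval-term : ∀ {u us} → Member m u → All (Member m) us → suc (length us) ≡ length vs →
      F u (chain m ++ us) ≡ Λ (con 1ℤ ⊗ (D zero (form (suc m) u) ⊗ forms (suc m) us))
    interval-term {u} {us} M Ms l with m ℕ.<? high u
    ... | yes m<high = begin
      F u (chain m ++ us)
        ≡⟨ cong (λ b → if b then orderingCount GS-edge N (chain m ++ us) else 0ℤ) (source-interval m≤n ms M m<high) ⟩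
      orderingCount GS-edge N (chain m ++ us)
        ≡⟨ orderingCount-forms N m us (ℕₚ.suc-injective (trans (sym (ℕₚ.+-suc m (length us))) (trans (cong (m ℕ.+_) l) e))) m≤n Ms ⟩
      Λ (forms (suc m) us)
        ≡⟨ ℤₚ.*-identityˡ (Λ (forms (suc m) us)) ⟨
      1ℤ * Λ (forms (suc m) us)
        ≡⟨ derivative-term {1ℤ} {u} {us} (≈-trans (D-form m u (proj₂ M)) (con-cong (θ-< m<high))) ⟨
      Λ (con 1ℤ ⊗ (D zero (form (suc m) u) ⊗ forms (suc m) us)) ∎
    ... | no m≮high = trans
      (cong (λ b → if b then orderingCount GS-edge N (chain m ++ us) else 0ℤ) (nonsource-interval vs m≤n M (ℕₚ.≮⇒≥ m≮high)))
      (sym (derivative-term {0ℤ} {u} {us} (≈-trans (D-form m u (proj₂ M)) (con-cong (θ-≤ (ℕₚ.≮⇒≥ m≮high))))))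

    interval-part : selectionSum vs (λ u us → F u (chain m ++ us)) ≡ Λ (D zero (forms (suc m) vs))
    interval-part = trans (selectionSum-cong ms interval-term)
      (trans (sym (Λ-D-forms (con 1ℤ) vs)) (Λ-cong (⊗-identityˡ (D zero (forms (suc m) vs)))))

    chain-part : ∀ m vs → m ℕ.+ length vs ≡ suc N → m ≤ n → All (Member m) vs →
      selectionSum (chain m) (λ u us → if isSource GS-edge (chain m ++ vs) u then orderingCount GS-edge N (us ++ vs) else 0ℤ)
        ≡ Λ (drop (forms (suc m) vs))
    -- Without chain vertices the sum is empty. As `vs` is not, the boundary term has a factor with
    -- no gap left, and is 0 too.
    chain-part zero (v ∷ vs) e m≤n ((I , low≤0) ∷ ms) = Λ-cong (≈-sym (≈-trans (drop-forms 0 (v ∷ vs))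
      (forms-0 0 (I ∷ All.map proj₁ ms) (here (ℕₚ.n≤0⇒n≡0 low≤0)))))
    chain-part (suc m) vs e m≤n ms = begin
      selectionSum (chain (suc m)) H
        ≡⟨ cong (λ us → selectionSum us H) (chain-suc m) ⟩
      selectionSum (chain m ++ x (suc m) ∷ []) H
        ≡⟨ selectionSum-++ (chain m) (x (suc m) ∷ []) H ⟩
      selectionSum (chain m) (λ u us → H u (us ++ x (suc m) ∷ [])) + (H (x (suc m)) (chain m ++ []) + 0ℤ)
        -- Each lower chain vertex has its successor above it, so only the last one can be on top.
        ≡⟨ cong₂ _+_ (trans (selectionSum-cong (Allₚ.map⁺ (all-range1 m (λ i _ i≤m → nonsource-x vs (s≤s i≤m))))
             (λ {u} {us} s _ _ → cong (λ b → if b then orderingCount GS-edge N ((us ++ x (suc m) ∷ []) ++ vs) else 0ℤ) s)) (selectionSum-0 (chain m)))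
             (trans (ℤₚ.+-identityʳ _) (top (lower-or-top ms))) ⟩
      0ℤ + Λ (drop (forms (suc (suc m)) vs))
        ≡⟨ ℤₚ.+-identityˡ _ ⟩
      Λ (drop (forms (suc (suc m)) vs)) ∎
      where
      H : Vtx → List Vtx → ℤ
      H u us = if isSource GS-edge (chain (suc m) ++ vs) u then orderingCount GS-edge N (us ++ vs) else 0ℤ
      top : All (Member m) vs ⊎ Any (λ v → low v ≡ suc m) vs → H (x (suc m)) (chain m ++ []) ≡ Λ (drop (forms (suc (suc m)) vs))
      top (inj₁ ms′) = begin
        H (x (suc m)) (chain m ++ [])
          ≡⟨ cong (λ b → if b then orderingCount GS-edge N ((chain m ++ []) ++ vs) else 0ℤ) (source-x ms′) ⟩
        orderingCount GS-edge N ((chain m ++ []) ++ vs)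
          ≡⟨ cong (λ us → orderingCount GS-edge N (us ++ vs)) (Listₚ.++-identityʳ (chain m)) ⟩
        orderingCount GS-edge N (chain m ++ vs)
          ≡⟨ orderingCount-forms N m vs (ℕₚ.suc-injective e) (ℕₚ.<⇒≤ m≤n) ms′ ⟩
        Λ (forms (suc m) vs)
          ≡⟨ Λ-cong (drop-forms (suc m) vs) ⟨
        Λ (drop (forms (suc (suc m)) vs)) ∎
      top (inj₂ a) = trans
        (cong (λ b → if b then orderingCount GS-edge N ((chain m ++ []) ++ vs) else 0ℤ) (nonsource-top (All.map proj₁ ms) a))
        (Λ-cong (≈-sym (≈-trans (drop-forms (suc m) vs) (forms-0 (suc m) (All.map proj₁ ms) a))))

  forms-++ : ∀ K us vs → forms K (us ++ vs) ≈ forms K us ⊗ forms K vs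
  forms-++ K []       vs = ≈-sym (⊗-identityˡ _)
  forms-++ K (u ∷ us) vs = ≈-trans (⊗-cong ≈-refl (forms-++ K us vs))
    (solve 3 (λ a b c → a :* (b :* c) := a :* b :* c) ≈-refl _ _ _)

  forms-map : ∀ K {f : Poly K} (g : ℕ → Vtx) → (∀ k → form K (g k) ≈ f) → ∀ ks → forms K (map g ks) ≈ pow f (length ks)
  forms-map K g e []       = ≈-refl
  forms-map K g e (k ∷ ks) = ⊗-cong (e k) (forms-map K g e ks)

  forms-copies : ∀ K {f : Poly K} (g : ℕ → Vtx) → (∀ k → form K (g k) ≈ f) → ∀ e → forms K (map g (range1 e)) ≈ pow f e
  forms-copies K {f} g h e = ≈-trans (forms-map K g h (range1 e)) (≡⇒≈ (cong (pow f) (length-range1 e)))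

  concatMap-range1 : ∀ {A : Set} (f : ℕ → List A) m → concatMap f (range1 (suc m)) ≡ concatMap f (range1 m) ++ f (suc m)
  concatMap-range1 f m = trans (cong (concatMap f) (range1-suc m))
    (trans (Listₚ.concatMap-++ f (range1 m) (suc m ∷ [])) (cong (concatMap f (range1 m) ++_) (Listₚ.++-identityʳ (f (suc m)))))

  -- The vertex list runs upwards in i, whereas `powers` starts from index `zero`, the highest chain
  -- vertex. So the block split off is the last one of the list, and the factors are commuted.
  forms-powers : ∀ K (F : ℕ → Poly K) (g : ℕ → ℕ → Vtx) → (∀ i k → form K (g i k) ≈ F i) → ∀ e m →
    forms K (concatMap (λ i → map (g i) (range1 e)) (range1 m)) ≈ powers e (λ (i : Fin m) → F (suc (gap i)))
  forms-powers K F g h e zero    = ≈-refl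
  forms-powers K F g h e (suc m) = ≈-trans (≡⇒≈ (cong (forms K) (concatMap-range1 (λ i → map (g i) (range1 e)) m)))
    (≈-trans (forms-++ K (concatMap (λ i → map (g i) (range1 e)) (range1 m)) (map (g (suc m)) (range1 e)))
    (≈-trans (⊗-cong (forms-powers K F g h e m) (forms-copies K (g (suc m)) (h (suc m)) e)) (⊗-comm _ _)))

  forms-differences : ∀ K e m →
    forms K (concatMap (λ j → concatMap (λ i → map (r i j) (range1 e)) (range1 (j ℕ.∸ 1))) (range1 m))
      ≈ differences e (λ (i : Fin m) → ζ K (suc (gap i)))
  forms-differences K e zero    = ≈-refl
  forms-differences K e (suc m) = ≈-trans (≡⇒≈ (cong (forms K) (concatMap-range1 row m)))
    (≈-trans (forms-++ K (concatMap row (range1 m)) (row (suc m)))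
    (≈-trans (⊗-cong (forms-differences K e m)
        (forms-powers K (λ i → ζ K (suc m) ⊖ ζ K i) (λ i → r i (suc m)) (λ _ _ → ≈-refl) e m)) (⊗-comm _ _)))
    where
    row : ℕ → List Vtx
    row j = concatMap (λ i → map (r i j) (range1 e)) (range1 (j ℕ.∸ 1))

  topo-selberg : ∀ α β c → + topoGS n (suc α) (suc β) c ≡ Λ (selberg n α β c)
  topo-selberg α β c = begin
    + topoGS n (suc α) (suc β) c
      ≡⟨ topo-orderingCount GS-edge (chain n ++ vs) ⟩
    orderingCount GS-edge (length (chain n ++ vs)) (chain n ++ vs)
      ≡⟨ orderingCount-forms _ n vs (sym (trans (Listₚ.length-++ (chain n)) (cong (ℕ._+ length vs)
           (trans (Listₚ.length-map x (range1 n)) (length-range1 n))))) ℕₚ.≤-refl members ⟩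
    Λ (forms (suc n) vs)
      ≡⟨ Λ-cong (≈-trans (forms-++ (suc n) ps (qs ++ rs)) (≈-trans (⊗-cong ≈-refl (forms-++ (suc n) qs rs))
           (≈-trans (solve 3 (λ a b c → a :* (b :* c) := a :* b :* c) ≈-refl _ _ _)
             (⊗-cong (⊗-cong (forms-powers (suc n) (ζ (suc n)) p p-form α n)
               (forms-powers (suc n) (λ i → total (suc n) ⊖ ζ (suc n) i) q (λ _ _ → ≈-refl) β n))
               (forms-differences (suc n) (2 ℕ.* c) n))))) ⟩
    Λ (selberg n α β c) ∎
    where
    open ≡-Reasoning
    ps qs rs vs : List Vtx
    ps = concatMap (λ i → map (p i) (range1 α)) (range1 n)
    qs = concatMap (λ i → map (q i) (range1 β)) (range1 n)
    rs = concatMap (λ j → concatMap (λ i → map (r i j) (range1 (2 ℕ.* c))) (range1 (j ℕ.∸ 1))) (range1 n)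
    vs = ps ++ qs ++ rs
    p-form : ∀ i k → form (suc n) (p i k) ≈ ζ (suc n) i
    p-form i k = ≈-trans (⊖-cong ≈-refl (ζ-0 (suc n))) (solve 1 (λ a → a :⊖ :con 0ℤ := a) ≈-refl (ζ (suc n) i))
    members : All (Member n) vs
    members = Allₚ.++⁺
      (all-concatMap-range1 n (λ i 1≤i i≤n → Allₚ.map⁺ (All.universal (λ k → interval-p i k 1≤i , z≤n) _)))
      (Allₚ.++⁺ (all-concatMap-range1 n (λ i 1≤i i≤n → Allₚ.map⁺ (All.universal (λ k → interval-q i k i≤n , i≤n) _)))
        (all-concatMap-range1 n (λ { (suc j) _ j<n → all-concatMap-range1 j (λ i _ i≤j →
          Allₚ.map⁺ (All.universal (λ k → interval-r i (suc j) k (s≤s i≤j) , ℕₚ.≤-trans i≤j (ℕₚ.<⇒≤ j<n)) _)) })))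

-- The formula in the notation of the theorem

prodRange-∏ : ∀ n f → prodRange n f ≡ ∏ n f
prodRange-∏ zero    f = refl
prodRange-∏ (suc n) f = begin
  product (map f (upTo (suc n)))            ≡⟨ cong (product ∘ map f) (Listₚ.upTo-∷ʳ n) ⟨
  product (map f (upTo n ∷ʳ n))             ≡⟨ cong product (Listₚ.map-++ f (upTo n) (n ∷ [])) ⟩
  product (map f (upTo n) ++ f n ∷ [])      ≡⟨ product-++ (map f (upTo n)) (f n ∷ []) ⟩
  prodRange n f ℕ.* (f n ℕ.* 1)             ≡⟨ cong₂ ℕ._*_ (prodRange-∏ n f) (ℕₚ.*-identityʳ (f n)) ⟩
  ∏ n f ℕ.* f n                             ∎
  where open ≡-Reasoning

nC2 : ∀ n → n C 2 ≡ triangle n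
nC2 zero    = refl
nC2 (suc n) = trans (sym (nCk+nC[k+1]≡[n+1]C[k+1] n 1)) (cong₂ ℕ._+_ (nC1≡n n) (nC2 n))

theorem1p5 : (n a b c : ℕ) → 1 ≤ n → 1 ≤ a → 1 ≤ b → 1 ≤ c →
    topoGS n a b c
    ℕ.* prodRange n (λ j → ((c ℕ.∸ 1) !) ℕ.* ((a ℕ.+ b ℕ.+ (j ℕ.+ n ℕ.∸ 1) ℕ.* c ℕ.∸ 1) !))
    ≡ ((n ℕ.* (a ℕ.+ b ℕ.∸ 1) ℕ.+ (n C 2) ℕ.* (2 ℕ.* c)) !)
    ℕ.* prodRange n (λ j → ((a ℕ.+ c ℕ.* j ℕ.∸ 1) !) ℕ.* ((b ℕ.+ c ℕ.* j ℕ.∸ 1) !) ℕ.* ((c ℕ.+ c ℕ.* j ℕ.∸ 1) !))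
theorem1p5 n (suc α) (suc β) (suc c) _ _ _ _ = ℤₚ.+-injective (begin
  + (topoGS n (suc α) (suc β) (suc c) ℕ.* prodRange n (den n α β))
    ≡⟨ ℤₚ.pos-* (topoGS n (suc α) (suc β) (suc c)) (prodRange n (den n α β)) ⟩
  + topoGS n (suc α) (suc β) (suc c) * + prodRange n (den n α β)
    ≡⟨ cong₂ (λ t d → t * + d) (topo-selberg n α β (suc c)) (prodRange-∏ n (den n α β)) ⟩
  I n α β * + ∏ n (den n α β)
    ≡⟨ closed-form n α β ⟩
  + ((size n α β !) ℕ.* ∏ n (num n α β))
    ≡⟨ cong₂ (λ s d → + ((s !) ℕ.* d)) size≡ (sym (prodRange-∏ n (num n α β))) ⟩
  + (((n ℕ.* (α ℕ.+ suc β) ℕ.+ (n C 2) ℕ.* (2 ℕ.* suc c)) !) ℕ.* prodRange n (num n α β)) ∎)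
  where
  open ≡-Reasoning
  open ClosedForm c
  size≡ : size n α β ≡ n ℕ.* (α ℕ.+ suc β) ℕ.+ (n C 2) ℕ.* (2 ℕ.* suc c)
  size≡ = trans (lemma n α β (triangle n ℕ.* (2 ℕ.* suc c))) (cong (λ t → n ℕ.* (α ℕ.+ suc β) ℕ.+ t ℕ.* (2 ℕ.* suc c)) (sym (nC2 n)))
    where
    lemma : ∀ n α β s → n ℕ.* α ℕ.+ n ℕ.* β ℕ.+ s ℕ.+ n ≡ n ℕ.* (α ℕ.+ suc β) ℕ.+ s
    lemma = ℕ-solve-∀
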